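{- With $p_0=N$, $$\mathcal Q_4=4\theta\,\mathcal L_3(-\theta,p_0)-6\theta^2p_0\,\mathcal L_2(-\theta,p_0)+4\theta^3p_0^2E .$$ After normal ordering (all $p_a$ to the left of all $D_a$, $a\ge1$), the right-hand side is independent of $p_0$.
   Context: Let $\alpha$ be an indeterminate, $\theta=\alpha^{ -1}$, $\Lambda=\mathbb Q(\alpha)[p_1,p_2,\dots]$, $\Lambda_N=\mathbb Q(\alpha)[x_1,\dots,x_N]^{\mathfrak S_N}$, $D_a=a\,\partial/\partial p_a$, $E=\sum_{a\ge1}p_aD_a$. Definition of $\mathcal Q_4$: let $\mathcal D_i=\frac{\partial}{\partial x_i}+\theta\sum_{j\ne i}\frac{1-s_{ij}}{x_i-x_j}$ ($s_{ij}$ exchanges $x_i,x_j$), $\mathcal P_m^{(N)}=\sum_{i=1}^N(x_i\mathcal D_i)^m$ for $m\ge1$, $\mathcal P_0^{(N)}=N\,\mathrm{Id}$; these commute and preserve $\Lambda_N$. Put $\overline{\mathcal P}_m^{(N)}=\sum_{r=0}^m\binom mr(-\theta N)^{m-r}\mathcal P_r^{(N)}$, $\overline G_N(z)=1-\theta z\sum_{m\ge0}\overline{\mathcal P}_m^{(N)}z^m$, $\Phi_N(z)=(1+\theta Nz)\overline G_N(z)$. The $\Phi_N(z)$ are compatible with the specializations $x_N=0$ and define an operator-valued series $\Phi(z)$ on $\Lambda$ with commuting coefficients and constant term the identity; the operators $\mathcal Q_r$ are defined by $-\log\Phi(z)=\sum_{r\ge1}\frac{\mathcal Q_r}{r}z^r$.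 Explicitly, on $\Lambda_N$, $\mathcal Q_4$ is $4\theta(\mathcal P_3^{(N)}-2\theta N\mathcal P_2^{(N)}+\theta^2N^2\mathcal P_1^{(N)})+2\theta^2(\mathcal P_1^{(N)})^2$. Sergeev--Veselov operators: let $\overline\Lambda=\Lambda[p_0]$ with $p_0$ a formal parameter ($D_a$, $a\geq 1$, being $p_0$-linear), adjoin a variable $x$, and for a parameter $k$ put $\mathsf D_k=\partial-\frac k2\mathsf A$ on $\overline\Lambda[x]$, where $\partial$ is the derivation with $\partial(x)=x$, $\partial(p_a)=ax^a$ for $a\ge1$, $\partial(p_0)=0$, and $\mathsf A$ is the $\overline\Lambda$-linear operator with $\mathsf A(1)=0$ and $\mathsf A(x^\ell)=(p_0-2\ell)x^\ell+p_\ell+2\sum_{a=1}^{\ell-1}p_ax^{\ell-a}$ for $\ell\ge1$. Let $\mathsf{ev}:\overline\Lambda[x]\to\overline\Lambda$ be the $\overline\Lambda$-linear map with $\mathsf{ev}(x^\ell)=p_\ell$ for $\ell\ge0$. Then $\mathcal L_r(k,p_0)=\mathsf{ev}\circ\mathsf D_k^r|_{\overline\Lambda}$; setting $p_0=N$ and $p_a=\sum_ix_i^a$ it acts on $\Lambda_N$. -}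

module Defs where

open import Algebra.Bundles using (CommutativeRing)
open import Data.Bool.Base using (if_then_else_)
open import Data.Empty using (⊥-elim)
open import Data.Fin.Base using (Fin; toℕ)
open import Data.Fin.Permutation.Components using (transpose)
import Data.Fin.Properties as Fin
open import Data.List.Base using (List; []; _∷_; map; replicate; _++_)
open import Data.Nat.Base using (ℕ; zero; suc; _∸_; _⊔_)
open import Data.Nat.Combinatorics using (_C_)
open import Data.Nat.GeneralisedArithmetic using (fold)
import Data.Nat.Base as ℕ
import Data.Nat.Properties as ℕ
open import Data.Product.Base using (Σ; ∃-syntax; _×_; _,_)
open import Data.Rational.Base using (ℚ; 0ℚ; 1ℚ; Positive; NonNegative; 1/_; ≢-nonZero)
import Data.Rational.Base as ℚ
import Data.Rational.Properties as ℚ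
open import Data.Sum.Base using (_⊎_; inj₁; inj₂)
open import Function.Base using (_∘_; id)
open import Level using (0ℓ)
open import Relation.Binary.Definitions using (DecidableEquality)
open import Relation.Binary.PropositionalEquality.Core as ≡ using (_≡_)
open import Relation.Nullary using (¬_; does; yes; no)

import Algebra.Properties.AbelianGroup
import Algebra.Properties.Ring
import Algebra.Properties.Semiring.Exp
import Algebra.Properties.Semiring.Mult
import Algebra.Properties.Semiring.Sum
import Algebra.Solver.Ring.NaturalCoefficients.Default
import Relation.Binary.Reasoning.Setoid

------------------------------------------------------------------------
-- The polynomial ring R[x] in one variable: lists of coefficients,
-- constant term first, identified when all coefficients agree.

module Univariate (R : CommutativeRing 0ℓ 0ℓ) where

  private
    module R where
      open CommutativeRing R public
      open Algebra.Properties.Ring (CommutativeRing.ring R) public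
      open Algebra.Solver.Ring.NaturalCoefficients.Default
        (CommutativeRing.commutativeSemiring R) public

  infix  4 _≈_
  infixl 6 _+_
  infixl 7 _*_ _•_

  Carrier : Set
  Carrier = List R.Carrier

  coeff : Carrier → ℕ → R.Carrier
  coeff []      _       = R.0#
  coeff (a ∷ p) zero    = a
  coeff (a ∷ p) (suc n) = coeff p n

  record _≈_ (p q : Carrier) : Set where
    constructor mk≈
    field
      coeff≈ : ∀ n → coeff p n R.≈ coeff q n

  open _≈_ public

  _+_ : Carrier → Carrier → Carrier
  []      + q       = q
  (a ∷ p) + []      = a ∷ p
  (a ∷ p) + (b ∷ q) = a R.+ b ∷ p + q

  -_ : Carrier → Carrier
  - p = map R.-_ p

  _•_ : R.Carrier → Carrier → Carrier
  c • p = map (c R.*_) p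

  _*_ : Carrier → Carrier → Carrier
  []      * q = []
  (a ∷ p) * q = a • q + (R.0# ∷ p * q)

  constant : R.Carrier → Carrier
  constant c = c ∷ []

  monomial : R.Carrier → ℕ → Carrier
  monomial c n = replicate n R.0# ++ constant c

  refl : ∀ {p} → p ≈ p
  refl = mk≈ λ n → R.refl

  sym : ∀ {p q} → p ≈ q → q ≈ p
  sym (mk≈ e) = mk≈ λ n → R.sym (e n)

  trans : ∀ {p q r} → p ≈ q → q ≈ r → p ≈ r
  trans (mk≈ e) (mk≈ f) = mk≈ λ n → R.trans (e n) (f n)

  coeff-+ : ∀ p q n → coeff (p + q) n R.≈ coeff p n R.+ coeff q n
  coeff-+ []      q       n       = R.sym (R.+-identityˡ _)
  coeff-+ (a ∷ p) []      n       = R.sym (R.+-identityʳ _)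
  coeff-+ (a ∷ p) (b ∷ q) zero    = R.refl
  coeff-+ (a ∷ p) (b ∷ q) (suc n) = coeff-+ p q n

  coeff-neg : ∀ p n → coeff (- p) n R.≈ R.- coeff p n
  coeff-neg []      n       = R.sym R.-0#≈0#
  coeff-neg (a ∷ p) zero    = R.refl
  coeff-neg (a ∷ p) (suc n) = coeff-neg p n

  coeff-• : ∀ c p n → coeff (c • p) n R.≈ c R.* coeff p n
  coeff-• c []      n       = R.sym (R.zeroʳ c)
  coeff-• c (a ∷ p) zero    = R.refl
  coeff-• c (a ∷ p) (suc n) = coeff-• c p n

  ∷-cong : ∀ {a b p q} → a R.≈ b → p ≈ q → a ∷ p ≈ b ∷ q
  ∷-cong a≈b p≈q .coeff≈ zero    = a≈b
  ∷-cong a≈b p≈q .coeff≈ (suc n) = p≈q .coeff≈ n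

  0∷[]≈[] : R.0# ∷ [] ≈ []
  0∷[]≈[] .coeff≈ zero    = R.refl
  0∷[]≈[] .coeff≈ (suc n) = R.refl

  +-cong : ∀ {p p′ q q′} → p ≈ p′ → q ≈ q′ → p + q ≈ p′ + q′
  +-cong {p} {p′} {q} {q′} e f .coeff≈ n = R.trans (coeff-+ p q n)
    (R.trans (R.+-cong (e .coeff≈ n) (f .coeff≈ n)) (R.sym (coeff-+ p′ q′ n)))

  +-assoc : ∀ p q r → (p + q) + r ≈ p + (q + r)
  +-assoc []      q       r       = refl
  +-assoc (a ∷ p) []      r       = refl
  +-assoc (a ∷ p) (b ∷ q) []      = refl
  +-assoc (a ∷ p) (b ∷ q) (c ∷ r) = ∷-cong (R.+-assoc a b c) (+-assoc p q r)

  +-comm : ∀ p q → p + q ≈ q + p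
  +-comm p q .coeff≈ n = R.trans (coeff-+ p q n)
    (R.trans (R.+-comm _ _) (R.sym (coeff-+ q p n)))

  +-identityʳ : ∀ p → p + [] ≈ p
  +-identityʳ p = +-comm p []

  neg-cong : ∀ {p q} → p ≈ q → - p ≈ - q
  neg-cong {p} {q} e .coeff≈ n = R.trans (coeff-neg p n)
    (R.trans (R.-‿cong (e .coeff≈ n)) (R.sym (coeff-neg q n)))

  +-inverseˡ : ∀ p → (- p) + p ≈ []
  +-inverseˡ p .coeff≈ n = R.trans (coeff-+ (- p) p n)
    (R.trans (R.+-congʳ (coeff-neg p n)) (R.-‿inverseˡ _))

  •-cong : ∀ {a b p q} → a R.≈ b → p ≈ q → a • p ≈ b • q
  •-cong {a} {b} {p} {q} a≈b e .coeff≈ n = R.trans (coeff-• a p n)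
    (R.trans (R.*-cong a≈b (e .coeff≈ n)) (R.sym (coeff-• b q n)))

  •-distribˡ : ∀ a p q → a • (p + q) ≈ a • p + a • q
  •-distribˡ a []      q       = refl
  •-distribˡ a (b ∷ p) []      = refl
  •-distribˡ a (b ∷ p) (c ∷ q) = ∷-cong (R.distribˡ a b c) (•-distribˡ a p q)

  •-distribʳ : ∀ a b p → (a R.+ b) • p ≈ a • p + b • p
  •-distribʳ a b []      = refl
  •-distribʳ a b (c ∷ p) = ∷-cong (R.distribʳ c a b) (•-distribʳ a b p)

  •-assoc : ∀ a b p → (a R.* b) • p ≈ a • (b • p)
  •-assoc a b []      = refl
  •-assoc a b (c ∷ p) = ∷-cong (R.*-assoc a b c) (•-assoc a b p)

  •-zero : ∀ p → R.0# • p ≈ []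
  •-zero p .coeff≈ n = R.trans (coeff-• R.0# p n) (R.zeroˡ _)

  +-interchange : ∀ p q r s → (p + q) + (r + s) ≈ (p + r) + (q + s)
  +-interchange p q r s .coeff≈ n =
    R.trans (coeff-+ (p + q) (r + s) n)
    (R.trans (R.+-cong (coeff-+ p q n) (coeff-+ r s n))
    (R.trans (R.solve 4 (λ a b c d → (a R.:+ b) R.:+ (c R.:+ d) R.:= (a R.:+ c) R.:+ (b R.:+ d))
                R.refl (coeff p n) (coeff q n) (coeff r n) (coeff s n))
    (R.sym (R.trans (coeff-+ (p + r) (q + s) n)
                    (R.+-cong (coeff-+ p r n) (coeff-+ q s n))))))

  *-congˡ : ∀ p {q r} → q ≈ r → p * q ≈ p * r
  *-congˡ []      e = refl
  *-congˡ (a ∷ p) e = +-cong (•-cong R.refl e) (∷-cong R.refl (*-congˡ p e))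

  *-zeroʳ : ∀ p → p * [] ≈ []
  *-zeroʳ []      = refl
  *-zeroʳ (a ∷ p) = trans (∷-cong R.refl (*-zeroʳ p)) 0∷[]≈[]

  *-∷ʳ : ∀ p b q → p * (b ∷ q) ≈ b • p + (R.0# ∷ p * q)
  *-∷ʳ []      b q = sym 0∷[]≈[]
  *-∷ʳ (a ∷ p) b q = ∷-cong (R.+-congʳ (R.*-comm a b))
    (trans (+-cong (refl {a • q}) (*-∷ʳ p b q))
    (trans (sym (+-assoc (a • q) (b • p) (R.0# ∷ p * q)))
    (trans (+-cong (+-comm (a • q) (b • p)) refl)
    (+-assoc (b • p) (a • q) (R.0# ∷ p * q)))))

  *-comm : ∀ p q → p * q ≈ q * p
  *-comm []      q = sym (*-zeroʳ q)
  *-comm (a ∷ p) q = trans (+-cong (refl {a • q}) (∷-cong R.refl (*-comm p q)))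
    (sym (*-∷ʳ q a p))

  *-cong : ∀ {p p′ q q′} → p ≈ p′ → q ≈ q′ → p * q ≈ p′ * q′
  *-cong {p} {p′} {q} {q′} e f = trans (*-congˡ p f)
    (trans (*-comm p q′) (trans (*-congˡ q′ e) (*-comm q′ p′)))

  *-distribˡ : ∀ p q r → p * (q + r) ≈ p * q + p * r
  *-distribˡ []      q r = refl
  *-distribˡ (a ∷ p) q r = trans
    (+-cong (•-distribˡ a q r)
      (trans (∷-cong (R.sym (R.+-identityˡ _)) (*-distribˡ p q r)) refl))
    (+-interchange (a • q) (a • r) (R.0# ∷ p * q) (R.0# ∷ p * r))

  *-distribʳ : ∀ p q r → (q + r) * p ≈ q * p + r * p
  *-distribʳ p q r = trans (*-comm (q + r) p)
    (trans (*-distribˡ p q r) (+-cong (*-comm p q) (*-comm p r)))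

  •-* : ∀ a p q → (a • p) * q ≈ a • (p * q)
  •-* a []      q = refl
  •-* a (b ∷ p) q = trans
    (+-cong (•-assoc a b q) (∷-cong (R.sym (R.zeroʳ a)) (•-* a p q)))
    (sym (•-distribˡ a (b • q) (R.0# ∷ p * q)))

  0∷-* : ∀ p q → (R.0# ∷ p) * q ≈ R.0# ∷ p * q
  0∷-* p q = +-cong (•-zero q) refl

  *-assoc : ∀ p q r → (p * q) * r ≈ p * (q * r)
  *-assoc []      q r = refl
  *-assoc (a ∷ p) q r = trans (*-distribʳ r (a • q) (R.0# ∷ p * q))
    (+-cong (•-* a q r) (trans (0∷-* (p * q) r) (∷-cong R.refl (*-assoc p q r))))

  *-identityˡ : ∀ p → constant R.1# * p ≈ p
  *-identityˡ p .coeff≈ n =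
    R.trans (coeff-+ (R.1# • p) (R.0# ∷ []) n)
    (R.trans (R.+-cong (R.trans (coeff-• R.1# p n) (R.*-identityˡ _)) (0∷[]≈[] .coeff≈ n))
    (R.+-identityʳ _))

  commutativeRing : CommutativeRing 0ℓ 0ℓ
  commutativeRing = record
    { Carrier = Carrier ; _≈_ = _≈_ ; _+_ = _+_ ; _*_ = _*_ ; -_ = -_
    ; 0# = [] ; 1# = constant R.1#
    ; isCommutativeRing = record
      { isRing = record
        { +-isAbelianGroup = record
          { isGroup = record
            { isMonoid = record
              { isSemigroup = record
                { isMagma = record
                  { isEquivalence = record { refl = refl ; sym = sym ; trans = trans }
                  ; ∙-cong = +-cong }
                ; assoc = +-assoc }
              ; identity = (λ p → refl) , +-identityʳ }
            ; inverse = +-inverseˡ , (λ p → trans (+-comm p (- p)) (+-inverseˡ p))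
            ; ⁻¹-cong = neg-cong }
          ; comm = +-comm }
        ; *-cong = *-cong
        ; *-assoc = *-assoc
        ; *-identity = *-identityˡ , (λ p → trans (*-comm p _) (*-identityˡ p))
        ; distrib = *-distribˡ , *-distribʳ }
      ; *-comm = *-comm } }

------------------------------------------------------------------------
-- The field ℚ(α) of rational functions: fractions of polynomials over ℚ.

module ℚ[α] = Univariate ℚ.+-*-commutativeRing

module RationalFunctions where

  private
    module P where
      open CommutativeRing ℚ[α].commutativeRing public
      open Algebra.Properties.Ring (CommutativeRing.ring ℚ[α].commutativeRing) public
      open Algebra.Solver.Ring.NaturalCoefficients.Default
        (CommutativeRing.commutativeSemiring ℚ[α].commutativeRing) public
    open ℚ[α] using (mk≈; coeff≈; ∷-cong)

  ℚ-integral : ∀ {a b} → a ≡.≢ 0ℚ → a ℚ.* b ≡ 0ℚ → b ≡ 0ℚ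
  ℚ-integral {a} {b} a≢0 ab≡0 = begin
    b                      ≡⟨ ℚ.*-identityˡ b ⟨
    1ℚ ℚ.* b               ≡⟨ ≡.cong (ℚ._* b) (ℚ.*-inverseˡ a) ⟨
    (1/ a ℚ.* a) ℚ.* b     ≡⟨ ℚ.*-assoc (1/ a) a b ⟩
    1/ a ℚ.* (a ℚ.* b)     ≡⟨ ≡.cong (1/ a ℚ.*_) ab≡0 ⟩
    1/ a ℚ.* 0ℚ            ≡⟨ ℚ.*-zeroʳ (1/ a) ⟩
    0ℚ                     ∎
    where
    open import Relation.Binary.PropositionalEquality.Properties using (module ≡-Reasoning)
    open ≡-Reasoning
    instance
      a-nonZero : ℚ.NonZero a
      a-nonZero = ≢-nonZero a≢0

  tail≈0 : ∀ {a p} → a ∷ p P.≈ P.0# → p P.≈ P.0#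
  tail≈0 e .coeff≈ n = e .coeff≈ (suc n)

  ∷≈0 : ∀ {a p} → a ≡ 0ℚ → p P.≈ P.0# → a ∷ p P.≈ P.0#
  ∷≈0 a≡0 e .coeff≈ zero    = a≡0
  ∷≈0 a≡0 e .coeff≈ (suc n) = e .coeff≈ n

  integral : ∀ p q → p P.* q P.≈ P.0# → p P.≈ P.0# ⊎ q P.≈ P.0#
  integral []      q e = inj₁ P.refl
  integral (a ∷ p) q e with a ℚ.≟ 0ℚ
  integral (a ∷ p) q e | yes ≡.refl
    with integral p q (tail≈0 (P.trans (P.sym (ℚ[α].0∷-* p q)) e))
  ... | inj₁ p≈0 = inj₁ (∷≈0 ≡.refl p≈0)
  ... | inj₂ q≈0 = inj₂ q≈0
  integral (a ∷ p) []      e | no a≢0 = inj₂ P.refl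
  integral (a ∷ p) (b ∷ q) e | no a≢0
    with ℚ-integral a≢0 (≡.trans (≡.sym (ℚ.+-identityʳ (a ℚ.* b))) (e .coeff≈ zero))
  ... | ≡.refl
    with integral (a ∷ p) q (tail≈0 (P.trans (P.sym (P.trans (ℚ[α].*-∷ʳ (a ∷ p) 0ℚ q)
           (P.+-congʳ (ℚ[α].•-zero (a ∷ p))))) e))
  ... | inj₁ p≈0 = inj₁ p≈0
  ... | inj₂ q≈0 = inj₂ (∷≈0 ≡.refl q≈0)

  nonzero-* : ∀ {p q} → ¬ p P.≈ P.0# → ¬ q P.≈ P.0# → ¬ p P.* q P.≈ P.0#
  nonzero-* {p} {q} p≉0 q≉0 e with integral p q e
  ... | inj₁ p≈0 = p≉0 p≈0
  ... | inj₂ q≈0 = q≉0 q≈0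

  cancel : ∀ s p q → ¬ s P.≈ P.0# → s P.* p P.≈ s P.* q → p P.≈ q
  cancel s p q s≉0 e with integral s (p P.- q) (P.trans (P.distribˡ s p (P.- q))
    (P.trans (P.+-cong e (P.sym (P.-‿distribʳ-* s q))) (P.-‿inverseʳ (s P.* q))))
  ... | inj₁ s≈0   = ⊥-elim (s≉0 s≈0)
  ... | inj₂ p-q≈0 = P.x∙y⁻¹≈ε⇒x≈y p q p-q≈0

  infix  4 _≈_
  infixl 6 _+_
  infixl 7 _*_

  record ℚ⟨α⟩ : Set where
    constructor frac
    field
      num   : List ℚ
      den   : List ℚ
      den≉0 : ¬ den P.≈ P.0#

  open ℚ⟨α⟩ public

  record _≈_ (x y : ℚ⟨α⟩) : Set where
    constructor cross
    field
      cross≈ : num x P.* den y P.≈ num y P.* den x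

  1≉0 : ¬ P.1# P.≈ P.0#
  1≉0 e with e .coeff≈ zero
  ... | ()

  fromPoly : List ℚ → ℚ⟨α⟩
  fromPoly p = frac p P.1# 1≉0

  _+_ : ℚ⟨α⟩ → ℚ⟨α⟩ → ℚ⟨α⟩
  frac a b b≉0 + frac c d d≉0 =
    frac (a P.* d P.+ c P.* b) (b P.* d) (nonzero-* b≉0 d≉0)

  _*_ : ℚ⟨α⟩ → ℚ⟨α⟩ → ℚ⟨α⟩
  frac a b b≉0 * frac c d d≉0 = frac (a P.* c) (b P.* d) (nonzero-* b≉0 d≉0)

  -_ : ℚ⟨α⟩ → ℚ⟨α⟩
  - frac a b b≉0 = frac (P.- a) b b≉0

  0# 1# : ℚ⟨α⟩
  0# = fromPoly P.0#
  1# = fromPoly P.1#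

  private
    open module Reasoning = Relation.Binary.Reasoning.Setoid P.setoid
    open P using (solve; _:+_; _:*_; _:=_; con)

  trans : ∀ {x y z} → x ≈ y → y ≈ z → x ≈ z
  trans {frac a b _} {frac c d d≉0} {frac e f _} (cross p) (cross q) =
    cross (cancel d (a P.* f) (e P.* b) d≉0 (begin
      d P.* (a P.* f) ≈⟨ solve 3 (λ a d f → d :* (a :* f) := (a :* d) :* f) P.refl a d f ⟩
      (a P.* d) P.* f ≈⟨ P.*-congʳ p ⟩
      (c P.* b) P.* f ≈⟨ solve 3 (λ c b f → (c :* b) :* f := (c :* f) :* b) P.refl c b f ⟩
      (c P.* f) P.* b ≈⟨ P.*-congʳ q ⟩
      (e P.* d) P.* b ≈⟨ solve 3 (λ e d b → (e :* d) :* b := d :* (e :* b)) P.refl e d b ⟩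
      d P.* (e P.* b) ∎))

  +-cong : ∀ {x x′ y y′} → x ≈ x′ → y ≈ y′ → x + y ≈ x′ + y′
  +-cong {frac a b _} {frac a′ b′ _} {frac c d _} {frac c′ d′ _} (cross p) (cross q) =
    cross (begin
      (a P.* d P.+ c P.* b) P.* (b′ P.* d′)
        ≈⟨ solve 6 (λ a b c d b′ d′ → (a :* d :+ c :* b) :* (b′ :* d′)
             := (a :* b′) :* (d :* d′) :+ (c :* d′) :* (b :* b′)) P.refl a b c d b′ d′ ⟩
      (a P.* b′) P.* (d P.* d′) P.+ (c P.* d′) P.* (b P.* b′)
        ≈⟨ P.+-cong (P.*-congʳ p) (P.*-congʳ q) ⟩
      (a′ P.* b) P.* (d P.* d′) P.+ (c′ P.* d) P.* (b P.* b′)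
        ≈⟨ solve 6 (λ a′ b c′ d b′ d′ → (a′ :* b) :* (d :* d′) :+ (c′ :* d) :* (b :* b′)
             := (a′ :* d′ :+ c′ :* b′) :* (b :* d)) P.refl a′ b c′ d b′ d′ ⟩
      (a′ P.* d′ P.+ c′ P.* b′) P.* (b P.* d) ∎)

  *-cong : ∀ {x x′ y y′} → x ≈ x′ → y ≈ y′ → x * y ≈ x′ * y′
  *-cong {frac a b _} {frac a′ b′ _} {frac c d _} {frac c′ d′ _} (cross p) (cross q) =
    cross (begin
      (a P.* c) P.* (b′ P.* d′)
        ≈⟨ solve 4 (λ a c b′ d′ → (a :* c) :* (b′ :* d′) := (a :* b′) :* (c :* d′)) P.refl a c b′ d′ ⟩
      (a P.* b′) P.* (c P.* d′)
        ≈⟨ P.*-cong p q ⟩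
      (a′ P.* b) P.* (c′ P.* d)
        ≈⟨ solve 4 (λ a′ b c′ d → (a′ :* b) :* (c′ :* d) := (a′ :* c′) :* (b :* d)) P.refl a′ b c′ d ⟩
      (a′ P.* c′) P.* (b P.* d) ∎)

  neg-cong : ∀ {x y} → x ≈ y → - x ≈ - y
  neg-cong {frac a b _} {frac c d _} (cross p) = cross (begin
    (P.- a) P.* d   ≈⟨ P.-‿distribˡ-* a d ⟨
    P.- (a P.* d)   ≈⟨ P.-‿cong p ⟩
    P.- (c P.* b)   ≈⟨ P.-‿distribˡ-* c b ⟩
    (P.- c) P.* b   ∎)

  +-comm : ∀ x y → x + y ≈ y + x
  +-comm (frac a b _) (frac c d _) = cross (solve 4 (λ a b c d →
    (a :* d :+ c :* b) :* (d :* b) := (c :* b :+ a :* d) :* (b :* d)) P.refl a b c d)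

  *-comm : ∀ x y → x * y ≈ y * x
  *-comm (frac a b _) (frac c d _) = cross (solve 4 (λ a b c d →
    (a :* c) :* (d :* b) := (c :* a) :* (b :* d)) P.refl a b c d)

  +-identityˡ : ∀ x → 0# + x ≈ x
  +-identityˡ (frac a b _) = cross (solve 2 (λ a b →
    (con 0 :* b :+ a :* con 1) :* b := a :* (con 1 :* b)) P.refl a b)

  *-identityˡ : ∀ x → 1# * x ≈ x
  *-identityˡ (frac a b _) = cross (solve 2 (λ a b →
    (con 1 :* a) :* b := a :* (con 1 :* b)) P.refl a b)

  +-inverseˡ : ∀ x → (- x) + x ≈ 0#
  +-inverseˡ (frac a b _) = cross (begin
    ((P.- a) P.* b P.+ a P.* b) P.* P.1#  ≈⟨ P.*-identityʳ _ ⟩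
    (P.- a) P.* b P.+ a P.* b             ≈⟨ P.distribʳ b (P.- a) a ⟨
    (P.- a P.+ a) P.* b                   ≈⟨ P.*-congʳ (P.-‿inverseˡ a) ⟩
    P.0# P.* b                            ≈⟨ P.zeroˡ (b P.* b) ⟨
    P.0# P.* (b P.* b)                    ∎)

  +-assoc : ∀ x y z → (x + y) + z ≈ x + (y + z)
  +-assoc (frac a b _) (frac c d _) (frac e f _) = cross (solve 6 (λ a b c d e f →
    ((a :* d :+ c :* b) :* f :+ e :* (b :* d)) :* (b :* (d :* f))
    := (a :* (d :* f) :+ (c :* f :+ e :* d) :* b) :* ((b :* d) :* f)) P.refl a b c d e f)

  *-assoc : ∀ x y z → (x * y) * z ≈ x * (y * z)
  *-assoc (frac a b _) (frac c d _) (frac e f _) = cross (solve 6 (λ a b c d e f →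
    ((a :* c) :* e) :* (b :* (d :* f)) := (a :* (c :* e)) :* ((b :* d) :* f)) P.refl a b c d e f)

  distribˡ : ∀ x y z → x * (y + z) ≈ x * y + x * z
  distribˡ (frac a b _) (frac c d _) (frac e f _) = cross (solve 6 (λ a b c d e f →
    (a :* (c :* f :+ e :* d)) :* ((b :* d) :* (b :* f))
    := ((a :* c) :* (b :* f) :+ (a :* e) :* (b :* d)) :* (b :* (d :* f))) P.refl a b c d e f)

  distribʳ : ∀ x y z → (y + z) * x ≈ y * x + z * x
  distribʳ x y z = trans (*-comm (y + z) x)
    (trans (distribˡ x y z) (+-cong (*-comm x y) (*-comm x z)))

  commutativeRing : CommutativeRing 0ℓ 0ℓ
  commutativeRing = record
    { Carrier = ℚ⟨α⟩ ; _≈_ = _≈_ ; _+_ = _+_ ; _*_ = _*_ ; -_ = -_ ; 0# = 0# ; 1# = 1#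
    ; isCommutativeRing = record
      { isRing = record
        { +-isAbelianGroup = record
          { isGroup = record
            { isMonoid = record
              { isSemigroup = record
                { isMagma = record
                  { isEquivalence = record
                    { refl = cross P.refl ; sym = λ (cross p) → cross (P.sym p) ; trans = trans }
                  ; ∙-cong = +-cong }
                ; assoc = +-assoc }
              ; identity = +-identityˡ , (λ x → trans (+-comm x 0#) (+-identityˡ x)) }
            ; inverse = +-inverseˡ , (λ x → trans (+-comm x (- x)) (+-inverseˡ x))
            ; ⁻¹-cong = neg-cong }
          ; comm = +-comm }
        ; *-cong = *-cong
        ; *-assoc = *-assoc
        ; *-identity = *-identityˡ , (λ x → trans (*-comm x 1#) (*-identityˡ x))
        ; distrib = distribˡ , distribʳ }
      ; *-comm = *-comm } }

  α θ : ℚ⟨α⟩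
  α = fromPoly (0ℚ ∷ 1ℚ ∷ [])
  θ = frac P.1# (0ℚ ∷ 1ℚ ∷ []) α≉0
    where
    α≉0 : ¬ 0ℚ ∷ 1ℚ ∷ [] P.≈ P.0#
    α≉0 e with e .coeff≈ 1
    ... | ()

  θ*α≈1 : θ * α ≈ 1#
  θ*α≈1 = cross (solve 1 (λ a → (con 1 :* a) :* con 1 := con 1 :* (a :* con 1))
    P.refl (0ℚ ∷ 1ℚ ∷ []))

  private
    module Multℚ = Algebra.Properties.Semiring.Mult
      (CommutativeRing.semiring ℚ.+-*-commutativeRing)
    module Mult = Algebra.Properties.Semiring.Mult
      (CommutativeRing.semiring commutativeRing)

  fromℚ : ℚ → ℚ⟨α⟩
  fromℚ q = fromPoly (ℚ[α].constant q)

  nonNeg : ∀ n → NonNegative (n Multℚ.× 1ℚ)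
  nonNeg zero    = _
  nonNeg (suc n) = ℚ.nonNeg+nonNeg⇒nonNeg 1ℚ (n Multℚ.× 1ℚ) {{nonNeg n}}

  positive : ∀ n → Positive (suc n Multℚ.× 1ℚ)
  positive n = ℚ.pos+nonNeg⇒pos 1ℚ (n Multℚ.× 1ℚ) {{nonNeg n}}

  nonZero : ∀ n → ℚ.NonZero (suc n Multℚ.× 1ℚ)
  nonZero n = ℚ.pos⇒nonZero (suc n Multℚ.× 1ℚ) {{positive n}}

  1/[1+_] : ℕ → ℚ⟨α⟩
  1/[1+ n ] = fromℚ ((1/ (suc n Multℚ.× 1ℚ)) {{nonZero n}})

  fromℕ≈ : ∀ n → n Mult.× 1# ≈ fromℚ (n Multℚ.× 1ℚ)
  fromℕ≈ zero    = cross (P.*-congʳ {P.1#} {P.0#} {0ℚ ∷ []} (P.sym ℚ[α].0∷[]≈[]))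
  fromℕ≈ (suc n) = trans (+-cong {1#} {1#} (cross P.refl) (fromℕ≈ n))
    (cross (solve 2 (λ p q → (p :* con 1 :+ q :* con 1) :* con 1 := (p :+ q) :* (con 1 :* con 1))
      P.refl P.1# (ℚ[α].constant (n Multℚ.× 1ℚ))))

  1/[1+n]-inverse : ∀ n → (suc n Mult.× 1#) * 1/[1+ n ] ≈ 1#
  1/[1+n]-inverse n = trans {y = fromℚ x * 1/[1+ n ]}
    (*-cong {y = 1/[1+ n ]} {y′ = 1/[1+ n ]} (fromℕ≈ (suc n)) (cross P.refl))
    (cross (P.*-cong {ℚ[α].constant x P.* num 1/[1+ n ]} {P.1#} {P.1#} {P.1# P.* P.1#}
      (ℚ[α].∷-cong (≡.trans (ℚ.+-identityʳ _) (ℚ.*-inverseʳ x {{nonZero n}})) (P.refl {[]}))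
      (P.sym (P.*-identityˡ P.1#))))
    where
    x = suc n Multℚ.× 1ℚ

-- Everything below only uses that the scalars form a commutative ring in
-- which α and the positive integers are invertible.

record Scalars : Set₁ where
  field
    commutativeRing : CommutativeRing 0ℓ 0ℓ
  open CommutativeRing commutativeRing
  open Algebra.Properties.Semiring.Mult semiring renaming (_×_ to _×ₙ_)
  field
    α θ             : Carrier
    θ*α≈1           : θ * α ≈ 1#
    1/[1+_]         : ℕ → Carrier
    1/[1+n]-inverse : ∀ n → (suc n ×ₙ 1#) * 1/[1+ n ] ≈ 1#

ℚ⟨α⟩-scalars : Scalars
ℚ⟨α⟩-scalars = record { RationalFunctions }

------------------------------------------------------------------------
-- The polynomial ring K[X] on a set X of variables, as the free
-- commutative K-algebra on X: terms modulo the equations provable from the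
-- axioms of commutative K-algebras.

module FreeAlgebra (K : CommutativeRing 0ℓ 0ℓ) where

  private module K = CommutativeRing K

  infix  4 _≋_
  infixl 6 _⊕_
  infixl 7 _⊗_
  infix  8 ⊖_

  data Poly (X : Set) : Set where
    con     : K.Carrier → Poly X
    var     : X → Poly X
    _⊕_ _⊗_ : Poly X → Poly X → Poly X
    ⊖_      : Poly X → Poly X

  data _≋_ {X : Set} : Poly X → Poly X → Set where
    refl       : ∀ {f} → f ≋ f
    sym        : ∀ {f g} → f ≋ g → g ≋ f
    trans      : ∀ {f g h} → f ≋ g → g ≋ h → f ≋ h
    ⊕-cong     : ∀ {f f′ g g′} → f ≋ f′ → g ≋ g′ → f ⊕ g ≋ f′ ⊕ g′
    ⊗-cong     : ∀ {f f′ g g′} → f ≋ f′ → g ≋ g′ → f ⊗ g ≋ f′ ⊗ g′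
    ⊖-cong     : ∀ {f g} → f ≋ g → ⊖ f ≋ ⊖ g
    con-cong   : ∀ {a b} → a K.≈ b → con a ≋ con b
    con-+      : ∀ a b → con (a K.+ b) ≋ con a ⊕ con b
    con-*      : ∀ a b → con (a K.* b) ≋ con a ⊗ con b
    ⊕-assoc    : ∀ f g h → (f ⊕ g) ⊕ h ≋ f ⊕ (g ⊕ h)
    ⊕-comm     : ∀ f g → f ⊕ g ≋ g ⊕ f
    ⊕-identity : ∀ f → con K.0# ⊕ f ≋ f
    ⊖-inverse  : ∀ f → (⊖ f) ⊕ f ≋ con K.0#
    ⊗-assoc    : ∀ f g h → (f ⊗ g) ⊗ h ≋ f ⊗ (g ⊗ h)
    ⊗-comm     : ∀ f g → f ⊗ g ≋ g ⊗ f
    ⊗-identity : ∀ f → con K.1# ⊗ f ≋ f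
    distrib    : ∀ f g h → f ⊗ (g ⊕ h) ≋ f ⊗ g ⊕ f ⊗ h

  polynomialRing : Set → CommutativeRing 0ℓ 0ℓ
  polynomialRing X = record
    { Carrier = Poly X ; _≈_ = _≋_ ; _+_ = _⊕_ ; _*_ = _⊗_ ; -_ = ⊖_
    ; 0# = con K.0# ; 1# = con K.1#
    ; isCommutativeRing = record
      { isRing = record
        { +-isAbelianGroup = record
          { isGroup = record
            { isMonoid = record
              { isSemigroup = record
                { isMagma = record
                  { isEquivalence = record { refl = refl ; sym = sym ; trans = trans }
                  ; ∙-cong = ⊕-cong }
                ; assoc = ⊕-assoc }
              ; identity = ⊕-identity , (λ f → trans (⊕-comm f _) (⊕-identity f)) }
            ; inverse = ⊖-inverse , (λ f → trans (⊕-comm f _) (⊖-inverse f))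
            ; ⁻¹-cong = ⊖-cong }
          ; comm = ⊕-comm }
        ; *-cong = ⊗-cong
        ; *-assoc = ⊗-assoc
        ; *-identity = ⊗-identity , (λ f → trans (⊗-comm f _) (⊗-identity f))
        ; distrib = distrib , (λ f g h → trans (⊗-comm (g ⊕ h) f)
            (trans (distrib f g h) (⊕-cong (⊗-comm f g) (⊗-comm f h)))) }
      ; *-comm = ⊗-comm } }

  module _ {X : Set} where
    open Algebra.Properties.Semiring.Sum
      (CommutativeRing.semiring (polynomialRing X)) public
      using (sum; sum-syntax)
    open Algebra.Properties.Semiring.Exp
      (CommutativeRing.semiring (polynomialRing X)) public
      using () renaming (_^_ to _↑_)

  -- the K-algebra homomorphism with given values on the variables
  evalAt : {X Y : Set} → (X → Poly Y) → Poly X → Poly Y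
  evalAt v (con a) = con a
  evalAt v (var x) = v x
  evalAt v (f ⊕ g) = evalAt v f ⊕ evalAt v g
  evalAt v (f ⊗ g) = evalAt v f ⊗ evalAt v g
  evalAt v (⊖ f)   = ⊖ evalAt v f

  -- the partial derivative with respect to the variable x
  ∂/∂ : {X : Set} → DecidableEquality X → X → Poly X → Poly X
  ∂/∂ _≟_ x (con a) = con K.0#
  ∂/∂ _≟_ x (var y) = if does (x ≟ y) then con K.1# else con K.0#
  ∂/∂ _≟_ x (f ⊕ g) = ∂/∂ _≟_ x f ⊕ ∂/∂ _≟_ x g
  ∂/∂ _≟_ x (f ⊗ g) = ∂/∂ _≟_ x f ⊗ g ⊕ f ⊗ ∂/∂ _≟_ x g
  ∂/∂ _≟_ x (⊖ f)   = ⊖ ∂/∂ _≟_ x f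

module Operators (S : Scalars) where

  open Scalars S using (θ; 1/[1+_]; commutativeRing) public
  open FreeAlgebra commutativeRing public

  module K where
    open CommutativeRing commutativeRing public
    open Algebra.Properties.Semiring.Mult semiring public using () renaming (_×_ to _×ₙ_)
    open Algebra.Properties.Semiring.Exp semiring public using (_^_)

    fromℕ : ℕ → Carrier
    fromℕ n = n ×ₙ 1#

  infixr 8 _·_

  _·_ : {X : Set} → K.Carrier → Poly X → Poly X
  a · f = con a ⊗ f

  ----------------------------------------------------------------------
  -- Operators on K[x_1,…,x_N].  They preserve the symmetric polynomials
  -- Λ_N, and are only ever applied to these.

  Op : ℕ → Set
  Op N = Poly (Fin N) → Poly (Fin N)

  module _ {N : ℕ} where

    s : Fin N → Fin N → Op N
    s i j = evalAt (var ∘ transpose i j)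

    -- (1 - s_ij) / (x_i - x_j), computed by the twisted Leibniz rule;
    -- ∇-quotient shows that ∇ i j f is the quotient of f - s_ij f by
    -- x_i - x_j.
    ∇ : Fin N → Fin N → Op N
    ∇ i j (con a) = con K.0#
    ∇ i j (var k) = if does (k Fin.≟ i) then con K.1#
                    else if does (k Fin.≟ j) then ⊖ con K.1#
                    else con K.0#
    ∇ i j (f ⊕ g) = ∇ i j f ⊕ ∇ i j g
    ∇ i j (f ⊗ g) = ∇ i j f ⊗ g ⊕ s i j f ⊗ ∇ i j g
    ∇ i j (⊖ f)   = ⊖ ∇ i j f

    private
      module P where
        open CommutativeRing (polynomialRing (Fin N)) public
        open Algebra.Properties.Ring (CommutativeRing.ring (polynomialRing (Fin N))) public
        open Algebra.Properties.AbelianGroup (CommutativeRing.+-abelianGroup (polynomialRing (Fin N))) public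
          using (⁻¹-∙-comm)
      open Relation.Binary.Reasoning.Setoid P.setoid
      module Solve = Algebra.Solver.Ring.NaturalCoefficients.Default
        (CommutativeRing.commutativeSemiring (polynomialRing (Fin N)))
      open Solve using (_:+_; _:*_; _:=_)

    ∇-quotient : ∀ i j f → (var i ⊕ ⊖ var j) ⊗ ∇ i j f ≋ f ⊕ ⊖ s i j f
    ∇-quotient i j (con a) = trans (P.zeroʳ _) (sym (P.-‿inverseʳ (con a)))
    ∇-quotient i j (var k) with k Fin.≟ i
    ... | yes ≡.refl = P.*-identityʳ _
    ... | no _ with k Fin.≟ j
    ...   | yes ≡.refl = begin
      (var i ⊕ ⊖ var k) ⊗ ⊖ con K.1#   ≈⟨ P.-‿distribʳ-* _ _ ⟨
      ⊖ ((var i ⊕ ⊖ var k) ⊗ con K.1#) ≈⟨ ⊖-cong (P.*-identityʳ _) ⟩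
      ⊖ (var i ⊕ ⊖ var k)              ≈⟨ P.⁻¹-∙-comm (var i) (⊖ var k) ⟨
      ⊖ var i ⊕ ⊖ ⊖ var k              ≈⟨ ⊕-cong refl (P.-‿involutive (var k)) ⟩
      ⊖ var i ⊕ var k                  ≈⟨ ⊕-comm _ _ ⟩
      var k ⊕ ⊖ var i                  ∎
    ...   | no _ = trans (P.zeroʳ _) (sym (P.-‿inverseʳ (var k)))
    ∇-quotient i j (f ⊕ g) = begin
      d ⊗ (∇ i j f ⊕ ∇ i j g)              ≈⟨ distrib d _ _ ⟩
      d ⊗ ∇ i j f ⊕ d ⊗ ∇ i j g            ≈⟨ ⊕-cong (∇-quotient i j f) (∇-quotient i j g) ⟩
      (f ⊕ ⊖ s i j f) ⊕ (g ⊕ ⊖ s i j g)    ≈⟨ Solve.solve 4 (λ a b c d →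
                                                (a :+ b) :+ (c :+ d) := (a :+ c) :+ (b :+ d))
                                                refl f (⊖ s i j f) g (⊖ s i j g) ⟩
      (f ⊕ g) ⊕ (⊖ s i j f ⊕ ⊖ s i j g)    ≈⟨ ⊕-cong refl (P.⁻¹-∙-comm _ _) ⟩
      (f ⊕ g) ⊕ ⊖ (s i j f ⊕ s i j g)      ∎
      where d = var i ⊕ ⊖ var j
    ∇-quotient i j (f ⊗ g) = begin
      d ⊗ (∇ i j f ⊗ g ⊕ s i j f ⊗ ∇ i j g)
        ≈⟨ Solve.solve 5 (λ d a g b c → d :* (a :* g :+ b :* c) := (d :* a) :* g :+ b :* (d :* c))
             refl d (∇ i j f) g (s i j f) (∇ i j g) ⟩
      (d ⊗ ∇ i j f) ⊗ g ⊕ s i j f ⊗ (d ⊗ ∇ i j g)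
        ≈⟨ ⊕-cong (⊗-cong (∇-quotient i j f) refl) (⊗-cong refl (∇-quotient i j g)) ⟩
      (f ⊕ ⊖ s i j f) ⊗ g ⊕ s i j f ⊗ (g ⊕ ⊖ s i j g)
        ≈⟨ Solve.solve 5 (λ f a g b c → (f :+ a) :* g :+ b :* (g :+ c)
             := f :* g :+ b :* c :+ (a :+ b) :* g)
             refl f (⊖ s i j f) g (s i j f) (⊖ s i j g) ⟩
      f ⊗ g ⊕ s i j f ⊗ (⊖ s i j g) ⊕ (⊖ s i j f ⊕ s i j f) ⊗ g
        ≈⟨ ⊕-cong (⊕-cong refl (sym (P.-‿distribʳ-* _ _)))
                  (trans (⊗-cong (⊖-inverse _) refl) (P.zeroˡ g)) ⟩
      f ⊗ g ⊕ ⊖ (s i j f ⊗ s i j g) ⊕ con K.0#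
        ≈⟨ P.+-identityʳ _ ⟩
      f ⊗ g ⊕ ⊖ (s i j f ⊗ s i j g) ∎
      where d = var i ⊕ ⊖ var j
    ∇-quotient i j (⊖ f) = begin
      (var i ⊕ ⊖ var j) ⊗ ⊖ ∇ i j f    ≈⟨ P.-‿distribʳ-* _ _ ⟨
      ⊖ ((var i ⊕ ⊖ var j) ⊗ ∇ i j f)  ≈⟨ ⊖-cong (∇-quotient i j f) ⟩
      ⊖ (f ⊕ ⊖ s i j f)                ≈⟨ P.⁻¹-∙-comm f (⊖ s i j f) ⟨
      ⊖ f ⊕ ⊖ ⊖ s i j f                ∎

    𝒟 : Fin N → Op N
    𝒟 i f = ∂/∂ Fin._≟_ i f
      ⊕ θ · (∑[ j < N ] (if does (j Fin.≟ i) then con K.0# else ∇ i j f))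

    x𝒟 : Fin N → Op N
    x𝒟 i f = var i ⊗ 𝒟 i f

  𝒫 : (N : ℕ) → ℕ → Op N
  𝒫 N zero      f = K.fromℕ N · f
  𝒫 N m@(suc _) f = ∑[ i < N ] fold f (x𝒟 i) m

  𝒫̄ : (N : ℕ) → ℕ → Op N
  𝒫̄ N m f = ∑[ r < suc m ]
    ((K.fromℕ (m C toℕ r) K.* (K.- (θ K.* K.fromℕ N)) K.^ (m ∸ toℕ r)) · 𝒫 N (toℕ r) f)

  ----------------------------------------------------------------------
  -- Power series in z with operators as coefficients.

  OpSeries : ℕ → Set
  OpSeries N = ℕ → Op N

  module _ {N : ℕ} where

    infixl 6 _−ₛ_
    infixl 7 _∘ₛ_
    infixr 8 _^ₛ_

    1ₛ : OpSeries N
    1ₛ zero    f = f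
    1ₛ (suc _) f = con K.0#

    _−ₛ_ : OpSeries N → OpSeries N → OpSeries N
    (A −ₛ B) r f = A r f ⊕ ⊖ B r f

    _∘ₛ_ : OpSeries N → OpSeries N → OpSeries N
    (A ∘ₛ B) r f = ∑[ j < suc r ] A (toℕ j) (B (r ∸ toℕ j) f)

    _^ₛ_ : OpSeries N → ℕ → OpSeries N
    A ^ₛ m = fold 1ₛ (A ∘ₛ_) m

    -- - log A = ∑_{m ≥ 1} (1 - A)^m / m for A with constant term 1: since
    -- 1 - A is divisible by z, only m ≤ r contribute to the coefficient
    -- of z^r.
    -log : OpSeries N → OpSeries N
    -log A r f = ∑[ m < r ] (1/[1+ toℕ m ] · ((1ₛ −ₛ A) ^ₛ suc (toℕ m)) r f)

  -- Ḡ_N(z) = 1 - θ z ∑_m 𝒫̄_m z^m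
  Ḡ : (N : ℕ) → OpSeries N
  Ḡ N zero    f = f
  Ḡ N (suc m) f = ⊖ (θ · 𝒫̄ N m f)

  -- Φ_N(z) = (1 + θ N z) Ḡ_N(z)
  Φ : (N : ℕ) → OpSeries N
  Φ N zero    f = Ḡ N zero f
  Φ N (suc r) f = Ḡ N (suc r) f ⊕ (θ K.* K.fromℕ N) · Ḡ N r f

  𝒬 : (N : ℕ) → ℕ → Op N
  𝒬 N r f = K.fromℕ r · -log (Φ N) r f

  ----------------------------------------------------------------------
  -- Λ = K[p_1,p_2,…], in which var a is p_{a+1}, and Λ̄ = Λ[p_0], in which
  -- var a is p_a.

  Λ Λ̄ : Set
  Λ = Poly ℕ
  Λ̄ = Poly ℕ

  p : ℕ → Λ̄
  p a = var a

  ι : Λ → Λ̄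
  ι = evalAt (p ∘ suc)

  p₀↦_ : ℕ → Λ̄ → Λ
  p₀↦ N = evalAt value
    where
    value : ℕ → Λ
    value zero    = con (K.fromℕ N)
    value (suc a) = var a

  -- p_a ↦ x_1^a + ⋯ + x_N^a
  π : (N : ℕ) → Λ → Poly (Fin N)
  π N = evalAt λ a → ∑[ i < N ] (var i ↑ suc a)

  -- An operator on Λ that is defined through compatible operators F N on the
  -- Λ_N is the operator T with this property; it is unique because a
  -- polynomial in the p_a that vanishes in every Λ_N is zero.  As π N is a
  -- surjection onto Λ_N and -log is formed coefficientwise, the operator 𝒬_r
  -- on Λ is the T with T Induces (λ N → 𝒬 N r).
  _Induces_ : (Λ → Λ) → ((N : ℕ) → Op N) → Set
  T Induces F = ∀ N g → π N (T g) ≋ F N (π N g)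

  _at-p₀=_ : (Λ̄ → Λ̄) → ℕ → Λ → Λ
  (T at-p₀= N) g = (p₀↦ N) (T (ι g))

  ----------------------------------------------------------------------
  -- Differential operators on Λ̄.

  D : ℕ → Λ̄ → Λ̄
  D a f = K.fromℕ a · ∂/∂ ℕ._≟_ a f

  -- D a f vanishes for a > bound f
  bound : Λ̄ → ℕ
  bound (con _) = 0
  bound (var a) = a
  bound (f ⊕ g) = bound f ⊔ bound g
  bound (f ⊗ g) = bound f ⊔ bound g
  bound (⊖ f)   = bound f

  E : Λ̄ → Λ̄
  E f = ∑[ a < bound f ] (p (suc (toℕ a)) ⊗ D (suc (toℕ a)) f)

  -- ∑ c_{a_1…a_r} D_{a_1} ⋯ D_{a_r} f over all 1 ≤ a_1,…,a_r ≤ b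
  normalOrderedPart : (b r : ℕ) → (List ℕ → Λ̄) → Λ̄ → Λ̄
  normalOrderedPart b zero    c f = c [] ⊗ f
  normalOrderedPart b (suc r) c f = ∑[ a < b ]
    normalOrderedPart b r (λ as → c (suc (toℕ a) ∷ as)) (D (suc (toℕ a)) f)

  -- ∑_{r ≤ R} ∑_{a_1,…,a_r ≥ 1} c_{a_1…a_r} D_{a_1} ⋯ D_{a_r}
  normalOrdered : ℕ → (List ℕ → Λ̄) → Λ̄ → Λ̄
  normalOrdered R c f = ∑[ r < suc R ] normalOrderedPart (bound f) (toℕ r) c f

  -- T has a normally ordered form in which p_0 does not occur.  T determines
  -- the coefficients c up to symmetrisation in a_1,…,a_r (the D_a commute),
  -- so the normally ordered form of T is then independent of p_0.
  NormalOrderIndependentOf-p₀ : (Λ̄ → Λ̄) → Set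
  NormalOrderIndependentOf-p₀ T =
    ∃[ R ] Σ (List ℕ → Λ) λ c → ∀ f → T f ≋ normalOrdered R (ι ∘ c) f

  ----------------------------------------------------------------------
  -- The operators of Sergeev and Veselov, on Λ̄[x].

  module Λ̄[x] = Univariate (polynomialRing ℕ)

  open Λ̄[x] using (monomial; constant; _•_) renaming (Carrier to Λ̄[x]; _+_ to _+ₓ_; -_ to -ₓ_)

  open Algebra.Properties.Semiring.Sum (CommutativeRing.semiring Λ̄[x].commutativeRing)
    using () renaming (sum to sumₓ)

  -- ∂ on Λ̄
  ∂₀ : Λ̄ → Λ̄[x]
  ∂₀ (con _)         = []
  ∂₀ (var zero)      = []
  ∂₀ (var a@(suc _)) = monomial (con (K.fromℕ a)) a
  ∂₀ (f ⊕ g)         = ∂₀ f +ₓ ∂₀ g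
  ∂₀ (f ⊗ g)         = g • ∂₀ f +ₓ f • ∂₀ g
  ∂₀ (⊖ f)           = -ₓ ∂₀ f

  -- ∂(c + xF) = ∂c + xF + x∂F
  ∂ : Λ̄[x] → Λ̄[x]
  ∂ []      = []
  ∂ (c ∷ F) = ∂₀ c +ₓ (con K.0# ∷ (F +ₓ ∂ F))

  -- A(x^ℓ)
  Aₓ : ℕ → Λ̄[x]
  Aₓ zero      = []
  Aₓ ℓ@(suc m) = monomial (p 0 ⊕ ⊖ con (K.fromℕ (2 ℕ.* ℓ))) ℓ
    +ₓ constant (p ℓ)
    +ₓ con (K.fromℕ 2) • sumₓ {m} (λ a → monomial (p (suc (toℕ a))) (ℓ ∸ suc (toℕ a)))

  A : Λ̄[x] → Λ̄[x]
  A = extend Aₓ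
    where
    -- the Λ̄-linear map sending x^ℓ to b ℓ
    extend : (ℕ → Λ̄[x]) → Λ̄[x] → Λ̄[x]
    extend b []      = []
    extend b (c ∷ F) = c • b 0 +ₓ extend (b ∘ suc) F

  𝖣 : K.Carrier → Λ̄[x] → Λ̄[x]
  𝖣 k F = ∂ F +ₓ -ₓ (con (k K.* 1/[1+ 1 ]) • A F)

  ev : Λ̄[x] → Λ̄
  ev = extend p
    where
    extend : (ℕ → Λ̄) → Λ̄[x] → Λ̄
    extend b []      = con K.0#
    extend b (c ∷ F) = c ⊗ b 0 ⊕ extend (b ∘ suc) F

  𝓛 : ℕ → K.Carrier → Λ̄ → Λ̄
  𝓛 r k f = ev (fold (constant f) (𝖣 k) r)

open Operators ℚ⟨α⟩-scalars public
  using (module K; θ; _⊕_; _⊗_; ⊖_; _↑_; _·_; Λ; Λ̄; p; 𝒬; E; 𝓛; _at-p₀=_; _Induces_;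
         NormalOrderIndependentOf-p₀)

module Submission where

-- Let T = ∂ + Θ on Λ̄[x], where Θ(1) = 0 and
-- Θ(x^ℓ) = θ (- ℓ x^ℓ + ∑_{0<a<ℓ} p_a x^{ℓ-a}).  On x Λ̄[x] the operator
-- 𝖣_{-θ} equals T + (θ/2) p_0 + (θ/2) ev, and T does not involve p_0; the terms
-- with p_0 on the right-hand side of the identity cancel, which leaves
--   4 θ ev T² ∂ + 2 θ² E².                                            (∗)
-- Moving the derivatives in (∗) to the right gives a normally ordered form
-- without p_0.  On the other hand, substituting x_i for x and power sums for the
-- p_a turns T + θ M into the operator x_i 𝒟_i on Λ_M[x_i]; hence (∗) induces
-- 4 θ (P_3 - 2 θ M P_2 + θ² M² P_1) + 2 θ² P_1², and this is the explicit
-- form of 𝒬_4, because the coefficient of z in Φ_M(z) vanishes.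

open import Algebra.Bundles using (CommutativeMonoid; CommutativeRing; RawRing)
open import Algebra.Solver.Ring.AlmostCommutativeRing
  using (AlmostCommutativeRing; fromCommutativeRing; _-Raw-AlmostCommutative⟶_)
open import Data.Bool.Base using (Bool; true; false; if_then_else_)
open import Data.Fin.Base using (Fin; zero; suc; toℕ)
import Data.Fin.Permutation as Permutation
open import Data.Fin.Permutation.Components using (transpose)
import Data.Fin.Properties as Fin
open import Data.List.Base using (List; []; _∷_; replicate; _++_)
open import Data.Maybe.Base using (Maybe; just; nothing)
open import Data.Nat.Base as ℕ using (ℕ; zero; suc; _∸_; _≤_; _<_; z≤n; s≤s)
open import Data.Nat.Combinatorics using () renaming (_C_ to _choose_)
open import Data.Nat.GeneralisedArithmetic using (fold)
import Data.Nat.Properties as ℕ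
open import Data.Product.Base using (_×_; _,_)
open import Defs using (Scalars; module Operators)
open import Function.Base using (_∘_; id)
open import Level using (0ℓ)
open import Relation.Binary.Definitions using (DecidableEquality)
open import Relation.Binary.PropositionalEquality.Core as ≡ using (_≡_; _≢_)
open import Relation.Nullary using (does; yes; no; contradiction)
open import Relation.Nullary.Decidable using (dec-true; dec-false)
import Algebra.Properties.AbelianGroup
import Algebra.Properties.CommutativeMonoid.Sum
import Algebra.Properties.CommutativeSemigroup
import Algebra.Properties.Ring
import Algebra.Properties.Semiring.Mult
import Algebra.Properties.Semiring.Mult.TCOptimised
import Algebra.Properties.Semiring.Sum
import Algebra.Solver.Ring
import Algebra.Solver.Ring.NaturalCoefficients.Default
import Relation.Binary.Reasoning.Setoid

-- The quadratic combination of the P_r comes from a shift. Write X_i for x_i 𝒟_i and c = θ M. As (X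
-- - c)^m + c (X - c)^{m-1} = X (X - c)^{m-1}, the coefficient of z^{m+1} in 1 - Φ_M is θ ∑ X_i (X_i
-- - c)^{m-1} for m ≥ 1. On symmetric polynomials X_i corresponds to `∂`, and X_i - c corresponds to
-- `T` on x Λ̄[x]; so the coefficient of z^4 is θ `ev` `T`² `∂`, from which M has disappeared. The
-- square of the coefficient of z² contributes the term with E².
--
-- The restriction to x Λ̄[x] has to be tracked throughout: on a constant `𝖣` is just `∂`, and `ev`
-- 1 = p_0 bears no relation to M. The constants that (θ/2) `ev` creates are treated separately, and
-- they are the source of E² on the side of the 𝓛_r.
--
-- The rings consist of terms modulo derivable equations, without normal forms or a cancellation law
-- at hand. Operators are therefore checked against the ring axioms, and no argument divides by x_i
-- - x_j.

-- A ring solver with integer coefficients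

module IntegerSolver (R : CommutativeRing 0ℓ 0ℓ) where

  private
    module R where
      open CommutativeRing R public
      open Algebra.Properties.Ring ring public
      open Algebra.Properties.AbelianGroup +-abelianGroup public using (⁻¹-∙-comm)
      open Algebra.Properties.Semiring.Mult.TCOptimised semiring public
        renaming (_×_ to _×ₙ_)
    open R using (Carrier; _≈_; _+_; _*_; -_; _×ₙ_; 0#; 1#)
    module Nat = Algebra.Solver.Ring.NaturalCoefficients.Default R.commutativeSemiring
    open Relation.Binary.Reasoning.Setoid R.setoid

    -- The pair (a , b) stands for the integer a - b.  Reducing after every
    -- operation makes equal coefficients syntactically equal, as solve demands.
    reduce : ℕ × ℕ → ℕ × ℕ
    reduce (a , b) = a ℕ.∸ b , b ℕ.∸ a

    ℤ-ring : RawRing 0ℓ 0ℓ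
    ℤ-ring = record
      { Carrier = ℕ × ℕ
      ; _≈_ = _≡_
      ; _+_ = λ (a , b) (c , d) → reduce (a ℕ.+ c , b ℕ.+ d)
      ; _*_ = λ (a , b) (c , d) → reduce (a ℕ.* c ℕ.+ b ℕ.* d , a ℕ.* d ℕ.+ b ℕ.* c)
      ; -_  = λ (a , b) → b , a
      ; 0#  = 0 , 0
      ; 1#  = 1 , 0 }

    -- The case `b = 0` is separate so that a constant `:# k` denotes `k ×ₙ 1#` itself, without a
    -- summand for the negative part. With the optimised multiples, `:# 0` and `:# 1` then denote
    -- `0#` and `1#` by definition, and goals match without conversion.
    ⟦_⟧ : ℕ × ℕ → Carrier
    ⟦ a , zero  ⟧ = a ×ₙ 1#
    ⟦ a , suc b ⟧ = a ×ₙ 1# + - (suc b ×ₙ 1#)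

    difference : ∀ a b → ⟦ a , b ⟧ ≈ a ×ₙ 1# + - (b ×ₙ 1#)
    difference a zero    = R.sym (R.trans (R.+-congˡ R.-0#≈0#) (R.+-identityʳ _))
    difference a (suc b) = R.refl

    -- Serves twice: it justifies `reduce`, and it turns the decidable equation in ℕ into equality
    -- of coefficients for the solver.
    difference≈ : ∀ a b c d → a ℕ.+ d ≡ c ℕ.+ b → ⟦ a , b ⟧ ≈ ⟦ c , d ⟧
    difference≈ a b c d e = begin
      ⟦ a , b ⟧                  ≈⟨ difference a b ⟩
      A + - B                    ≈⟨ R.+-identityʳ _ ⟨
      A + - B + 0#               ≈⟨ R.+-congˡ (R.-‿inverseʳ D) ⟨
      A + - B + (D + - D)        ≈⟨ Nat.solve 4 (λ a b d e → a Nat.:+ b Nat.:+ (d Nat.:+ e)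
                                      Nat.:= a Nat.:+ d Nat.:+ (b Nat.:+ e)) R.refl A (- B) D (- D) ⟩
      A + D + (- B + - D)        ≈⟨ R.+-congʳ (R.×-homo-+ 1# a d) ⟨
      (a ℕ.+ d) ×ₙ 1# + (- B + - D) ≡⟨ ≡.cong (λ n → n ×ₙ 1# + (- B + - D)) e ⟩
      (c ℕ.+ b) ×ₙ 1# + (- B + - D) ≈⟨ R.+-congʳ (R.×-homo-+ 1# c b) ⟩
      C + B + (- B + - D)        ≈⟨ Nat.solve 4 (λ c b b′ d → c Nat.:+ b Nat.:+ (b′ Nat.:+ d)
                                      Nat.:= c Nat.:+ d Nat.:+ (b Nat.:+ b′)) R.refl C B (- B) (- D) ⟩
      C + - D + (B + - B)        ≈⟨ R.+-congˡ (R.-‿inverseʳ B) ⟩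
      C + - D + 0#               ≈⟨ R.+-identityʳ _ ⟩
      C + - D                    ≈⟨ difference c d ⟨
      ⟦ c , d ⟧                  ∎
      where
      A = a ×ₙ 1#
      B = b ×ₙ 1#
      C = c ×ₙ 1#
      D = d ×ₙ 1#

    reduce≈ : ∀ a b → ⟦ reduce (a , b) ⟧ ≈ ⟦ a , b ⟧
    reduce≈ a b = difference≈ (a ℕ.∸ b) (b ℕ.∸ a) a b (balance a b)
      where
      balance : ∀ a b → a ℕ.∸ b ℕ.+ b ≡ a ℕ.+ (b ℕ.∸ a)
      balance zero    zero    = ≡.refl
      balance zero    (suc b) = ≡.refl
      balance (suc a) zero    = ≡.refl
      balance (suc a) (suc b) = ≡.trans (ℕ.+-suc (a ℕ.∸ b) b) (≡.cong suc (balance a b))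

    +-homo : ∀ x y → ⟦ RawRing._+_ ℤ-ring x y ⟧ ≈ ⟦ x ⟧ + ⟦ y ⟧
    +-homo (a , b) (c , d) = begin
      ⟦ reduce (a ℕ.+ c , b ℕ.+ d) ⟧
        ≈⟨ reduce≈ (a ℕ.+ c) (b ℕ.+ d) ⟩
      ⟦ a ℕ.+ c , b ℕ.+ d ⟧
        ≈⟨ difference (a ℕ.+ c) (b ℕ.+ d) ⟩
      (a ℕ.+ c) ×ₙ 1# + - ((b ℕ.+ d) ×ₙ 1#)
        ≈⟨ R.+-cong (R.×-homo-+ 1# a c) (R.-‿cong (R.×-homo-+ 1# b d)) ⟩
      (A + C) + - (B + D)
        ≈⟨ R.+-congˡ (R.⁻¹-∙-comm B D) ⟨
      (A + C) + (- B + - D)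
        ≈⟨ Nat.solve 4 (λ a c b d → (a Nat.:+ c) Nat.:+ (b Nat.:+ d) Nat.:= (a Nat.:+ b) Nat.:+ (c Nat.:+ d))
             R.refl A C (- B) (- D) ⟩
      (A + - B) + (C + - D)
        ≈⟨ R.+-cong (difference a b) (difference c d) ⟨
      ⟦ a , b ⟧ + ⟦ c , d ⟧ ∎
      where
      A = a ×ₙ 1#
      B = b ×ₙ 1#
      C = c ×ₙ 1#
      D = d ×ₙ 1#

    *-homo : ∀ x y → ⟦ RawRing._*_ ℤ-ring x y ⟧ ≈ ⟦ x ⟧ * ⟦ y ⟧
    *-homo (a , b) (c , d) = begin
      ⟦ reduce (a ℕ.* c ℕ.+ b ℕ.* d , a ℕ.* d ℕ.+ b ℕ.* c) ⟧
        ≈⟨ reduce≈ (a ℕ.* c ℕ.+ b ℕ.* d) (a ℕ.* d ℕ.+ b ℕ.* c) ⟩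
      ⟦ a ℕ.* c ℕ.+ b ℕ.* d , a ℕ.* d ℕ.+ b ℕ.* c ⟧
        ≈⟨ difference (a ℕ.* c ℕ.+ b ℕ.* d) (a ℕ.* d ℕ.+ b ℕ.* c) ⟩
      (a ℕ.* c ℕ.+ b ℕ.* d) ×ₙ 1# + - ((a ℕ.* d ℕ.+ b ℕ.* c) ×ₙ 1#)
        ≈⟨ R.+-cong (products a c b d) (R.-‿cong (products a d b c)) ⟩
      (A * C + B * D) + - (A * D + B * C)
        ≈⟨ R.+-cong (R.+-congˡ (R.sym (neg*neg B D)))
                    (R.trans (R.sym (R.⁻¹-∙-comm _ _))
                             (R.+-cong (R.-‿distribʳ-* A D) (R.-‿distribˡ-* B C))) ⟩
      (A * C + - B * - D) + (A * - D + - B * C)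
        ≈⟨ Nat.solve 4 (λ a b c d → (a Nat.:* c Nat.:+ b Nat.:* d) Nat.:+ (a Nat.:* d Nat.:+ b Nat.:* c)
             Nat.:= (a Nat.:+ b) Nat.:* (c Nat.:+ d)) R.refl A (- B) C (- D) ⟩
      (A + - B) * (C + - D)
        ≈⟨ R.*-cong (difference a b) (difference c d) ⟨
      ⟦ a , b ⟧ * ⟦ c , d ⟧ ∎
      where
      A = a ×ₙ 1#
      B = b ×ₙ 1#
      C = c ×ₙ 1#
      D = d ×ₙ 1#

      products : ∀ a c b d → (a ℕ.* c ℕ.+ b ℕ.* d) ×ₙ 1#
        ≈ (a ×ₙ 1#) * (c ×ₙ 1#) + (b ×ₙ 1#) * (d ×ₙ 1#)
      products a c b d = R.trans (R.×-homo-+ 1# (a ℕ.* c) (b ℕ.* d))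
        (R.+-cong (R.×1-homo-* a c) (R.×1-homo-* b d))

      neg*neg : ∀ x y → - x * - y ≈ x * y
      neg*neg x y = R.trans (R.sym (R.-‿distribˡ-* x (- y)))
        (R.trans (R.-‿cong (R.sym (R.-‿distribʳ-* x y))) (R.-‿involutive (x * y)))

    -‿homo : ∀ x → ⟦ RawRing.-_ ℤ-ring x ⟧ ≈ - ⟦ x ⟧
    -‿homo (a , b) = begin
      ⟦ b , a ⟧                        ≈⟨ difference b a ⟩
      b ×ₙ 1# + - (a ×ₙ 1#)            ≈⟨ R.+-comm _ _ ⟩
      - (a ×ₙ 1#) + b ×ₙ 1#            ≈⟨ R.+-congˡ (R.-‿involutive _) ⟨
      - (a ×ₙ 1#) + - - (b ×ₙ 1#)      ≈⟨ R.⁻¹-∙-comm _ _ ⟩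
      - (a ×ₙ 1# + - (b ×ₙ 1#))        ≈⟨ R.-‿cong (difference a b) ⟨
      - ⟦ a , b ⟧                      ∎

    ring : AlmostCommutativeRing 0ℓ 0ℓ
    ring = fromCommutativeRing R

    morphism : ℤ-ring -Raw-AlmostCommutative⟶ ring
    morphism = record
      { ⟦_⟧ = ⟦_⟧ ; +-homo = +-homo ; *-homo = *-homo ; -‿homo = -‿homo
      ; 0-homo = R.refl ; 1-homo = R.refl }

    _≟_ : ∀ x y → Maybe (⟦ x ⟧ ≈ ⟦ y ⟧)
    (a , b) ≟ (c , d) with a ℕ.+ d ℕ.≟ c ℕ.+ b
    ... | yes e = just (difference≈ a b c d e)
    ... | no  _ = nothing

  open Algebra.Solver.Ring ℤ-ring ring morphism _≟_ public
    using (Polynomial; solve; _:=_; _:+_; _:*_; :-_; con)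

  :# : ∀ {n} → ℕ → Polynomial n
  :# k = con (k , 0)

-- Congruences, sums and scalars in polynomial algebras

module Generic (S : Scalars) where

  open Operators S

  module Ring {X : Set} where
    open CommutativeRing (polynomialRing X) public
      using (setoid; zeroˡ; zeroʳ; +-identityʳ; *-identityʳ; -‿inverseʳ; +-commutativeMonoid; semiring)
    open Algebra.Properties.Ring (CommutativeRing.ring (polynomialRing X)) public
      using (-0#≈0#)
    open Algebra.Properties.Semiring.Sum semiring public
      using (sum-cong-≋; ∑-distrib-+; ∑-comm; *-distribˡ-sum; *-distribʳ-sum; sum-replicate-zero)
    open Algebra.Properties.Semiring.Mult.TCOptimised semiring public
      using (×-homo-+; ×1-homo-*) renaming (_×_ to _×′_; ×ᵤ≈× to ×≈×′)
    open Algebra.Properties.Semiring.Mult semiring public using (_×_)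

  module Solver {X : Set} = IntegerSolver (polynomialRing X)
  module ≋-Reasoning {X : Set} = Relation.Binary.Reasoning.Setoid (Ring.setoid {X})
  open Solver using (_:+_; _:*_; _:=_; :-_; :#)

  private variable
    X Y : Set

  -- the form in which the solver presents the integer n
  #_ : ℕ → Poly X
  # n = n Ring.×′ con K.1#

  con-fromℕ : ∀ n → con {X = X} (K.fromℕ n) ≋ # n
  con-fromℕ n = trans (unoptimised n) (Ring.×≈×′ n (con K.1#))
    where
    unoptimised : ∀ n → con (K.fromℕ n) ≋ n Ring.× con {X = X} K.1#
    unoptimised zero    = refl
    unoptimised (suc n) = trans (con-+ _ _) (⊕-cong refl (unoptimised n))

  con-neg : ∀ a → con (K.- a) ≋ ⊖ con {X = X} a
  con-neg a = begin
    con (K.- a)                        ≈⟨ Solver.solve 2 (λ a b → b := (b :+ a) :+ :- a) refl (con a) (con (K.- a)) ⟩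
    con (K.- a) ⊕ con a ⊕ ⊖ con a      ≈⟨ ⊕-cong (con-+ _ _) refl ⟨
    con (K.- a K.+ a) ⊕ ⊖ con a        ≈⟨ ⊕-cong (con-cong (K.-‿inverseˡ a)) refl ⟩
    con K.0# ⊕ ⊖ con a                 ≈⟨ ⊕-identity _ ⟩
    ⊖ con a                            ∎
    where open ≋-Reasoning

  con-^ : ∀ a n → con (a K.^ n) ≋ con {X = X} a ↑ n
  con-^ a zero    = refl
  con-^ a (suc n) = trans (con-* _ _) (⊗-cong refl (con-^ a n))

  half : con {X = X} K.1# ≋ # 2 ⊗ con 1/[1+ 1 ]
  half = trans (con-cong (K.sym (Scalars.1/[1+n]-inverse S 1))) (trans (con-* _ _) (⊗-cong (con-fromℕ 2) refl))

  ≡⇒≋ : {f g : Poly X} → f ≡ g → f ≋ g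
  ≡⇒≋ ≡.refl = refl

  ↑-cong : ∀ {f g : Poly X} n → f ≋ g → f ↑ n ≋ g ↑ n
  ↑-cong zero    e = refl
  ↑-cong (suc n) e = ⊗-cong e (↑-cong n e)

  sum-0 : ∀ n {f : Fin n → Poly X} → (∀ i → f i ≋ con K.0#) → sum f ≋ con K.0#
  sum-0 n e = trans (Ring.sum-cong-≋ e) (Ring.sum-replicate-zero n)

  -- Since `≋` is generated by the axioms, a map defined by recursion on terms has to respect each
  -- axiom separately. The same pattern recurs for `∂/∂` and `∇`.
  evalAt-cong : ∀ (v : X → Poly Y) {f g} → f ≋ g → evalAt v f ≋ evalAt v g
  evalAt-cong v refl               = refl
  evalAt-cong v (sym e)            = sym (evalAt-cong v e)
  evalAt-cong v (trans e e′)       = trans (evalAt-cong v e) (evalAt-cong v e′)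
  evalAt-cong v (⊕-cong e e′)      = ⊕-cong (evalAt-cong v e) (evalAt-cong v e′)
  evalAt-cong v (⊗-cong e e′)      = ⊗-cong (evalAt-cong v e) (evalAt-cong v e′)
  evalAt-cong v (⊖-cong e)         = ⊖-cong (evalAt-cong v e)
  evalAt-cong v (con-cong e)       = con-cong e
  evalAt-cong v (con-+ a b)        = con-+ a b
  evalAt-cong v (con-* a b)        = con-* a b
  evalAt-cong v (⊕-assoc f g h)    = ⊕-assoc _ _ _
  evalAt-cong v (⊕-comm f g)       = ⊕-comm _ _
  evalAt-cong v (⊕-identity f)     = ⊕-identity _
  evalAt-cong v (⊖-inverse f)      = ⊖-inverse _
  evalAt-cong v (⊗-assoc f g h)    = ⊗-assoc _ _ _
  evalAt-cong v (⊗-comm f g)       = ⊗-comm _ _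
  evalAt-cong v (⊗-identity f)     = ⊗-identity _
  evalAt-cong v (distrib f g h)    = distrib _ _ _

  evalAt-sum : ∀ (v : X → Poly Y) n (f : Fin n → Poly X) → evalAt v (sum f) ≡ ∑[ i < n ] evalAt v (f i)
  evalAt-sum v zero    f = ≡.refl
  evalAt-sum v (suc n) f = ≡.cong (evalAt v (f zero) ⊕_) (evalAt-sum v n (f ∘ suc))

  evalAt-↑ : ∀ (v : X → Poly Y) f n → evalAt v (f ↑ n) ≡ evalAt v f ↑ n
  evalAt-↑ v f zero    = ≡.refl
  evalAt-↑ v f (suc n) = ≡.cong (evalAt v f ⊗_) (evalAt-↑ v f n)

  module _ (_≟_ : DecidableEquality X) (x : X) where

    private
      d : Poly X → Poly X
      d = ∂/∂ _≟_ x

    ∂/∂-cong : ∀ {f g} → f ≋ g → d f ≋ d g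
    ∂/∂-cong refl            = refl
    ∂/∂-cong (sym e)         = sym (∂/∂-cong e)
    ∂/∂-cong (trans e e′)    = trans (∂/∂-cong e) (∂/∂-cong e′)
    ∂/∂-cong (⊕-cong e e′)   = ⊕-cong (∂/∂-cong e) (∂/∂-cong e′)
    ∂/∂-cong (⊗-cong e e′)   = ⊕-cong (⊗-cong (∂/∂-cong e) e′) (⊗-cong e (∂/∂-cong e′))
    ∂/∂-cong (⊖-cong e)      = ⊖-cong (∂/∂-cong e)
    ∂/∂-cong (con-cong e)    = refl
    ∂/∂-cong (con-+ a b)     = sym (⊕-identity _)
    ∂/∂-cong (con-* a b)     = Solver.solve 2 (λ a b → :# 0 := :# 0 :* b :+ a :* :# 0) refl (con a) (con b)
    ∂/∂-cong (⊕-assoc f g h) = ⊕-assoc _ _ _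
    ∂/∂-cong (⊕-comm f g)    = ⊕-comm _ _
    ∂/∂-cong (⊕-identity f)  = ⊕-identity _
    ∂/∂-cong (⊖-inverse f)   = ⊖-inverse _
    ∂/∂-cong (⊗-assoc f g h) = Solver.solve 6 (λ f g h f′ g′ h′ →
      (f′ :* g :+ f :* g′) :* h :+ (f :* g) :* h′ := f′ :* (g :* h) :+ f :* (g′ :* h :+ g :* h′))
      refl f g h (d f) (d g) (d h)
    ∂/∂-cong (⊗-comm f g)    = Solver.solve 4 (λ f g f′ g′ →
      f′ :* g :+ f :* g′ := g′ :* f :+ g :* f′) refl f g (d f) (d g)
    ∂/∂-cong (⊗-identity f)  = Solver.solve 2 (λ f f′ →
      :# 0 :* f :+ :# 1 :* f′ := f′) refl f (d f)
    ∂/∂-cong (distrib f g h) = Solver.solve 6 (λ f g h f′ g′ h′ →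
      f′ :* (g :+ h) :+ f :* (g′ :+ h′) := (f′ :* g :+ f :* g′) :+ (f′ :* h :+ f :* h′))
      refl f g h (d f) (d g) (d h)

  -- Dunkl operators

  module _ {N : ℕ} where

    s-cong : ∀ (i j : Fin N) {f g} → f ≋ g → s i j f ≋ s i j g
    s-cong i j = evalAt-cong (var ∘ transpose i j)

    ∇-cong : ∀ (i j : Fin N) {f g} → f ≋ g → ∇ i j f ≋ ∇ i j g
    ∇-cong i j refl            = refl
    ∇-cong i j (sym e)         = sym (∇-cong i j e)
    ∇-cong i j (trans e e′)    = trans (∇-cong i j e) (∇-cong i j e′)
    ∇-cong i j (⊕-cong e e′)   = ⊕-cong (∇-cong i j e) (∇-cong i j e′)
    ∇-cong i j (⊗-cong e e′)   = ⊕-cong (⊗-cong (∇-cong i j e) e′) (⊗-cong (s-cong i j e) (∇-cong i j e′))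
    ∇-cong i j (⊖-cong e)      = ⊖-cong (∇-cong i j e)
    ∇-cong i j (con-cong e)    = refl
    ∇-cong i j (con-+ a b)     = sym (⊕-identity _)
    ∇-cong i j (con-* a b)     = Solver.solve 2 (λ a b → :# 0 := :# 0 :* b :+ a :* :# 0) refl (con a) (con b)
    ∇-cong i j (⊕-assoc f g h) = ⊕-assoc _ _ _
    ∇-cong i j (⊕-comm f g)    = ⊕-comm _ _
    ∇-cong i j (⊕-identity f)  = ⊕-identity _
    ∇-cong i j (⊖-inverse f)   = ⊖-inverse _
    ∇-cong i j (⊗-assoc f g h) = Solver.solve 7 (λ g h f′ g′ h′ sf sg →
      (f′ :* g :+ sf :* g′) :* h :+ (sf :* sg) :* h′ := f′ :* (g :* h) :+ sf :* (g′ :* h :+ sg :* h′))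
      refl g h (∇ i j f) (∇ i j g) (∇ i j h) (s i j f) (s i j g)
    -- Both sides are symmetric in f and g up to ∇ f ⊗ (g - s g) and
    -- (f - s f) ⊗ ∇ g, and these agree by ∇-quotient.
    ∇-cong i j (⊗-comm f g)    = begin
      f′ ⊗ g ⊕ s i j f ⊗ g′
        ≈⟨ Solver.solve 5 (λ f′ g sf g′ sg → f′ :* g :+ sf :* g′
             := f′ :* (g :+ :- sg) :+ (f′ :* sg :+ sf :* g′)) refl f′ g (s i j f) g′ (s i j g) ⟩
      f′ ⊗ (g ⊕ ⊖ s i j g) ⊕ (f′ ⊗ s i j g ⊕ s i j f ⊗ g′)
        ≈⟨ ⊕-cong (⊗-cong refl (∇-quotient i j g)) refl ⟨
      f′ ⊗ (x ⊗ g′) ⊕ (f′ ⊗ s i j g ⊕ s i j f ⊗ g′)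
        ≈⟨ ⊕-cong (Solver.solve 3 (λ f′ x g′ → f′ :* (x :* g′) := (x :* f′) :* g′) refl f′ x g′) refl ⟩
      (x ⊗ f′) ⊗ g′ ⊕ (f′ ⊗ s i j g ⊕ s i j f ⊗ g′)
        ≈⟨ ⊕-cong (⊗-cong (∇-quotient i j f) refl) refl ⟩
      (f ⊕ ⊖ s i j f) ⊗ g′ ⊕ (f′ ⊗ s i j g ⊕ s i j f ⊗ g′)
        ≈⟨ Solver.solve 5 (λ f sf g′ f′ sg → (f :+ :- sf) :* g′ :+ (f′ :* sg :+ sf :* g′)
             := g′ :* f :+ sg :* f′) refl f (s i j f) g′ f′ (s i j g) ⟩
      g′ ⊗ f ⊕ s i j g ⊗ f′ ∎
      where
      open ≋-Reasoning
      x = var i ⊕ ⊖ var j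
      f′ = ∇ i j f
      g′ = ∇ i j g
    ∇-cong i j (⊗-identity f)  = Solver.solve 2 (λ f f′ →
      :# 0 :* f :+ :# 1 :* f′ := f′) refl f (∇ i j f)
    ∇-cong i j (distrib f g h) = Solver.solve 6 (λ sf g h f′ g′ h′ →
      f′ :* (g :+ h) :+ sf :* (g′ :+ h′) := (f′ :* g :+ sf :* g′) :+ (f′ :* h :+ sf :* h′))
      refl (s i j f) g h (∇ i j f) (∇ i j g) (∇ i j h)

    if-cong : ∀ (b : Bool) {f f′ g g′ : Poly X} → f ≋ f′ → g ≋ g′ →
      (if b then f else g) ≋ (if b then f′ else g′)
    if-cong true  e e′ = e
    if-cong false e e′ = e′

    module _ (i : Fin N) where

      private
        off-diagonal : (Fin N → Poly (Fin N)) → Poly (Fin N)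
        off-diagonal g = ∑[ j < N ] (if does (j Fin.≟ i) then con K.0# else g j)

        off-diagonal-⊗ : ∀ c (g : Fin N → Poly (Fin N)) → off-diagonal (λ j → c ⊗ g j) ≋ c ⊗ off-diagonal g
        off-diagonal-⊗ c g = sym (trans (Ring.*-distribˡ-sum {n = N} c _)
          (Ring.sum-cong-≋ {n = N} λ j → pull (does (j Fin.≟ i))))
          where
          pull : ∀ b {h} → c ⊗ (if b then con K.0# else h) ≋ (if b then con K.0# else c ⊗ h)
          pull true  = Ring.zeroʳ c
          pull false = refl

      x𝒟-cong : ∀ {f g} → f ≋ g → x𝒟 i f ≋ x𝒟 i g
      x𝒟-cong e = ⊗-cong refl (⊕-cong (∂/∂-cong Fin._≟_ i e) (⊗-cong refl
        (Ring.sum-cong-≋ {n = N} λ j → if-cong (does (j Fin.≟ i)) refl (∇-cong i j e))))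

      x𝒟-0 : x𝒟 i (con K.0#) ≋ con K.0#
      x𝒟-0 = trans (⊗-cong refl (⊕-cong refl (⊗-cong refl (sum-0 N λ j → if-0 (does (j Fin.≟ i))))))
        (Solver.solve 2 (λ x t → x :* (:# 0 :+ t :* :# 0) := :# 0) refl (var i) (con θ))
        where
        if-0 : ∀ b → (if b then con K.0# else con K.0#) ≋ con {X = Fin N} K.0#
        if-0 true  = refl
        if-0 false = refl

      x𝒟-⊕ : ∀ f g → x𝒟 i (f ⊕ g) ≋ x𝒟 i f ⊕ x𝒟 i g
      x𝒟-⊕ f g = trans (⊗-cong refl (⊕-cong refl (⊗-cong refl
        (trans (Ring.sum-cong-≋ {n = N} λ j → split (does (j Fin.≟ i))) (Ring.∑-distrib-+ {n = N} _ _)))))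
        (Solver.solve 6 (λ x t a b c d → x :* ((a :+ b) :+ t :* (c :+ d)) := x :* (a :+ t :* c) :+ x :* (b :+ t :* d))
          refl (var i) (con θ) (∂/∂ Fin._≟_ i f) (∂/∂ Fin._≟_ i g)
          (off-diagonal λ j → ∇ i j f) (off-diagonal λ j → ∇ i j g))
        where
        split : ∀ b {u v : Poly (Fin N)} → (if b then con K.0# else u ⊕ v)
          ≋ (if b then con K.0# else u) ⊕ (if b then con K.0# else v)
        split true  = sym (⊕-identity _)
        split false = refl

      x𝒟-· : ∀ a f → x𝒟 i (a · f) ≋ a · x𝒟 i f
      x𝒟-· a f = trans (⊗-cong refl (⊕-cong refl (⊗-cong refl
        (trans (Ring.sum-cong-≋ {n = N} λ j → if-cong (does (j Fin.≟ i)) refl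
                 (trans (⊕-cong (Ring.zeroˡ f) refl) (⊕-identity _)))
               (off-diagonal-⊗ (con a) (λ j → ∇ i j f))))))
        (Solver.solve 6 (λ x t a f d e → x :* ((:# 0 :* f :+ a :* d) :+ t :* (a :* e)) := a :* (x :* (d :+ t :* e)))
          refl (var i) (con θ) (con a) f (∂/∂ Fin._≟_ i f) (off-diagonal λ j → ∇ i j f))

  -- The ring Λ̄[x]

  open Λ̄[x] using (coeff; coeff≈; mk≈; monomial; constant; _•_; ∷-cong; 0∷[]≈[]; coeff-+; coeff-•; coeff-neg;
                    •-cong; •-distribˡ)
    renaming (Carrier to Λ̄[x]; _≈_ to _≈ₓ_; _+_ to _+ₓ_; -_ to -ₓ_)

  module Ringₓ where
    open CommutativeRing Λ̄[x].commutativeRing public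
    open Algebra.Properties.Semiring.Sum semiring public

  open Ringₓ using () renaming (sum to sumₓ)
  module Solverₓ = IntegerSolver Λ̄[x].commutativeRing
  module ≈ₓ-Reasoning = Relation.Binary.Reasoning.Setoid Ringₓ.setoid

  Λ̄-monoid Λ̄[x]-monoid : CommutativeMonoid 0ℓ 0ℓ
  Λ̄-monoid    = Ring.+-commutativeMonoid {ℕ}
  Λ̄[x]-monoid = Ringₓ.+-commutativeMonoid

  Positive : Λ̄[x] → Set
  Positive F = coeff F 0 ≋ con K.0#

  divideByX : Λ̄[x] → Λ̄[x]
  divideByX []      = []
  divideByX (c ∷ F) = F

  positive : ∀ {F} → Positive F → F ≈ₓ con K.0# ∷ divideByX F
  positive {[]}    e = Ringₓ.sym 0∷[]≈[]
  positive {c ∷ F} e = ∷-cong e Ringₓ.refl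

  coeff-divideByX : ∀ F n → coeff (divideByX F) n ≡ coeff F (suc n)
  coeff-divideByX []      n = ≡.refl
  coeff-divideByX (c ∷ F) n = ≡.refl

  0∷-+ : ∀ F G → con K.0# ∷ (F +ₓ G) ≈ₓ (con K.0# ∷ F) +ₓ (con K.0# ∷ G)
  0∷-+ F G = ∷-cong (sym (⊕-identity _)) Ringₓ.refl

  ∷-split : ∀ c F → c ∷ F ≈ₓ constant c +ₓ (con K.0# ∷ F)
  ∷-split c F = ∷-cong (sym (Ring.+-identityʳ c)) Ringₓ.refl

  -- Additive maps on Λ̄[x], determined by their values on monomials

  module _ (M : CommutativeMonoid 0ℓ 0ℓ) where

    private module M where
      open CommutativeMonoid M public
      open Algebra.Properties.CommutativeMonoid.Sum M public
    open M using (_≈_; _∙_; ε)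

    -- Additivity replaces Λ̄-linearity because `∂` and `T` differentiate coefficients; identities
    -- are accordingly tested on h x^n for every h. The target is a general monoid so that Λ̄, Λ̄[x]
    -- and the polynomials in x_1,...,x_M are all covered.
    record IsAdditive (Ψ : Λ̄[x] → M.Carrier) : Set where
      field
        cong  : ∀ {F G} → F ≈ₓ G → Ψ F ≈ Ψ G
        []-homo : Ψ [] ≈ ε
        +-homo  : ∀ F G → Ψ (F +ₓ G) ≈ Ψ F ∙ Ψ G

      sum-homo : ∀ n (F : Fin n → Λ̄[x]) → Ψ (sumₓ F) ≈ M.sum (λ i → Ψ (F i))
      sum-homo zero    F = []-homo
      sum-homo (suc n) F = M.trans (+-homo _ _) (M.∙-cong M.refl (sum-homo n (F ∘ suc)))

    open IsAdditive

    module _ {Ψ : Λ̄[x] → M.Carrier} (add : IsAdditive Ψ) where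

      additive-0∷ : IsAdditive (λ F → Ψ (con K.0# ∷ F))
      additive-0∷ .cong e      = add .cong (∷-cong refl e)
      additive-0∷ .[]-homo     = M.trans (add .cong 0∷[]≈[]) (add .[]-homo)
      additive-0∷ .+-homo F G  = M.trans (add .cong (0∷-+ F G)) (add .+-homo _ _)

      monomial-0 : ∀ n {h} → h ≋ con K.0# → Ψ (monomial h n) ≈ ε
      monomial-0 n e = M.trans (add .cong (vanish n e)) (add .[]-homo)
        where
        vanish : ∀ n {h} → h ≋ con K.0# → monomial h n ≈ₓ []
        vanish zero    e = Ringₓ.trans (∷-cong e Ringₓ.refl) 0∷[]≈[]
        vanish (suc n) e = Ringₓ.trans (∷-cong refl (vanish n e)) 0∷[]≈[]

    -- `B` bounds the degree and is unrelated to the length of the list: a short list is padded by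
    -- zero monomials, and the surplus of a long one has zero coefficients.
    expand : ∀ {Ψ} → IsAdditive Ψ → ∀ F B → (∀ n → B ≤ n → coeff F n ≋ con K.0#) →
      Ψ F ≈ M.sum {B} (λ a → Ψ (monomial (coeff F (toℕ a)) (toℕ a)))
    expand {Ψ} add []      B       z = M.trans (add .[]-homo) (M.sym (M.trans
      (M.sum-cong-≋ {B} λ a → monomial-0 add (toℕ a) refl) (M.sum-replicate-zero B)))
    expand {Ψ} add (c ∷ F) zero    z = M.trans (add .cong {c ∷ F} {[]} (mk≈ λ n → z n z≤n)) (add .[]-homo)
    expand {Ψ} add (c ∷ F) (suc B) z = M.trans (add .cong (∷-split c F)) (M.trans (add .+-homo _ _)
      (M.∙-cong M.refl (expand (additive-0∷ add) F B λ n B≤n → z (suc n) (s≤s B≤n))))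

    -- Induction on the list of coefficients. The tail is compared through both maps precomposed
    -- with multiplication by x, which are additive again by `additive-0∷`.
    agree : ∀ {Ψ Ψ′} → IsAdditive Ψ → IsAdditive Ψ′ →
      (∀ h n → Ψ (monomial h n) ≈ Ψ′ (monomial h n)) → ∀ F → Ψ F ≈ Ψ′ F
    agree add add′ e []      = M.trans (add .[]-homo) (M.sym (add′ .[]-homo))
    agree add add′ e (c ∷ F) = M.trans (add .cong (∷-split c F)) (M.trans (add .+-homo _ _)
      (M.trans (M.∙-cong (e c 0) (agree (additive-0∷ add) (additive-0∷ add′) (λ h n → e h (suc n)) F))
      (M.sym (M.trans (add′ .cong (∷-split c F)) (add′ .+-homo _ _)))))

    agree-positive : ∀ {Ψ Ψ′} → IsAdditive Ψ → IsAdditive Ψ′ →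
      (∀ h n → Ψ (monomial h (suc n)) ≈ Ψ′ (monomial h (suc n))) → ∀ F → Positive F → Ψ F ≈ Ψ′ F
    agree-positive add add′ e F F⁺ = M.trans (add .cong (positive F⁺))
      (M.trans (agree (additive-0∷ add) (additive-0∷ add′) e (divideByX F)) (add′ .cong (Ringₓ.sym (positive F⁺))))

    additive-∙ : ∀ {Ψ Ψ′} → IsAdditive Ψ → IsAdditive Ψ′ → IsAdditive (λ F → Ψ F ∙ Ψ′ F)
    additive-∙ add add′ .cong e     = M.∙-cong (add .cong e) (add′ .cong e)
    additive-∙ add add′ .[]-homo    = M.trans (M.∙-cong (add .[]-homo) (add′ .[]-homo)) (M.identityˡ ε)
    additive-∙ add add′ .+-homo F G = M.trans (M.∙-cong (add .+-homo F G) (add′ .+-homo F G))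
      (interchange _ _ _ _)
      where open Algebra.Properties.CommutativeSemigroup M.commutativeSemigroup using (interchange)

  open IsAdditive public

  module _ {M M′ : CommutativeMonoid 0ℓ 0ℓ} where

    private
      module M  = CommutativeMonoid M
      module M′ = CommutativeMonoid M′

    additive-∘ : ∀ {Ψ} {Υ : M.Carrier → M′.Carrier} →
      (∀ {a b} → a M.≈ b → Υ a M′.≈ Υ b) → Υ M.ε M′.≈ M′.ε → (∀ a b → Υ (a M.∙ b) M′.≈ Υ a M′.∙ Υ b) →
      IsAdditive M Ψ → IsAdditive M′ (Υ ∘ Ψ)
    additive-∘ Υ-cong Υ-ε Υ-∙ add .cong e     = Υ-cong (add .cong e)
    additive-∘ Υ-cong Υ-ε Υ-∙ add .[]-homo    = M′.trans (Υ-cong (add .[]-homo)) Υ-ε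
    additive-∘ Υ-cong Υ-ε Υ-∙ add .+-homo F G = M′.trans (Υ-cong (add .+-homo F G)) (Υ-∙ _ _)

  additive-∘ₓ : ∀ {M Ψ Υ} → IsAdditive M Ψ → IsAdditive Λ̄[x]-monoid Υ → IsAdditive M (Ψ ∘ Υ)
  additive-∘ₓ add = additive-∘ (add .cong) (add .[]-homo) (add .+-homo)

  additive-id : IsAdditive Λ̄[x]-monoid id
  additive-id .cong e     = e
  additive-id .[]-homo    = Ringₓ.refl
  additive-id .+-homo F G = Ringₓ.refl

  additive-• : ∀ c → IsAdditive Λ̄[x]-monoid (c •_)
  additive-• c .cong e     = •-cong refl e
  additive-• c .[]-homo    = Ringₓ.refl
  additive-• c .+-homo F G = •-distribˡ c F G

  additive-coeff : ∀ n → IsAdditive Λ̄-monoid (λ F → coeff F n)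
  additive-coeff n .cong e     = e .coeff≈ n
  additive-coeff n .[]-homo    = refl
  additive-coeff n .+-homo F G = coeff-+ F G n

  additive-0 : ∀ M → IsAdditive M (λ _ → CommutativeMonoid.ε M)
  additive-0 M .cong e     = CommutativeMonoid.refl M
  additive-0 M .[]-homo    = CommutativeMonoid.refl M
  additive-0 M .+-homo F G = CommutativeMonoid.sym M (CommutativeMonoid.identityˡ M _)

  -- Monomials and multiplication by powers of x

  shift : ℕ → Λ̄[x] → Λ̄[x]
  shift n F = replicate n (con K.0#) ++ F

  additive-shift : ∀ n → IsAdditive Λ̄[x]-monoid (shift n)
  additive-shift zero    = additive-id
  additive-shift (suc n) = additive-∘ₓ (additive-0∷ Λ̄[x]-monoid additive-id) (additive-shift n)

  shift-monomial : ∀ n h m → shift n (monomial h m) ≡ monomial h (n ℕ.+ m)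
  shift-monomial zero    h m = ≡.refl
  shift-monomial (suc n) h m = ≡.cong (con K.0# ∷_) (shift-monomial n h m)

  monomial-cong : ∀ n {g h} → g ≋ h → monomial g n ≈ₓ monomial h n
  monomial-cong zero    e = ∷-cong e Ringₓ.refl
  monomial-cong (suc n) e = ∷-cong refl (monomial-cong n e)

  monomial-⊕ : ∀ n g h → monomial (g ⊕ h) n ≈ₓ monomial g n +ₓ monomial h n
  monomial-⊕ zero    g h = Ringₓ.refl
  monomial-⊕ (suc n) g h = ∷-cong (sym (⊕-identity _)) (monomial-⊕ n g h)

  •-monomial : ∀ n g h → g • monomial h n ≈ₓ monomial (g ⊗ h) n
  •-monomial zero    g h = Ringₓ.refl
  •-monomial (suc n) g h = ∷-cong (Ring.zeroʳ g) (•-monomial n g h)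

  coeff-monomial-≡ : ∀ n h → coeff (monomial h n) n ≡ h
  coeff-monomial-≡ zero    h = ≡.refl
  coeff-monomial-≡ (suc n) h = coeff-monomial-≡ n h

  coeff-monomial-≢ : ∀ m n h → m ≢ n → coeff (monomial h m) n ≡ con K.0#
  coeff-monomial-≢ zero    zero    h m≢n = contradiction ≡.refl m≢n
  coeff-monomial-≢ zero    (suc n) h m≢n = ≡.refl
  coeff-monomial-≢ (suc m) zero    h m≢n = ≡.refl
  coeff-monomial-≢ (suc m) (suc n) h m≢n = coeff-monomial-≢ m n h (m≢n ∘ ≡.cong suc)

  -- Linear extensions from the powers of x

  -- Coefficients pass through `σ`: the identity yields `ev`, and specialization of the p_a yields
  -- the substitution of x_i for x.
  linear : (Λ̄ → Poly Y) → (ℕ → Poly Y) → Λ̄[x] → Poly Y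
  linear σ b []      = con K.0#
  linear σ b (c ∷ F) = σ c ⊗ b 0 ⊕ linear σ (b ∘ suc) F

  module _ {Y : Set} {σ : Λ̄ → Poly Y} (σ-cong : ∀ {f g} → f ≋ g → σ f ≋ σ g)
    (σ-0 : σ (con K.0#) ≋ con K.0#) (σ-⊕ : ∀ f g → σ (f ⊕ g) ≋ σ f ⊕ σ g) where

    private
      vanish : ∀ b F → F ≈ₓ [] → linear σ b F ≋ con K.0#
      vanish b []      e = refl
      vanish b (c ∷ F) e = trans
        (⊕-cong (⊗-cong (trans (σ-cong (e .coeff≈ 0)) σ-0) refl) (vanish (b ∘ suc) F (mk≈ (e .coeff≈ ∘ suc))))
        (Solver.solve 1 (λ x → :# 0 :* x :+ :# 0 := :# 0) refl (b 0))

      lcong : ∀ b {F G} → F ≈ₓ G → linear σ b F ≋ linear σ b G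
      lcong b {[]}    {G}     e = sym (vanish b G (Ringₓ.sym e))
      lcong b {c ∷ F} {[]}    e = vanish b (c ∷ F) e
      lcong b {c ∷ F} {d ∷ G} e = ⊕-cong (⊗-cong (σ-cong (e .coeff≈ 0)) refl)
        (lcong (b ∘ suc) (mk≈ (e .coeff≈ ∘ suc)))

      lplus : ∀ b F G → linear σ b (F +ₓ G) ≋ linear σ b F ⊕ linear σ b G
      lplus b []      G       = sym (⊕-identity _)
      lplus b (c ∷ F) []      = sym (Ring.+-identityʳ _)
      lplus b (c ∷ F) (d ∷ G) = trans (⊕-cong (⊗-cong (σ-⊕ c d) refl) (lplus (b ∘ suc) F G))
        (Solver.solve 5 (λ c d x f g → (c :+ d) :* x :+ (f :+ g) := (c :* x :+ f) :+ (d :* x :+ g))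
          refl (σ c) (σ d) (b 0) (linear σ (b ∘ suc) F) (linear σ (b ∘ suc) G))

    additive-linear : ∀ b → IsAdditive (Ring.+-commutativeMonoid {Y}) (linear σ b)
    additive-linear b .cong    = lcong b
    additive-linear b .[]-homo = refl
    additive-linear b .+-homo  = lplus b

    linear-monomial : ∀ b h n → linear σ b (monomial h n) ≋ σ h ⊗ b n
    linear-monomial b h zero    = Ring.+-identityʳ _
    linear-monomial b h (suc n) = trans (⊕-cong (⊗-cong σ-0 refl) (linear-monomial (b ∘ suc) h n))
      (Solver.solve 2 (λ x y → :# 0 :* x :+ y := y) refl (b 0) (σ h ⊗ b (suc n)))

  linear-• : ∀ b c F → linear id b (c • F) ≋ c ⊗ linear id b F
  linear-• b c []      = sym (Ring.zeroʳ c)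
  linear-• b c (d ∷ F) = trans (⊕-cong (⊗-assoc c d (b 0)) (linear-• (b ∘ suc) c F)) (sym (distrib c _ _))

  linearₓ : (ℕ → Λ̄[x]) → Λ̄[x] → Λ̄[x]
  linearₓ b []      = []
  linearₓ b (c ∷ F) = c • b 0 +ₓ linearₓ (b ∘ suc) F

  -- Reduces all properties of `linearₓ` to the scalar-valued `linear`, one coefficient at a time.
  coeff-linearₓ : ∀ b F n → coeff (linearₓ b F) n ≋ linear id (λ ℓ → coeff (b ℓ) n) F
  coeff-linearₓ b []      n = refl
  coeff-linearₓ b (c ∷ F) n = trans (coeff-+ (c • b 0) _ n)
    (⊕-cong (coeff-• c (b 0) n) (coeff-linearₓ (b ∘ suc) F n))

  additive-linear-id : ∀ b → IsAdditive Λ̄-monoid (linear id b)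
  additive-linear-id = additive-linear id refl (λ _ _ → refl)

  additive-linearₓ : ∀ b → IsAdditive Λ̄[x]-monoid (linearₓ b)
  additive-linearₓ b .cong {F} {G} e = mk≈ λ n → trans (coeff-linearₓ b F n)
    (trans (additive-linear-id _ .cong e) (sym (coeff-linearₓ b G n)))
  additive-linearₓ b .[]-homo        = Ringₓ.refl
  additive-linearₓ b .+-homo F G     = mk≈ λ n → trans (coeff-linearₓ b (F +ₓ G) n)
    (trans (additive-linear-id _ .+-homo F G) (trans (⊕-cong (sym (coeff-linearₓ b F n)) (sym (coeff-linearₓ b G n)))
      (sym (coeff-+ (linearₓ b F) (linearₓ b G) n))))

  linearₓ-monomial : ∀ b h n → linearₓ b (monomial h n) ≈ₓ h • b n
  linearₓ-monomial b h n = mk≈ λ k → trans (coeff-linearₓ b (monomial h n) k)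
    (trans (linear-monomial id refl (λ _ _ → refl) _ h n) (sym (coeff-• h (b n) k)))

  linearₓ-• : ∀ b c F → linearₓ b (c • F) ≈ₓ c • linearₓ b F
  linearₓ-• b c F = mk≈ λ n → trans (coeff-linearₓ b (c • F) n)
    (trans (linear-• (λ ℓ → coeff (b ℓ) n) c F)
      (trans (⊗-cong refl (sym (coeff-linearₓ b F n))) (sym (coeff-• c (linearₓ b F) n))))

  -- Uses nothing about `ext` but its recursion equations, so that it applies to a function that is
  -- known only through its computation.
  extendₓ-unique : (ext : (ℕ → Λ̄[x]) → Λ̄[x] → Λ̄[x]) → (∀ b → ext b [] ≡ []) →
    (∀ b c F → ext b (c ∷ F) ≡ c • b 0 +ₓ ext (b ∘ suc) F) → ∀ b F → ext b F ≡ linearₓ b F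
  extendₓ-unique ext nil cons b []      = nil b
  extendₓ-unique ext nil cons b (c ∷ F) = ≡.trans (cons b c F)
    (≡.cong (c • b 0 +ₓ_) (extendₓ-unique ext nil cons (b ∘ suc) F))

  extend-unique : (ext : (ℕ → Λ̄) → Λ̄[x] → Λ̄) → (∀ b → ext b [] ≡ con K.0#) →
    (∀ b c F → ext b (c ∷ F) ≡ c ⊗ b 0 ⊕ ext (b ∘ suc) F) → ∀ b F → ext b F ≡ linear id b F
  extend-unique ext nil cons b []      = nil b
  extend-unique ext nil cons b (c ∷ F) = ≡.trans (cons b c F)
    (≡.cong (c ⊗ b 0 ⊕_) (extend-unique ext nil cons (b ∘ suc) F))

  -- The operators `extend' inside A and ev are local and cannot be named; they
  -- are the values that unification has to give to extendA and extendEv once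
  -- Aₓ and p have been abstracted to a variable.
  mutual
    extendA : (ℕ → Λ̄[x]) → Λ̄[x] → Λ̄[x]
    extendA = _

    A≡linearₓ : ∀ F → A F ≡ linearₓ Aₓ F
    A≡linearₓ F with Aₓ
    ... | b = extendₓ-unique extendA (λ _ → ≡.refl) (λ _ _ _ → ≡.refl) b F

  mutual
    extendEv : (ℕ → Λ̄) → Λ̄[x] → Λ̄
    extendEv = _

    ev≡linear : ∀ F → ev F ≡ linear id p F
    ev≡linear F with p
    ... | b = extend-unique extendEv (λ _ → ≡.refl) (λ _ _ _ → ≡.refl) b F

  additive-≡ : ∀ {M Ψ Ψ′} → (∀ F → Ψ F ≡ Ψ′ F) → IsAdditive M Ψ′ → IsAdditive M Ψ
  additive-≡ {M} {Ψ} {Ψ′} e add = record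
    { cong    = λ {F} {G} q → M.trans (M.reflexive (e F)) (M.trans (add .cong q) (M.sym (M.reflexive (e G))))
    ; []-homo = M.trans (M.reflexive (e [])) (add .[]-homo)
    ; +-homo  = λ F G → M.trans (M.reflexive (e (F +ₓ G))) (M.trans (add .+-homo F G)
        (M.∙-cong (M.sym (M.reflexive (e F))) (M.sym (M.reflexive (e G))))) }
    where module M = CommutativeMonoid M

  additive-A : IsAdditive Λ̄[x]-monoid A
  additive-A = additive-≡ A≡linearₓ (additive-linearₓ Aₓ)

  additive-ev : IsAdditive Λ̄-monoid ev
  additive-ev = additive-≡ ev≡linear (additive-linear-id p)

  ev-monomial : ∀ h n → ev (monomial h n) ≋ h ⊗ p n
  ev-monomial h n = trans (≡⇒≋ (ev≡linear (monomial h n))) (linear-monomial id refl (λ _ _ → refl) p h n)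

  ev-• : ∀ c F → ev (c • F) ≋ c ⊗ ev F
  ev-• c F = trans (≡⇒≋ (ev≡linear (c • F))) (trans (linear-• p c F) (⊗-cong refl (≡⇒≋ (≡.sym (ev≡linear F)))))

  -- The derivation ∂

  coeff-∂₀-zero : ∀ f → coeff (∂₀ f) 0 ≋ con K.0#
  coeff-∂₀-zero (con a)       = refl
  coeff-∂₀-zero (var zero)    = refl
  coeff-∂₀-zero (var (suc a)) = refl
  coeff-∂₀-zero (f ⊕ g) = trans (coeff-+ (∂₀ f) (∂₀ g) 0)
    (trans (⊕-cong (coeff-∂₀-zero f) (coeff-∂₀-zero g)) (⊕-identity _))
  coeff-∂₀-zero (f ⊗ g) = trans (coeff-+ (g • ∂₀ f) (f • ∂₀ g) 0)
    (trans (⊕-cong (trans (coeff-• g (∂₀ f) 0) (⊗-cong refl (coeff-∂₀-zero f)))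
                   (trans (coeff-• f (∂₀ g) 0) (⊗-cong refl (coeff-∂₀-zero g))))
    (Solver.solve 2 (λ f g → g :* :# 0 :+ f :* :# 0 := :# 0) refl f g))
  coeff-∂₀-zero (⊖ f) = trans (coeff-neg (∂₀ f) 0) (trans (⊖-cong (coeff-∂₀-zero f)) Ring.-0#≈0#)

  -- Both sides are derivations in f with the same values on the variables. Hence `∂₀ f` is ∑ D_a f
  -- x^a, the source of every expansion in the D_a below, and `∂₀` inherits its congruence from
  -- `∂/∂`.
  coeff-∂₀ : ∀ f a → coeff (∂₀ f) (suc a) ≋ D (suc a) f
  coeff-∂₀ (con c)       a = sym (Ring.zeroʳ _)
  coeff-∂₀ (var zero)    a = sym (Ring.zeroʳ _)
  -- The Boolean `does (suc a ℕ.≟ suc b)` evaluates to `a ≡ᵇ b`, so abstracting the latter decides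
  -- the branch of `∂/∂`.
  coeff-∂₀ (var (suc b)) a with a ℕ.≡ᵇ b | ℕ.≡ᵇ⇒≡ a b | ℕ.≡⇒≡ᵇ a b
  ... | false | _   | a≢b = trans (≡⇒≋ (coeff-monomial-≢ b a _ (a≢b ∘ ≡.sym))) (sym (Ring.zeroʳ _))
  ... | true  | a≡b | _   with a≡b _
  ...   | ≡.refl = trans (≡⇒≋ (coeff-monomial-≡ b _)) (sym (Ring.*-identityʳ _))
  coeff-∂₀ (f ⊕ g) a = trans (coeff-+ (∂₀ f) (∂₀ g) (suc a))
    (trans (⊕-cong (coeff-∂₀ f a) (coeff-∂₀ g a)) (sym (distrib _ _ _)))
  coeff-∂₀ (f ⊗ g) a = trans (coeff-+ (g • ∂₀ f) (f • ∂₀ g) (suc a))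
    (trans (⊕-cong (trans (coeff-• g (∂₀ f) (suc a)) (⊗-cong refl (coeff-∂₀ f a)))
                   (trans (coeff-• f (∂₀ g) (suc a)) (⊗-cong refl (coeff-∂₀ g a))))
    (Solver.solve 5 (λ f g n f′ g′ → g :* (n :* f′) :+ f :* (n :* g′) := n :* (f′ :* g :+ f :* g′)) refl
      f g (con (K.fromℕ (suc a))) (∂/∂ ℕ._≟_ (suc a) f) (∂/∂ ℕ._≟_ (suc a) g)))
  coeff-∂₀ (⊖ f) a = trans (coeff-neg (∂₀ f) (suc a)) (trans (⊖-cong (coeff-∂₀ f a))
    (Solver.solve 2 (λ n f′ → :- (n :* f′) := n :* (:- f′)) refl (con (K.fromℕ (suc a))) (∂/∂ ℕ._≟_ (suc a) f)))

  ∂₀-cong : ∀ {f g} → f ≋ g → ∂₀ f ≈ₓ ∂₀ g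
  ∂₀-cong {f} {g} e = mk≈ λ where
    zero    → trans (coeff-∂₀-zero f) (sym (coeff-∂₀-zero g))
    (suc a) → trans (coeff-∂₀ f a) (trans (⊗-cong refl (∂/∂-cong ℕ._≟_ (suc a) e)) (sym (coeff-∂₀ g a)))

  private
    ∂-vanish : ∀ F → F ≈ₓ [] → ∂ F ≈ₓ []
    ∂-vanish []      e = Ringₓ.refl
    ∂-vanish (c ∷ F) e = Λ̄[x].trans (Λ̄[x].+-cong (∂₀-cong (e .coeff≈ 0)) (∷-cong refl
      (Λ̄[x].trans (Λ̄[x].+-cong F≈0 (∂-vanish F F≈0)) Ringₓ.refl))) 0∷[]≈[]
      where
      F≈0 : F ≈ₓ []
      F≈0 = mk≈ (e .coeff≈ ∘ suc)

    ∂-cong : ∀ {F G} → F ≈ₓ G → ∂ F ≈ₓ ∂ G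
    ∂-cong {[]}    {G}     e = Ringₓ.sym (∂-vanish G (Ringₓ.sym e))
    ∂-cong {c ∷ F} {[]}    e = ∂-vanish (c ∷ F) e
    ∂-cong {c ∷ F} {d ∷ G} e = Λ̄[x].+-cong (∂₀-cong (e .coeff≈ 0)) (∷-cong refl
      (Λ̄[x].+-cong F≈G (∂-cong F≈G)))
      where
      F≈G : F ≈ₓ G
      F≈G = mk≈ (e .coeff≈ ∘ suc)

    ∂-+ : ∀ F G → ∂ (F +ₓ G) ≈ₓ ∂ F +ₓ ∂ G
    ∂-+ []      G       = Ringₓ.refl
    ∂-+ (c ∷ F) []      = Ringₓ.sym (Ringₓ.+-identityʳ _)
    ∂-+ (c ∷ F) (d ∷ G) = begin
      (∂₀ c +ₓ ∂₀ d) +ₓ (con K.0# ∷ ((F +ₓ G) +ₓ ∂ (F +ₓ G)))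
        ≈⟨ Λ̄[x].+-cong Ringₓ.refl (∷-cong refl (Λ̄[x].trans (Λ̄[x].+-cong Ringₓ.refl (∂-+ F G))
             (Λ̄[x].+-interchange F G (∂ F) (∂ G)))) ⟩
      (∂₀ c +ₓ ∂₀ d) +ₓ (con K.0# ∷ ((F +ₓ ∂ F) +ₓ (G +ₓ ∂ G)))
        ≈⟨ Λ̄[x].+-cong Ringₓ.refl (0∷-+ (F +ₓ ∂ F) (G +ₓ ∂ G)) ⟩
      (∂₀ c +ₓ ∂₀ d) +ₓ ((con K.0# ∷ (F +ₓ ∂ F)) +ₓ (con K.0# ∷ (G +ₓ ∂ G)))
        ≈⟨ Λ̄[x].+-interchange (∂₀ c) (∂₀ d) _ _ ⟩
      (∂₀ c +ₓ (con K.0# ∷ (F +ₓ ∂ F))) +ₓ (∂₀ d +ₓ (con K.0# ∷ (G +ₓ ∂ G))) ∎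
      where open ≈ₓ-Reasoning

  additive-∂ : IsAdditive Λ̄[x]-monoid ∂
  additive-∂ .cong    = ∂-cong
  additive-∂ .[]-homo = Ringₓ.refl
  additive-∂ .+-homo  = ∂-+

  ∂-monomial : ∀ h n → ∂ (monomial h n) ≈ₓ shift n (∂₀ h) +ₓ monomial (h ⊗ con (K.fromℕ n)) n
  ∂-monomial h zero    = Λ̄[x].+-cong (Ringₓ.refl {∂₀ h}) (∷-cong (sym (Ring.zeroʳ h)) Ringₓ.refl)
  ∂-monomial h (suc n) = begin
    con K.0# ∷ (monomial h n +ₓ ∂ (monomial h n))
      ≈⟨ ∷-cong refl (Λ̄[x].+-cong (Ringₓ.refl {monomial h n}) (∂-monomial h n)) ⟩
    con K.0# ∷ (monomial h n +ₓ (shift n (∂₀ h) +ₓ monomial (h ⊗ con (K.fromℕ n)) n))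
      ≈⟨ ∷-cong refl (Solverₓ.solve 3 (λ a b c → a Solverₓ.:+ (b Solverₓ.:+ c) Solverₓ.:= b Solverₓ.:+ (a Solverₓ.:+ c))
           Ringₓ.refl (monomial h n) (shift n (∂₀ h)) (monomial (h ⊗ con (K.fromℕ n)) n)) ⟩
    con K.0# ∷ (shift n (∂₀ h) +ₓ (monomial h n +ₓ monomial (h ⊗ con (K.fromℕ n)) n))
      ≈⟨ ∷-cong refl (Λ̄[x].+-cong (Ringₓ.refl {shift n (∂₀ h)}) (Ringₓ.trans (Ringₓ.sym (monomial-⊕ n h _))
           (monomial-cong n (trans (Solver.solve 2 (λ h k → h :+ h :* k := h :* (:# 1 :+ k)) refl h (con (K.fromℕ n)))
             (⊗-cong refl (sym (con-+ _ _))))))) ⟩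
    con K.0# ∷ (shift n (∂₀ h) +ₓ monomial (h ⊗ con (K.fromℕ (suc n))) n)
      ≈⟨ 0∷-+ (shift n (∂₀ h)) _ ⟩
    shift (suc n) (∂₀ h) +ₓ monomial (h ⊗ con (K.fromℕ (suc n))) (suc n) ∎
    where open ≈ₓ-Reasoning

  ∂-• : ∀ {u} → ∂₀ u ≈ₓ [] → ∀ F → ∂ (u • F) ≈ₓ u • ∂ F
  ∂-• {u} e []      = Ringₓ.refl
  ∂-• {u} e (c ∷ F) = begin
    (c • ∂₀ u +ₓ u • ∂₀ c) +ₓ (con K.0# ∷ (u • F +ₓ ∂ (u • F)))
      ≈⟨ Λ̄[x].+-cong (Λ̄[x].+-cong (•-cong refl e) Ringₓ.refl)
           (∷-cong (sym (Ring.zeroʳ u)) (Λ̄[x].trans (Λ̄[x].+-cong (Ringₓ.refl {u • F}) (∂-• e F)) (Ringₓ.sym (•-distribˡ u F (∂ F))))) ⟩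
    u • ∂₀ c +ₓ u • (con K.0# ∷ (F +ₓ ∂ F))
      ≈⟨ •-distribˡ u (∂₀ c) _ ⟨
    u • (∂₀ c +ₓ (con K.0# ∷ (F +ₓ ∂ F))) ∎
    where open ≈ₓ-Reasoning

  -- The operator T

  -- The diagonal coefficient n - θ n of `T` at x^n: one part from `∂`, the other from `Θ`.
  κ : ℕ → Λ̄
  κ n = con (K.fromℕ n) ⊕ con θ ⊗ ⊖ con (K.fromℕ n)

  -- With ℓ = m + 1 and a = b + 1, the exponent ℓ - a is written as a successor. Every monomial is
  -- then visibly a multiple of x, and lemmas about x^{m+1} apply to it directly.
  lowerTerms : Λ̄ → (m : ℕ) → Fin m → Λ̄[x]
  lowerTerms h m b = monomial (h ⊗ (con θ ⊗ p (suc (toℕ b)))) (suc (m ∸ suc (toℕ b)))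

  Θ : ℕ → Λ̄[x]
  Θ zero    = []
  Θ (suc m) = monomial (con θ ⊗ ⊖ con (K.fromℕ (suc m))) (suc m)
    +ₓ sumₓ {m} (λ b → monomial (con θ ⊗ p (suc (toℕ b))) (suc (m ∸ suc (toℕ b))))

  T : Λ̄[x] → Λ̄[x]
  T F = ∂ F +ₓ linearₓ Θ F

  additive-T : IsAdditive Λ̄[x]-monoid T
  additive-T = additive-∙ _ additive-∂ (additive-linearₓ Θ)

  -- Meant for u = (θ/2) p_0, a constant of `∂`: it moves the factors p_0 left by one application of
  -- `𝖣` past the next one.
  T-• : ∀ {u} → ∂₀ u ≈ₓ [] → ∀ F → T (u • F) ≈ₓ u • T F
  T-• {u} e F = Ringₓ.trans (Λ̄[x].+-cong (∂-• e F) (linearₓ-• Θ u F)) (Ringₓ.sym (•-distribˡ u (∂ F) _))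

  •-Θ : ∀ h m → h • Θ (suc m) ≈ₓ monomial (h ⊗ (con θ ⊗ ⊖ con (K.fromℕ (suc m)))) (suc m) +ₓ sumₓ (lowerTerms h m)
  •-Θ h m = Ringₓ.trans (•-distribˡ h (monomial (con θ ⊗ ⊖ con (K.fromℕ (suc m))) (suc m)) (sumₓ lower))
    (Λ̄[x].+-cong (•-monomial (suc m) h _) (Ringₓ.trans (sum-homo (additive-• h) m lower)
      (Ringₓ.sum-cong-≋ {m} λ b → •-monomial (suc (m ∸ suc (toℕ b))) h _)))
    where
    lower : Fin m → Λ̄[x]
    lower b = monomial (con θ ⊗ p (suc (toℕ b))) (suc (m ∸ suc (toℕ b)))

  T-monomial : ∀ h m → T (monomial h (suc m))
    ≈ₓ shift (suc m) (∂₀ h) +ₓ (monomial (h ⊗ κ (suc m)) (suc m) +ₓ sumₓ (lowerTerms h m))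
  T-monomial h m = begin
    ∂ (monomial h (suc m)) +ₓ linearₓ Θ (monomial h (suc m))
      ≈⟨ Λ̄[x].+-cong (∂-monomial h (suc m)) (Ringₓ.trans (linearₓ-monomial Θ h (suc m)) (•-Θ h m)) ⟩
    (V +ₓ monomial a (suc m)) +ₓ (monomial b (suc m) +ₓ Σ)
      ≈⟨ Solverₓ.solve 4 (λ v a b s → (v Solverₓ.:+ a) Solverₓ.:+ (b Solverₓ.:+ s)
           Solverₓ.:= v Solverₓ.:+ ((a Solverₓ.:+ b) Solverₓ.:+ s)) Ringₓ.refl V (monomial a (suc m)) (monomial b (suc m)) Σ ⟩
    V +ₓ ((monomial a (suc m) +ₓ monomial b (suc m)) +ₓ Σ)
      ≈⟨ Λ̄[x].+-cong (Ringₓ.refl {V}) (Λ̄[x].+-cong {q = Σ} (Ringₓ.trans (Ringₓ.sym (monomial-⊕ (suc m) a b))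
           (monomial-cong (suc m) (sym (distrib h _ _)))) Ringₓ.refl) ⟩
    V +ₓ (monomial (h ⊗ κ (suc m)) (suc m) +ₓ Σ) ∎
    where
    open ≈ₓ-Reasoning
    a b : Λ̄
    a = h ⊗ con (K.fromℕ (suc m))
    b = h ⊗ (con θ ⊗ ⊖ con (K.fromℕ (suc m)))
    V Σ : Λ̄[x]
    V = shift (suc m) (∂₀ h)
    Σ = sumₓ (lowerTerms h m)

  -- All exponents in `T-monomial` are positive. Iterates of `T` thus stay where `𝖣-positive`,
  -- `x𝒟-φ` and `sum-φ` are available.
  T-positive : ∀ F → Positive F → Positive (T F)
  T-positive = agree-positive Λ̄-monoid (additive-∘ₓ (additive-coeff 0) additive-T) (additive-0 _) λ h m →
    trans (T-monomial h m .coeff≈ 0)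
    (trans (coeff-+ (shift (suc m) (∂₀ h)) (monomial (h ⊗ κ (suc m)) (suc m) +ₓ sumₓ (lowerTerms h m)) 0)
    (trans (⊕-cong refl (trans (coeff-+ (monomial (h ⊗ κ (suc m)) (suc m)) (sumₓ (lowerTerms h m)) 0)
      (trans (⊕-cong refl (trans (sum-homo (additive-coeff 0) m (lowerTerms h m)) (sum-0 m λ _ → refl)))
      (⊕-identity _)))) (⊕-identity _)))

  -- Comparison of 𝖣 with T

  t : Λ̄
  t = con (θ K.* 1/[1+ 1 ])

  -- Expressing θ through `t` turns identities involving the factor 1/2 of `𝖣` into ones with
  -- integer coefficients, which the solver can prove.
  θ≋t+t : con θ ≋ t ⊕ t
  θ≋t+t = begin
    con θ                              ≈⟨ Ring.*-identityʳ _ ⟨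
    con θ ⊗ con K.1#                   ≈⟨ ⊗-cong refl half ⟩
    con θ ⊗ (# 2 ⊗ con 1/[1+ 1 ])      ≈⟨ Solver.solve 2 (λ a h → a :* (:# 2 :* h) := a :* h :+ a :* h) refl (con θ) (con 1/[1+ 1 ]) ⟩
    con θ ⊗ con 1/[1+ 1 ] ⊕ con θ ⊗ con 1/[1+ 1 ] ≈⟨ ⊕-cong (con-* _ _) (con-* _ _) ⟨
    t ⊕ t                              ∎
    where open ≋-Reasoning

  𝖣≈ : ∀ F → 𝖣 (K.- θ) F ≈ₓ ∂ F +ₓ t • A F
  𝖣≈ F = Λ̄[x].+-cong (Ringₓ.refl {∂ F}) (mk≈ λ n →
    trans (coeff-neg (con (K.- θ K.* 1/[1+ 1 ]) • A F) n) (trans (⊖-cong (trans (coeff-• _ (A F) n) (⊗-cong -t refl)))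
    (trans (Solver.solve 2 (λ t a → :- (:- t :* a) := t :* a) refl t (coeff (A F) n)) (sym (coeff-• t (A F) n)))))
    where
    -t : con (K.- θ K.* 1/[1+ 1 ]) ≋ ⊖ t
    -t = trans (con-* _ _) (trans (⊗-cong (con-neg θ) refl) (trans
      (Solver.solve 2 (λ a b → :- a :* b := :- (a :* b)) refl (con θ) (con 1/[1+ 1 ])) (⊖-cong (sym (con-* _ _)))))

  additive-𝖣 : IsAdditive Λ̄[x]-monoid (𝖣 (K.- θ))
  additive-𝖣 = record
    { cong    = λ {F} {G} e → Ringₓ.trans (𝖣≈ F) (Ringₓ.trans (additive .cong e) (Ringₓ.sym (𝖣≈ G)))
    ; []-homo = Ringₓ.refl
    ; +-homo  = λ F G → Ringₓ.trans (𝖣≈ (F +ₓ G)) (Ringₓ.trans (additive .+-homo F G)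
        (Λ̄[x].+-cong (Ringₓ.sym (𝖣≈ F)) (Ringₓ.sym (𝖣≈ G)))) }
    where
    additive : IsAdditive Λ̄[x]-monoid (λ F → ∂ F +ₓ t • A F)
    additive = additive-∙ _ additive-∂ (additive-∘ₓ (additive-• t) additive-A)

  coeff-monomial : ∀ h n k → coeff (monomial h n) k ≋ h ⊗ coeff (monomial (con K.1#) n) k
  coeff-monomial h n k = trans (monomial-cong n (sym (Ring.*-identityʳ h)) .coeff≈ k)
    (trans (sym (•-monomial n h (con K.1#) .coeff≈ k)) (coeff-• h (monomial (con K.1#) n) k))

  -- On x^ℓ the summand -2ℓ x^ℓ and the doubled sum of `A` become `Θ`, as 2t = θ; what is left is t
  -- p_0 x^ℓ and t p_ℓ. At 1 the equation would fail: the left side is 0 and the right side 2 t p_0.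
  tA-positive : ∀ F → Positive F → t • A F ≈ₓ linearₓ Θ F +ₓ ((t ⊗ p 0) • F +ₓ constant (t ⊗ ev F))
  tA-positive = agree-positive Λ̄[x]-monoid (additive-∘ₓ (additive-• t) additive-A)
    (additive-∙ _ (additive-linearₓ Θ) (additive-∙ _ (additive-• _) additive-constant)) monomials
    where
    additive-constant : IsAdditive Λ̄[x]-monoid (λ F → constant (t ⊗ ev F))
    additive-constant .cong e     = monomial-cong 0 (⊗-cong refl (additive-ev .cong e))
    additive-constant .[]-homo    = Ringₓ.trans (monomial-cong 0 (Ring.zeroʳ t)) 0∷[]≈[]
    additive-constant .+-homo F G = Ringₓ.trans
      (monomial-cong 0 (trans (⊗-cong refl (additive-ev .+-homo F G)) (distrib t _ _))) (monomial-⊕ 0 _ _)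

    monomials : ∀ h m → t • A (monomial h (suc m))
      ≈ₓ linearₓ Θ (monomial h (suc m)) +ₓ ((t ⊗ p 0) • monomial h (suc m) +ₓ constant (t ⊗ ev (monomial h (suc m))))
    -- Comparing the coefficients of x^k brings scalars and monomials into the single ring Λ̄; `ε`
    -- and `ε₀` are the indicators of k = m + 1 and k = 0.
    monomials h m = mk≈ λ k → begin
      coeff (t • A (monomial h (suc m))) k
        ≈⟨ coeff-• t (A (monomial h (suc m))) k ⟩
      t ⊗ coeff (A (monomial h (suc m))) k
        ≈⟨ ⊗-cong refl (trans (≡⇒≋ (≡.cong (λ F → coeff F k) (A≡linearₓ (monomial h (suc m)))))
             (trans (linearₓ-monomial Aₓ h (suc m) .coeff≈ k) (coeff-• h (Aₓ (suc m)) k))) ⟩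
      t ⊗ (h ⊗ coeff (Aₓ (suc m)) k)
        ≈⟨ ⊗-cong refl (⊗-cong refl (A-coeff k)) ⟩
      t ⊗ (h ⊗ ((p 0 ⊕ ⊖ (# 2 ⊗ c)) ⊗ ε k ⊕ p (suc m) ⊗ ε₀ k ⊕ # 2 ⊗ Σ k))
        ≈⟨ Solver.solve 8 (λ t h p₀ c e p e₀ s →
             t :* (h :* ((p₀ :+ :- (:# 2 :* c)) :* e :+ p :* e₀ :+ :# 2 :* s))
             := h :* (((t :+ t) :* :- c) :* e :+ (t :+ t) :* s)
                :+ ((t :* p₀) :* (h :* e) :+ (t :* (h :* p)) :* e₀))
             refl t h (p 0) c (ε k) (p (suc m)) (ε₀ k) (Σ k) ⟩
      h ⊗ (((t ⊕ t) ⊗ ⊖ c) ⊗ ε k ⊕ (t ⊕ t) ⊗ Σ k) ⊕ ((t ⊗ p 0) ⊗ (h ⊗ ε k) ⊕ (t ⊗ (h ⊗ p (suc m))) ⊗ ε₀ k)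
        ≈⟨ ⊕-cong (⊗-cong refl (⊕-cong (⊗-cong (⊗-cong θ≋t+t refl) refl) (⊗-cong θ≋t+t refl))) refl ⟨
      h ⊗ ((con θ ⊗ ⊖ c) ⊗ ε k ⊕ con θ ⊗ Σ k) ⊕ ((t ⊗ p 0) ⊗ (h ⊗ ε k) ⊕ (t ⊗ (h ⊗ p (suc m))) ⊗ ε₀ k)
        ≈⟨ ⊕-cong (⊗-cong refl (Θ-coeff k)) (⊕-cong (⊗-cong refl (coeff-monomial h (suc m) k))
             (⊗-cong (⊗-cong refl (ev-monomial h (suc m))) refl)) ⟨
      h ⊗ coeff (Θ (suc m)) k ⊕ ((t ⊗ p 0) ⊗ coeff (monomial h (suc m)) k
        ⊕ (t ⊗ ev (monomial h (suc m))) ⊗ ε₀ k)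
        ≈⟨ ⊕-cong (trans (linearₓ-monomial Θ h (suc m) .coeff≈ k) (coeff-• h (Θ (suc m)) k))
             (⊕-cong (coeff-• (t ⊗ p 0) (monomial h (suc m)) k) (coeff-monomial _ 0 k)) ⟨
      coeff (linearₓ Θ (monomial h (suc m))) k ⊕ (coeff ((t ⊗ p 0) • monomial h (suc m)) k
        ⊕ coeff (constant (t ⊗ ev (monomial h (suc m)))) k)
        ≈⟨ trans (coeff-+ (linearₓ Θ (monomial h (suc m)))
               ((t ⊗ p 0) • monomial h (suc m) +ₓ constant (t ⊗ ev (monomial h (suc m)))) k)
             (⊕-cong refl (coeff-+ ((t ⊗ p 0) • monomial h (suc m)) (constant (t ⊗ ev (monomial h (suc m)))) k)) ⟨
      coeff (linearₓ Θ (monomial h (suc m))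
        +ₓ ((t ⊗ p 0) • monomial h (suc m) +ₓ constant (t ⊗ ev (monomial h (suc m))))) k ∎
      where
      open ≋-Reasoning
      c : Λ̄
      c = con (K.fromℕ (suc m))

      lead lead′ Σₓ : Λ̄[x]
      lead  = monomial (p 0 ⊕ ⊖ con (K.fromℕ (2 ℕ.* suc m))) (suc m)
      lead′ = monomial (con θ ⊗ ⊖ c) (suc m)
      Σₓ    = sumₓ {m} (λ b → monomial (p (suc (toℕ b))) (m ∸ toℕ b))

      ε ε₀ Σ : ℕ → Λ̄
      ε k  = coeff (monomial (con K.1#) (suc m)) k
      ε₀ k = coeff (monomial (con K.1#) 0) k
      Σ k  = coeff Σₓ k

      double : con (K.fromℕ (2 ℕ.* suc m)) ≋ # 2 ⊗ c
      double = trans (con-fromℕ (2 ℕ.* suc m)) (trans (Ring.×1-homo-* 2 (suc m))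
        (⊗-cong refl (sym (con-fromℕ (suc m)))))

      A-coeff : ∀ k → coeff (Aₓ (suc m)) k ≋ (p 0 ⊕ ⊖ (# 2 ⊗ c)) ⊗ ε k ⊕ p (suc m) ⊗ ε₀ k ⊕ # 2 ⊗ Σ k
      A-coeff k = trans (coeff-+ (lead +ₓ constant (p (suc m))) (con (K.fromℕ 2) • Σₓ) k)
        (⊕-cong (trans (coeff-+ lead (constant (p (suc m))) k)
                  (⊕-cong (trans (coeff-monomial _ (suc m) k) (⊗-cong (⊕-cong refl (⊖-cong double)) refl))
                          (coeff-monomial _ 0 k)))
                (trans (coeff-• (con (K.fromℕ 2)) Σₓ k) (⊗-cong (con-fromℕ 2) refl)))

      exponent : ∀ (b : Fin m) → suc (m ∸ suc (toℕ b)) ≡ m ∸ toℕ b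
      exponent b = ≡.sym (ℕ.+-∸-assoc 1 (Fin.toℕ<n b))

      Σₓ-θ : sumₓ {m} (λ b → monomial (con θ ⊗ p (suc (toℕ b))) (suc (m ∸ suc (toℕ b)))) ≈ₓ con θ • Σₓ
      Σₓ-θ = Ringₓ.trans (Ringₓ.sum-cong-≋ {m} λ b → Ringₓ.trans
          (Ringₓ.reflexive (≡.cong (monomial _) (exponent b)))
          (Ringₓ.sym (•-monomial (m ∸ toℕ b) (con θ) (p (suc (toℕ b))))))
        (Ringₓ.sym (sum-homo (additive-• (con θ)) m (λ b → monomial (p (suc (toℕ b))) (m ∸ toℕ b))))

      Θ-coeff : ∀ k → coeff (Θ (suc m)) k ≋ (con θ ⊗ ⊖ c) ⊗ ε k ⊕ con θ ⊗ Σ k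
      Θ-coeff k = trans (coeff-+ lead′ (sumₓ {m} (λ b → monomial (con θ ⊗ p (suc (toℕ b))) (suc (m ∸ suc (toℕ b))))) k) (⊕-cong (coeff-monomial _ (suc m) k)
        (trans (Σₓ-θ .coeff≈ k) (coeff-• (con θ) Σₓ k)))

  𝖣-positive : ∀ F → Positive F → 𝖣 (K.- θ) F ≈ₓ T F +ₓ ((t ⊗ p 0) • F +ₓ constant (t ⊗ ev F))
  𝖣-positive F F⁺ = Ringₓ.trans (𝖣≈ F) (Ringₓ.trans (Λ̄[x].+-cong (Ringₓ.refl {∂ F}) (tA-positive F F⁺))
    (Ringₓ.sym (Λ̄[x].+-assoc (∂ F) (linearₓ Θ F) _)))

  𝖣-constant : ∀ g → 𝖣 (K.- θ) (constant g) ≈ₓ ∂₀ g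
  𝖣-constant g = Ringₓ.trans (𝖣≈ (constant g)) (Ringₓ.trans (Λ̄[x].+-cong
    (Ringₓ.trans (Λ̄[x].+-cong (Ringₓ.refl {∂₀ g}) 0∷[]≈[]) (Ringₓ.+-identityʳ (∂₀ g)))
    (additive-• t .cong (Ringₓ.trans (Ringₓ.reflexive (A≡linearₓ (constant g))) (linearₓ-monomial Aₓ g 0))))
    (Ringₓ.+-identityʳ (∂₀ g)))

  -- The operators 𝓛₂ and 𝓛₃ in terms of T

  e₁ e₂ e₃ : Λ̄ → Λ̄
  e₁ f = ev (∂₀ f)
  e₂ f = ev (T (∂₀ f))
  e₃ f = ev (T (T (∂₀ f)))

  module _ (f : Λ̄) where

    private
      F₁ F₂ : Λ̄[x]
      F₁ = ∂₀ f
      F₂ = T F₁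
      u : Λ̄
      u = t ⊗ p 0

      F₁⁺ : Positive F₁
      F₁⁺ = coeff-∂₀-zero f

      D′ : Λ̄[x] → Λ̄[x]
      D′ = 𝖣 (K.- θ)

      D² : D′ (D′ (constant f)) ≈ₓ F₂ +ₓ (u • F₁ +ₓ constant (t ⊗ e₁ f))
      D² = Ringₓ.trans (additive-𝖣 .cong (𝖣-constant f)) (𝖣-positive F₁ F₁⁺)

      -- The constant `t ⊗ e₁ f` of `D²` is hit by `∂` alone, the two other summands fall under
      -- `𝖣-positive`. After `ev` this constant gives `t ⊗ e₁ (e₁ f)`, and 4 θ t = 2 θ² is the
      -- coefficient of E².
      D³ : D′ (D′ (D′ (constant f))) ≈ₓ (T F₂ +ₓ (u • F₂ +ₓ constant (t ⊗ e₂ f)))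
        +ₓ ((T (u • F₁) +ₓ (u • (u • F₁) +ₓ constant (t ⊗ ev (u • F₁)))) +ₓ ∂₀ (t ⊗ e₁ f))
      D³ = Ringₓ.trans (additive-𝖣 .cong D²) (Ringₓ.trans (additive-𝖣 .+-homo F₂ _) (Λ̄[x].+-cong
        (𝖣-positive F₂ (T-positive F₁ F₁⁺))
        (Ringₓ.trans (additive-𝖣 .+-homo (u • F₁) _) (Λ̄[x].+-cong
          (𝖣-positive (u • F₁) (trans (coeff-• u F₁ 0) (trans (⊗-cong refl F₁⁺) (Ring.zeroʳ u))))
          (𝖣-constant (t ⊗ e₁ f))))))

    𝓛₂ : 𝓛 2 (K.- θ) f ≋ e₂ f ⊕ (u ⊗ e₁ f ⊕ (t ⊗ e₁ f) ⊗ p 0)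
    𝓛₂ = trans (additive-ev .cong D²) (trans (additive-ev .+-homo F₂ _) (⊕-cong refl
      (trans (additive-ev .+-homo (u • F₁) _) (⊕-cong (ev-• u F₁) (ev-monomial _ 0)))))

    𝓛₃ : 𝓛 3 (K.- θ) f ≋ (e₃ f ⊕ (u ⊗ e₂ f ⊕ (t ⊗ e₂ f) ⊗ p 0))
      ⊕ ((u ⊗ e₂ f ⊕ (u ⊗ (u ⊗ e₁ f) ⊕ (t ⊗ (u ⊗ e₁ f)) ⊗ p 0)) ⊕ t ⊗ e₁ (e₁ f))
    𝓛₃ = trans (additive-ev .cong D³) (trans (additive-ev .+-homo (T F₂ +ₓ (u • F₂ +ₓ constant (t ⊗ e₂ f))) _)
      (⊕-cong
        (trans (additive-ev .+-homo (T F₂) _) (⊕-cong refl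
          (trans (additive-ev .+-homo (u • F₂) _) (⊕-cong (ev-• u F₂) (ev-monomial _ 0)))))
        (trans (additive-ev .+-homo (T (u • F₁) +ₓ _) _) (⊕-cong
          (trans (additive-ev .+-homo (T (u • F₁)) _) (⊕-cong
            (trans (additive-ev .cong (T-• Ringₓ.refl F₁)) (ev-• u F₂))
            (trans (additive-ev .+-homo (u • (u • F₁)) _) (⊕-cong
              (trans (ev-• u (u • F₁)) (⊗-cong refl (ev-• u F₁)))
              (trans (ev-monomial _ 0) (⊗-cong (⊗-cong refl (ev-• u F₁)) refl))))))
          (ev-• t (∂₀ (e₁ f)))))))

  -- Expansion in the derivatives D_a

  ∂/∂-bound : ∀ h a → bound h ≤ a → ∂/∂ ℕ._≟_ (suc a) h ≋ con K.0#
  ∂/∂-bound (con c)       a h≤a = refl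
  ∂/∂-bound (var zero)    a h≤a = refl
  ∂/∂-bound (var (suc b)) a h≤a with a ℕ.≡ᵇ b | ℕ.≡ᵇ⇒≡ a b
  ... | false | _   = refl
  ... | true  | a≡b = contradiction (≡.subst (suc b ≤_) (a≡b _) h≤a) ℕ.1+n≰n
  ∂/∂-bound (f ⊕ g) a h≤a = trans (⊕-cong (∂/∂-bound f a (ℕ.m⊔n≤o⇒m≤o _ _ h≤a)) (∂/∂-bound g a (ℕ.m⊔n≤o⇒n≤o _ _ h≤a)))
    (⊕-identity _)
  ∂/∂-bound (f ⊗ g) a h≤a = trans (⊕-cong (⊗-cong (∂/∂-bound f a (ℕ.m⊔n≤o⇒m≤o _ _ h≤a)) refl)
                                          (⊗-cong refl (∂/∂-bound g a (ℕ.m⊔n≤o⇒n≤o _ _ h≤a))))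
    (Solver.solve 2 (λ f g → :# 0 :* g :+ f :* :# 0 := :# 0) refl f g)
  ∂/∂-bound (⊖ f) a h≤a = trans (⊖-cong (∂/∂-bound f a h≤a)) Ring.-0#≈0#

  module _ {M : CommutativeMonoid 0ℓ 0ℓ} {Ψ : Λ̄[x] → CommutativeMonoid.Carrier M} (add : IsAdditive M Ψ) where

    private module M where
      open CommutativeMonoid M public
      open Algebra.Properties.CommutativeMonoid.Sum M public

    -- `B` is free because a normally ordered form applied to f lets all indices run up to
    -- `bound f`, also for the derivatives of f, whose own bounds can be smaller.
    expand-∂₀ : ∀ h B → bound h ≤ B → Ψ (∂₀ h) M.≈ M.sum {B} (λ a → Ψ (monomial (D (suc (toℕ a)) h) (suc (toℕ a))))
    expand-∂₀ h B h≤B = M.trans (add .cong (positive (coeff-∂₀-zero h))) (M.trans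
      (expand M (additive-0∷ M add) (divideByX (∂₀ h)) B λ a B≤a → trans (coeff-tail a)
        (trans (⊗-cong refl (∂/∂-bound h a (ℕ.≤-trans h≤B B≤a))) (Ring.zeroʳ _)))
      (M.sum-cong-≋ {B} λ a → add .cong (monomial-cong (suc (toℕ a)) (coeff-tail (toℕ a)))))
      where
      coeff-tail : ∀ a → coeff (divideByX (∂₀ h)) a ≋ D (suc a) h
      coeff-tail a = trans (≡⇒≋ (coeff-divideByX (∂₀ h) a)) (coeff-∂₀ h a)

  E≋e₁ : ∀ f → E f ≋ e₁ f
  E≋e₁ f = sym (trans (expand-∂₀ additive-ev f (bound f) ℕ.≤-refl) (Ring.sum-cong-≋ {n = bound f} λ a →
    trans (ev-monomial _ (suc (toℕ a))) (⊗-comm _ _)))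

  -- Cancellation of p_0

  rhs : Λ̄ → Λ̄
  rhs f = (K.fromℕ 4 K.* θ) · 𝓛 3 (K.- θ) f
        ⊕ ⊖ ((K.fromℕ 6 K.* θ K.^ 2) · (p 0 ⊗ 𝓛 2 (K.- θ) f))
        ⊕ (K.fromℕ 4 K.* θ K.^ 3) · (p 0 ↑ 2 ⊗ E f)

  rhs≋ : ∀ f → rhs f ≋ (# 4 ⊗ con θ) ⊗ e₃ f ⊕ (# 2 ⊗ (con θ ⊗ con θ)) ⊗ e₁ (e₁ f)
  rhs≋ f = begin
    rhs f
      ≈⟨ ⊕-cong (⊕-cong (⊗-cong (trans (con-* _ _) (⊗-cong (con-fromℕ 4) θ≋t+t)) (𝓛₃ f))
                        (⊖-cong (⊗-cong (scalar 6 2) (⊗-cong refl (𝓛₂ f)))))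
                (⊗-cong (scalar 4 3) (⊗-cong refl (E≋e₁ f))) ⟩
    -- With θ = 2t, the coefficient of p_0 `e₂` is 12 θ t - 6 θ² = 0, and that of p_0² `e₁` is 8 θ
    -- t² - 12 θ² t + 4 θ³ = (2 - 6 + 4) θ³ = 0. These two equations account for the constants 6 and
    -- 4 of the correction terms.
    _ ≈⟨ Solver.solve 6 (λ t p e₁ e₂ e₃ e₁₁ → let u = t :* p; θ = t :+ t in
           (:# 4 :* θ) :* ((e₃ :+ (u :* e₂ :+ (t :* e₂) :* p))
             :+ ((u :* e₂ :+ (u :* (u :* e₁) :+ (t :* (u :* e₁)) :* p)) :+ t :* e₁₁))
           :+ :- ((:# 6 :* (θ :* (θ :* :# 1))) :* (p :* (e₂ :+ (u :* e₁ :+ (t :* e₁) :* p))))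
           :+ (:# 4 :* (θ :* (θ :* (θ :* :# 1)))) :* ((p :* (p :* :# 1)) :* e₁)
           := (:# 4 :* θ) :* e₃ :+ (:# 2 :* (θ :* θ)) :* e₁₁)
           refl t (p 0) (e₁ f) (e₂ f) (e₃ f) (e₁ (e₁ f)) ⟩
    (# 4 ⊗ (t ⊕ t)) ⊗ e₃ f ⊕ (# 2 ⊗ ((t ⊕ t) ⊗ (t ⊕ t))) ⊗ e₁ (e₁ f)
      ≈⟨ ⊕-cong (⊗-cong (⊗-cong refl θ≋t+t) refl) (⊗-cong (⊗-cong refl (⊗-cong θ≋t+t θ≋t+t)) refl) ⟨
    (# 4 ⊗ con θ) ⊗ e₃ f ⊕ (# 2 ⊗ (con θ ⊗ con θ)) ⊗ e₁ (e₁ f) ∎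
    where
    open ≋-Reasoning
    scalar : ∀ n k → con (K.fromℕ n K.* θ K.^ k) ≋ # n ⊗ (t ⊕ t) ↑ k
    scalar n k = trans (con-* _ _) (⊗-cong (con-fromℕ n) (trans (con-^ θ k) (↑-cong k θ≋t+t)))

  -- Divided differences of symmetric polynomials

  module _ {N : ℕ} {i j : Fin N} (i≢j : i ≢ j) where

    private
      data Position (k : Fin N) : Set where
        first  : k ≡ i → Position k
        second : k ≡ j → Position k
        other  : k ≢ i → k ≢ j → Position k

      position : ∀ k → Position k
      position k with k Fin.≟ i | k Fin.≟ j
      ... | yes e | _     = first e
      ... | no _  | yes e = second e
      ... | no n  | no n′ = other n n′

      transpose-i : transpose i j i ≡ j
      transpose-i rewrite dec-true (i Fin.≟ i) ≡.refl = ≡.refl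

      transpose-j : transpose i j j ≡ i
      transpose-j rewrite dec-false (j Fin.≟ i) (i≢j ∘ ≡.sym) | dec-true (j Fin.≟ j) ≡.refl = ≡.refl

      transpose-other : ∀ {k} → k ≢ i → k ≢ j → transpose i j k ≡ k
      transpose-other {k} k≢i k≢j rewrite dec-false (k Fin.≟ i) k≢i | dec-false (k Fin.≟ j) k≢j = ≡.refl

      ∇-var-j : ∇ i j (var j) ≡ ⊖ con K.1#
      ∇-var-j rewrite dec-false (j Fin.≟ i) (i≢j ∘ ≡.sym) | dec-true (j Fin.≟ j) ≡.refl = ≡.refl

      ∇-var-other : ∀ {k} → k ≢ i → k ≢ j → ∇ i j (var k) ≡ con K.0#
      ∇-var-other {k} k≢i k≢j rewrite dec-false (k Fin.≟ i) k≢i | dec-false (k Fin.≟ j) k≢j = ≡.refl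

    ∇-var-i : ∇ i j (var i) ≡ con K.1#
    ∇-var-i rewrite dec-true (i Fin.≟ i) ≡.refl = ≡.refl

    s-var-i : s i j (var i) ≡ var j
    s-var-i = ≡.cong var transpose-i

    s-involutive : ∀ f → s i j (s i j f) ≋ f
    s-involutive (con a) = refl
    s-involutive (var k) = ≡⇒≋ (≡.cong var (case (position k)))
      where
      case : ∀ {k} → Position k → transpose i j (transpose i j k) ≡ k
      case (first ≡.refl)  = ≡.trans (≡.cong (transpose i j) transpose-i) transpose-j
      case (second ≡.refl) = ≡.trans (≡.cong (transpose i j) transpose-j) transpose-i
      case (other n n′)    = ≡.trans (≡.cong (transpose i j) (transpose-other n n′)) (transpose-other n n′)
    s-involutive (f ⊕ g) = ⊕-cong (s-involutive f) (s-involutive g)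
    s-involutive (f ⊗ g) = ⊗-cong (s-involutive f) (s-involutive g)
    s-involutive (⊖ f)   = ⊖-cong (s-involutive f)

    ∇-s : ∀ f → ∇ i j (s i j f) ≋ ⊖ ∇ i j f
    ∇-s (con a) = sym Ring.-0#≈0#
    ∇-s (var k) = case (position k)
      where
      case : ∀ {k} → Position k → ∇ i j (var (transpose i j k)) ≋ ⊖ ∇ i j (var k)
      case (first ≡.refl)  = ≡⇒≋ (≡.trans (≡.cong (∇ i j ∘ var) transpose-i)
        (≡.trans ∇-var-j (≡.cong ⊖_ (≡.sym ∇-var-i))))
      case (second ≡.refl) = trans (≡⇒≋ (≡.trans (≡.cong (∇ i j ∘ var) transpose-j) ∇-var-i))
        (trans (Solver.solve 1 (λ x → x := :- (:- x)) refl (con K.1#)) (⊖-cong (≡⇒≋ (≡.sym ∇-var-j))))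
      case (other n n′) = trans (≡⇒≋ (≡.trans (≡.cong (∇ i j ∘ var) (transpose-other n n′)) (∇-var-other n n′)))
        (trans (sym Ring.-0#≈0#) (⊖-cong (≡⇒≋ (≡.sym (∇-var-other n n′)))))
    ∇-s (f ⊕ g) = trans (⊕-cong (∇-s f) (∇-s g))
      (Solver.solve 2 (λ a b → :- a :+ :- b := :- (a :+ b)) refl (∇ i j f) (∇ i j g))
    ∇-s (f ⊗ g) = begin
      ∇ i j (s i j f) ⊗ s i j g ⊕ s i j (s i j f) ⊗ ∇ i j (s i j g)
        ≈⟨ ⊕-cong (⊗-cong (∇-s f) refl) (⊗-cong (s-involutive f) (∇-s g)) ⟩
      (⊖ ∇ i j f) ⊗ s i j g ⊕ f ⊗ ⊖ ∇ i j g
        ≈⟨ Solver.solve 4 (λ a sg f b → :- a :* sg :+ f :* :- b := :- (b :* f :+ sg :* a)) refl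
             (∇ i j f) (s i j g) f (∇ i j g) ⟩
      -- The twist has passed from the first factor to the second; this is the Leibniz rule for the
      -- product in reverse order.
      ⊖ ∇ i j (g ⊗ f)
        ≈⟨ ⊖-cong (∇-cong i j (⊗-comm g f)) ⟩
      ⊖ ∇ i j (f ⊗ g) ∎
      where open ≋-Reasoning
    ∇-s (⊖ f) = ⊖-cong (∇-s f)

    -- `∇-quotient` would require cancelling x_i - x_j. Instead ∇ f = ∇ (s f) = - ∇ f, and 2 is
    -- invertible.
    ∇-symmetric : ∀ {f} → s i j f ≋ f → ∇ i j f ≋ con K.0#
    ∇-symmetric {f} e = begin
      a                                    ≈⟨ ⊗-identity a ⟨
      con K.1# ⊗ a                         ≈⟨ ⊗-cong half refl ⟩
      (# 2 ⊗ h) ⊗ a                        ≈⟨ Solver.solve 2 (λ h a → (:# 2 :* h) :* a := h :* (a :+ a)) refl h a ⟩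
      h ⊗ (a ⊕ a)                          ≈⟨ ⊗-cong refl (⊕-cong (trans (sym (∇-cong i j e)) (∇-s f)) refl) ⟩
      h ⊗ (⊖ a ⊕ a)                        ≈⟨ Solver.solve 2 (λ h a → h :* (:- a :+ a) := :# 0) refl h a ⟩
      con K.0#                             ∎
      where
      open ≋-Reasoning
      a h : Poly (Fin N)
      a = ∇ i j f
      h = con 1/[1+ 1 ]

  -- (x^n - y^n)/(x - y) at x = x_i, y = x_j
  geometric : ∀ {N} → Fin N → Fin N → ℕ → Poly (Fin N)
  geometric i j n = ∑[ b < n ] (var j ↑ toℕ b ⊗ var i ↑ (n ∸ suc (toℕ b)))

  geometric-suc : ∀ {N} (i j : Fin N) n → geometric i j (suc n)
    ≋ var i ↑ n ⊕ ∑[ b < n ] (var j ↑ suc (toℕ b) ⊗ var i ↑ (n ∸ suc (toℕ b)))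
  geometric-suc i j n = ⊕-cong (⊗-identity _) refl

  ∇-↑ : ∀ {N} {i j : Fin N} → i ≢ j → ∀ n → ∇ i j (var i ↑ n) ≋ geometric i j n
  ∇-↑ i≢j zero = refl
  ∇-↑ {i = i} {j} i≢j (suc n) = begin
    ∇ i j (var i) ⊗ var i ↑ n ⊕ s i j (var i) ⊗ ∇ i j (var i ↑ n)
      ≈⟨ ⊕-cong (trans (⊗-cong (≡⇒≋ (∇-var-i i≢j)) refl) (⊗-identity _))
                (⊗-cong (≡⇒≋ (s-var-i i≢j)) (∇-↑ i≢j n)) ⟩
    var i ↑ n ⊕ var j ⊗ geometric i j n
      ≈⟨ ⊕-cong refl (trans (Ring.*-distribˡ-sum {n = n} (var j) _)
           (Ring.sum-cong-≋ {n = n} λ b → sym (⊗-assoc (var j) _ _))) ⟩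
    var i ↑ n ⊕ ∑[ b < n ] (var j ↑ suc (toℕ b) ⊗ var i ↑ (n ∸ suc (toℕ b)))
      ≈⟨ geometric-suc i j n ⟨
    geometric i j (suc n) ∎
    where open ≋-Reasoning

  -- Finite sums and derivatives of powers

  sum-const : ∀ n (f : Poly X) → sum {n = n} (λ _ → f) ≋ con (K.fromℕ n) ⊗ f
  sum-const zero    f = sym (Ring.zeroˡ f)
  sum-const (suc n) f = trans (⊕-cong refl (sum-const n f))
    (trans (Solver.solve 2 (λ f n → f :+ n :* f := (:# 1 :+ n) :* f) refl f (con (K.fromℕ n))) (⊗-cong (sym (con-+ _ _)) refl))

  -- Restoring the term j = i turns the sum in 𝒟_i into one over all j, in which power sums can be
  -- recognised.
  sum-omit : ∀ {N} (i : Fin N) (g : Fin N → Poly X) →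
    ∑[ j < N ] (if does (j Fin.≟ i) then con K.0# else g j) ⊕ g i ≋ sum g
  sum-omit {N = suc N} zero    g = trans (⊕-cong (⊕-identity _) refl) (⊕-comm _ _)
  sum-omit {N = suc N} (suc i) g = trans (⊕-assoc _ _ _) (⊕-cong refl (sum-omit i (g ∘ suc)))

  if-0 : ∀ (b : Bool) {f : Poly X} → (b ≡ false → f ≋ con K.0#) → (if b then con K.0# else f) ≋ con K.0#
  if-0 true  e = refl
  if-0 false e = e ≡.refl

  does-false : ∀ {N} {i j : Fin N} → does (j Fin.≟ i) ≡ false → i ≢ j
  does-false {i = i} e ≡.refl with ≡.trans (≡.sym (dec-true (i Fin.≟ i) ≡.refl)) e
  ... | ()

  sum-single : ∀ {N} (i : Fin N) (g : Fin N → Poly X) → (∀ {j} → i ≢ j → g j ≋ con K.0#) → sum g ≋ g i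
  sum-single {N = N} i g e = trans (sym (sum-omit i g)) (trans
    (⊕-cong (sum-0 N λ j → if-0 (does (j Fin.≟ i)) (e ∘ does-false {i = i} {j})) refl) (⊕-identity _))

  x∂-↑ : ∀ {N} (i : Fin N) n → var i ⊗ ∂/∂ Fin._≟_ i (var i ↑ n) ≋ con (K.fromℕ n) ⊗ var i ↑ n
  x∂-↑ i zero    = Solver.solve 1 (λ x → x :* :# 0 := :# 0 :* :# 1) refl (var i)
  x∂-↑ i (suc n) = begin
    var i ⊗ (∂/∂ Fin._≟_ i (var i) ⊗ var i ↑ n ⊕ var i ⊗ ∂/∂ Fin._≟_ i (var i ↑ n))
      ≈⟨ ⊗-cong refl (⊕-cong (⊗-cong (≡⇒≋ ∂-var) refl) (x∂-↑ i n)) ⟩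
    var i ⊗ (con K.1# ⊗ var i ↑ n ⊕ con (K.fromℕ n) ⊗ var i ↑ n)
      ≈⟨ Solver.solve 3 (λ x y n → x :* (:# 1 :* y :+ n :* y) := (:# 1 :+ n) :* (x :* y)) refl
           (var i) (var i ↑ n) (con (K.fromℕ n)) ⟩
    (con K.1# ⊕ con (K.fromℕ n)) ⊗ var i ↑ suc n
      ≈⟨ ⊗-cong (con-+ _ _) refl ⟨
    con (K.fromℕ (suc n)) ⊗ var i ↑ suc n ∎
    where
    open ≋-Reasoning
    ∂-var : ∂/∂ Fin._≟_ i (var i) ≡ con K.1#
    ∂-var rewrite dec-true (i Fin.≟ i) ≡.refl = ≡.refl

  ∂-↑-other : ∀ {N} {i j : Fin N} → i ≢ j → ∀ n → ∂/∂ Fin._≟_ i (var j ↑ n) ≋ con K.0#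
  ∂-↑-other i≢j zero = refl
  ∂-↑-other {i = i} {j} i≢j (suc n) = trans (⊕-cong (⊗-cong (≡⇒≋ ∂-var) refl) (⊗-cong refl (∂-↑-other i≢j n)))
    (Solver.solve 2 (λ x y → :# 0 :* y :+ x :* :# 0 := :# 0) refl (var j) (var j ↑ n))
    where
    ∂-var : ∂/∂ Fin._≟_ i (var j) ≡ con K.0#
    ∂-var rewrite dec-false (i Fin.≟ j) i≢j = ≡.refl

  ∂/∂-sum : ∀ {N} (i : Fin N) n (f : Fin n → Poly (Fin N)) →
    ∂/∂ Fin._≟_ i (sum f) ≡ sum (λ k → ∂/∂ Fin._≟_ i (f k))
  ∂/∂-sum i zero    f = ≡.refl
  ∂/∂-sum i (suc n) f = ≡.cong (∂/∂ Fin._≟_ i (f zero) ⊕_) (∂/∂-sum i n (f ∘ suc))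

  ↑-+ : ∀ (x : Poly X) m n → x ↑ (m ℕ.+ n) ≋ x ↑ m ⊗ x ↑ n
  ↑-+ x zero    n = sym (⊗-identity _)
  ↑-+ x (suc m) n = trans (⊗-cong refl (↑-+ x m n)) (sym (⊗-assoc _ _ _))

  -- The value of p_0 is irrelevant below, so N and M are independent.
  module Specialization (N M : ℕ) where

    π̄ : Λ̄ → Poly (Fin M)
    π̄ h = π M ((p₀↦ N) h)

    π̄-cong : ∀ {f g} → f ≋ g → π̄ f ≋ π̄ g
    π̄-cong e = evalAt-cong _ (evalAt-cong _ e)

    π̄-ι : ∀ g → π̄ (ι g) ≋ π M g
    π̄-ι (con a) = refl
    π̄-ι (var a) = refl
    π̄-ι (f ⊕ g) = ⊕-cong (π̄-ι f) (π̄-ι g)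
    π̄-ι (f ⊗ g) = ⊗-cong (π̄-ι f) (π̄-ι g)
    π̄-ι (⊖ f)   = ⊖-cong (π̄-ι f)

    s-π̄ : ∀ i j h → s i j (π̄ h) ≋ π̄ h
    s-π̄ i j (con a)       = refl
    s-π̄ i j (var zero)    = refl
    s-π̄ i j (var (suc a)) = begin
      s i j (∑[ k < M ] (var k ↑ suc a))
        ≡⟨ evalAt-sum (var ∘ transpose i j) M (λ k → var k ↑ suc a) ⟩
      ∑[ k < M ] s i j (var k ↑ suc a)
        ≈⟨ Ring.sum-cong-≋ {n = M} (λ k → ≡⇒≋ (evalAt-↑ (var ∘ transpose i j) (var k) (suc a))) ⟩
      ∑[ k < M ] (var (transpose i j k) ↑ suc a)
        ≈⟨ Algebra.Properties.CommutativeMonoid.Sum.∑-permute (Ring.+-commutativeMonoid {Fin M})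
             (λ k → var k ↑ suc a) (Permutation.transpose i j) ⟨
      ∑[ k < M ] (var k ↑ suc a) ∎
      where open ≋-Reasoning
    s-π̄ i j (f ⊕ g) = ⊕-cong (s-π̄ i j f) (s-π̄ i j g)
    s-π̄ i j (f ⊗ g) = ⊗-cong (s-π̄ i j f) (s-π̄ i j g)
    s-π̄ i j (⊖ f)   = ⊖-cong (s-π̄ i j f)

    ∇-π̄ : ∀ {i j} → i ≢ j → ∀ h → ∇ i j (π̄ h) ≋ con K.0#
    ∇-π̄ i≢j h = ∇-symmetric i≢j (s-π̄ _ _ h)

    φ : Fin M → Λ̄[x] → Poly (Fin M)
    φ i = linear π̄ (var i ↑_)

    Λ_M-monoid : CommutativeMonoid 0ℓ 0ℓ
    Λ_M-monoid = Ring.+-commutativeMonoid {Fin M}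

    additive-φ : ∀ i → IsAdditive Λ_M-monoid (φ i)
    additive-φ i = additive-linear π̄-cong refl (λ _ _ → refl) (var i ↑_)

    φ-monomial : ∀ i h n → φ i (monomial h n) ≋ π̄ h ⊗ var i ↑ n
    φ-monomial i h n = linear-monomial π̄-cong refl (λ _ _ → refl) (var i ↑_) h n

    φ-• : ∀ i g F → φ i (g • F) ≋ π̄ g ⊗ φ i F
    φ-• i g = agree Λ_M-monoid (additive-∘ₓ (additive-φ i) (additive-• g))
      (additive-∘ {M = Λ_M-monoid} {M′ = Λ_M-monoid} (⊗-cong refl) (Ring.zeroʳ _) (distrib (π̄ g)) (additive-φ i))
      λ h n → trans (additive-φ i .cong (•-monomial n g h)) (trans (φ-monomial i (g ⊗ h) n)
        (trans (⊗-assoc _ _ _) (⊗-cong refl (sym (φ-monomial i h n)))))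

    φ-neg : ∀ i F → φ i (-ₓ F) ≋ ⊖ φ i F
    φ-neg i F = begin
      φ i (-ₓ F)                            ≈⟨ Solver.solve 2 (λ a b → a := (a :+ b) :+ :- b) refl (φ i (-ₓ F)) (φ i F) ⟩
      φ i (-ₓ F) ⊕ φ i F ⊕ ⊖ φ i F          ≈⟨ ⊕-cong (additive-φ i .+-homo (-ₓ F) F) refl ⟨
      φ i (-ₓ F +ₓ F) ⊕ ⊖ φ i F             ≈⟨ ⊕-cong (additive-φ i .cong (Λ̄[x].+-inverseˡ F)) refl ⟩
      con K.0# ⊕ ⊖ φ i F                    ≈⟨ ⊕-identity _ ⟩
      ⊖ φ i F                               ∎
      where open ≋-Reasoning

    φ-shift : ∀ i n F → φ i (shift n F) ≋ var i ↑ n ⊗ φ i F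
    φ-shift i n = agree Λ_M-monoid (additive-∘ₓ (additive-φ i) (additive-shift n))
      (additive-∘ {M = Λ_M-monoid} {M′ = Λ_M-monoid} (⊗-cong refl) (Ring.zeroʳ _) (distrib _) (additive-φ i))
      λ h m → trans (additive-φ i .cong (Ringₓ.reflexive (shift-monomial n h m))) (trans (φ-monomial i h (n ℕ.+ m))
        (trans (⊗-cong refl (↑-+ (var i) n m)) (trans
          (Solver.solve 3 (λ h x y → h :* (x :* y) := x :* (h :* y)) refl (π̄ h) (var i ↑ n) (var i ↑ m))
          (⊗-cong refl (sym (φ-monomial i h m))))))

    -- Both sides obey the Leibniz rule along `π̄`. On a power sum only the summand x_i^a survives,
    -- giving a x_i^a, the image of `∂` p_a.
    ∂-φ : ∀ i h → var i ⊗ ∂/∂ Fin._≟_ i (π̄ h) ≋ φ i (∂₀ h)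
    ∂-φ i (con a)       = Ring.zeroʳ _
    ∂-φ i (var zero)    = Ring.zeroʳ _
    ∂-φ i (var (suc a)) = begin
      var i ⊗ ∂/∂ Fin._≟_ i (∑[ k < M ] (var k ↑ suc a))
        ≈⟨ ⊗-cong refl (≡⇒≋ (∂/∂-sum i M (λ k → var k ↑ suc a))) ⟩
      var i ⊗ ∑[ k < M ] ∂/∂ Fin._≟_ i (var k ↑ suc a)
        ≈⟨ ⊗-cong refl (sum-single i _ λ i≢j → ∂-↑-other i≢j (suc a)) ⟩
      var i ⊗ ∂/∂ Fin._≟_ i (var i ↑ suc a)
        ≈⟨ x∂-↑ i (suc a) ⟩
      con (K.fromℕ (suc a)) ⊗ var i ↑ suc a
        ≈⟨ φ-monomial i (con (K.fromℕ (suc a))) (suc a) ⟨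
      φ i (∂₀ (var (suc a))) ∎
      where open ≋-Reasoning
    ∂-φ i (f ⊕ g) = trans (distrib _ _ _) (trans (⊕-cong (∂-φ i f) (∂-φ i g)) (sym (additive-φ i .+-homo (∂₀ f) (∂₀ g))))
    ∂-φ i (f ⊗ g) = trans (Solver.solve 5 (λ x f g f′ g′ → x :* (f′ :* g :+ f :* g′) := g :* (x :* f′) :+ f :* (x :* g′)) refl
        (var i) (π̄ f) (π̄ g) (∂/∂ Fin._≟_ i (π̄ f)) (∂/∂ Fin._≟_ i (π̄ g)))
      (trans (⊕-cong (trans (⊗-cong refl (∂-φ i f)) (sym (φ-• i g (∂₀ f)))) (trans (⊗-cong refl (∂-φ i g)) (sym (φ-• i f (∂₀ g)))))
        (sym (additive-φ i .+-homo (g • ∂₀ f) (f • ∂₀ g))))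
    ∂-φ i (⊖ f) = trans (Solver.solve 2 (λ x f′ → x :* :- f′ := :- (x :* f′)) refl (var i) (∂/∂ Fin._≟_ i (π̄ f)))
      (trans (⊖-cong (∂-φ i f)) (sym (φ-neg i (∂₀ f))))

    -- The difference part of 𝒟_i vanishes on the symmetric polynomial `π̄ h`, so only the partial
    -- derivative remains.
    x𝒟-π̄ : ∀ i h → x𝒟 i (π̄ h) ≋ φ i (∂₀ h)
    x𝒟-π̄ i h = trans (⊗-cong refl (trans (⊕-cong refl (trans (⊗-cong refl (sum-0 M λ j →
        if-0 (does (j Fin.≟ i)) λ e → ∇-π̄ (does-false {i = i} {j} e) h)) (Ring.zeroʳ _))) (Ring.+-identityʳ _)))
      (∂-φ i h)

    c : K.Carrier
    c = θ K.* K.fromℕ M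

    private
      -- Let ℓ = m + 1. The symmetric factor H leaves each divided difference, and x_i ∑_j (x_i^ℓ -
      -- x_j^ℓ)/(x_i - x_j) over all j is M x_i^ℓ + ∑_{0<a<ℓ} p_a x_i^{ℓ-a}. Removing the term j = i
      -- subtracts ℓ x_i^ℓ. Times θ, this is `Θ` together with the scalar c = θ M.
      monomials : ∀ i h m → x𝒟 i (φ i (monomial h (suc m)))
        ≋ φ i (T (monomial h (suc m))) ⊕ c · φ i (monomial h (suc m))
      monomials i h m = begin
        x𝒟 i (φ i (monomial h (suc m)))
          ≈⟨ x𝒟-cong i (φ-monomial i h (suc m)) ⟩
        x ⊗ ((dH ⊗ X′ ⊕ H ⊗ dX) ⊕ con θ ⊗ O)
          ≈⟨ Solver.solve 7 (λ x dH X H dX t O → x :* ((dH :* X :+ H :* dX) :+ t :* O)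
               := X :* (x :* dH) :+ H :* (x :* dX) :+ t :* (x :* O)) refl x dH X′ H dX (con θ) O ⟩
        X′ ⊗ (x ⊗ dH) ⊕ H ⊗ (x ⊗ dX) ⊕ con θ ⊗ (x ⊗ O)
          ≈⟨ ⊕-cong (⊕-cong (⊗-cong refl (∂-φ i h)) (⊗-cong refl (x∂-↑ i (suc m)))) (⊗-cong refl xO) ⟩
        X′ ⊗ φ i (∂₀ h) ⊕ H ⊗ (n ⊗ X′) ⊕ con θ ⊗ (H ⊗ (con (K.fromℕ M) ⊗ X′ ⊕ Z) ⊕ ⊖ (H ⊗ (n ⊗ X′)))
          ≈⟨ Solver.solve 7 (λ X d H n t M Z → X :* d :+ H :* (n :* X) :+ t :* (H :* (M :* X :+ Z) :+ :- (H :* (n :* X)))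
               := (X :* d :+ ((H :* (n :+ t :* :- n)) :* X :+ (H :* t) :* Z)) :+ (t :* M) :* (H :* X)) refl
               X′ (φ i (∂₀ h)) H n (con θ) (con (K.fromℕ M)) Z ⟩
        (X′ ⊗ φ i (∂₀ h) ⊕ (π̄ (h ⊗ κ (suc m)) ⊗ X′ ⊕ (H ⊗ con θ) ⊗ Z)) ⊕ (con θ ⊗ con (K.fromℕ M)) ⊗ (H ⊗ X′)
          ≈⟨ ⊕-cong (⊕-cong (φ-shift i (suc m) (∂₀ h)) (⊕-cong (φ-monomial i (h ⊗ κ (suc m)) (suc m)) lowerSum))
                    (⊗-cong (con-* _ _) (φ-monomial i h (suc m))) ⟨
        (φ i (shift (suc m) (∂₀ h)) ⊕ (φ i (monomial (h ⊗ κ (suc m)) (suc m)) ⊕ φ i (sumₓ (lowerTerms h m))))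
          ⊕ c · φ i (monomial h (suc m))
          ≈⟨ ⊕-cong (trans (additive-φ i .cong (T-monomial h m)) (trans
               (additive-φ i .+-homo (shift (suc m) (∂₀ h)) (monomial (h ⊗ κ (suc m)) (suc m) +ₓ sumₓ (lowerTerms h m)))
               (⊕-cong refl (additive-φ i .+-homo (monomial (h ⊗ κ (suc m)) (suc m)) (sumₓ (lowerTerms h m)))))) refl ⟨
        φ i (T (monomial h (suc m))) ⊕ c · φ i (monomial h (suc m)) ∎
        where
        open ≋-Reasoning
        x X′ H dX dH n O Z : Poly (Fin M)
        x  = var i
        X′ = var i ↑ suc m
        H  = π̄ h
        dX = ∂/∂ Fin._≟_ i X′
        dH = ∂/∂ Fin._≟_ i H
        n  = con (K.fromℕ (suc m))
        O  = ∑[ j < M ] (if does (j Fin.≟ i) then con K.0# else ∇ i j (H ⊗ X′))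
        Z  = ∑[ b < m ] (π̄ (p (suc (toℕ b))) ⊗ var i ↑ suc (m ∸ suc (toℕ b)))

        ∇-HX : ∀ j → i ≢ j → ∇ i j (H ⊗ X′) ≋ H ⊗ geometric i j (suc m)
        ∇-HX j i≢j = trans (⊕-cong (trans (⊗-cong (∇-π̄ i≢j h) refl) (Ring.zeroˡ _))
          (⊗-cong (s-π̄ i j h) (∇-↑ i≢j (suc m)))) (⊕-identity _)

        O+ : O ⊕ H ⊗ geometric i i (suc m) ≋ H ⊗ ∑[ j < M ] geometric i j (suc m)
        O+ = trans (⊕-cong (Ring.sum-cong-≋ {n = M} λ j → branch j (does (j Fin.≟ i)) (does-false {i = i} {j})) refl)
          (trans (sum-omit i (λ j → H ⊗ geometric i j (suc m))) (sym (Ring.*-distribˡ-sum {n = M} H (λ j → geometric i j (suc m)))))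
          where
          branch : ∀ j b → (b ≡ false → i ≢ j) → (if b then con K.0# else ∇ i j (H ⊗ X′))
            ≋ (if b then con K.0# else H ⊗ geometric i j (suc m))
          branch j true  _ = refl
          branch j false e = ∇-HX j (e ≡.refl)

        -- At j = i the m + 1 summands all coincide with x_i^m.
        x-diagonal : x ⊗ geometric i i (suc m) ≋ n ⊗ X′
        x-diagonal = trans (⊗-cong refl (Ring.sum-cong-≋ {n = suc m} λ b →
            trans (sym (↑-+ (var i) (toℕ b) (m ∸ toℕ b))) (≡⇒≋ (≡.cong (var i ↑_) (ℕ.m+[n∸m]≡n (ℕ.s≤s⁻¹ (Fin.toℕ<n b)))))))
          (trans (⊗-cong refl (sum-const (suc m) (var i ↑ m)))
          (Solver.solve 3 (λ x n y → x :* (n :* y) := n :* (x :* y)) refl x n (var i ↑ m)))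

        -- The summand with exponent 0 at x_j is the same for all M values of j; each other one sums
        -- over j to a power sum.
        x-all : x ⊗ ∑[ j < M ] geometric i j (suc m) ≋ con (K.fromℕ M) ⊗ X′ ⊕ Z
        x-all = begin
          x ⊗ ∑[ j < M ] geometric i j (suc m)
            ≈⟨ ⊗-cong refl (trans (Ring.sum-cong-≋ {n = M} λ j → geometric-suc i j m)
                 (Ring.∑-distrib-+ {n = M} (λ _ → var i ↑ m) _)) ⟩
          x ⊗ (∑[ j < M ] (var i ↑ m) ⊕ ∑[ j < M ] ∑[ b < m ] (var j ↑ suc (toℕ b) ⊗ W b))
            ≈⟨ ⊗-cong refl (⊕-cong (sum-const M (var i ↑ m)) (trans
                 (Ring.∑-comm {m = M} {n = m} (λ j b → var j ↑ suc (toℕ b) ⊗ W b))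
                 (Ring.sum-cong-≋ {n = m} λ b → sym (Ring.*-distribʳ-sum {n = M} (W b) (λ j → var j ↑ suc (toℕ b)))))) ⟩
          x ⊗ (con (K.fromℕ M) ⊗ var i ↑ m ⊕ ∑[ b < m ] (π̄ (p (suc (toℕ b))) ⊗ W b))
            ≈⟨ trans (distrib x _ _) (⊕-cong
                 (Solver.solve 3 (λ x n y → x :* (n :* y) := n :* (x :* y)) refl x (con (K.fromℕ M)) (var i ↑ m))
                 (trans (Ring.*-distribˡ-sum {n = m} x (λ b → π̄ (p (suc (toℕ b))) ⊗ W b)) (Ring.sum-cong-≋ {n = m} λ b →
                   Solver.solve 3 (λ x n y → x :* (n :* y) := n :* (x :* y)) refl x (π̄ (p (suc (toℕ b)))) (W b)))) ⟩
          con (K.fromℕ M) ⊗ X′ ⊕ Z ∎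
          where
          W : Fin m → Poly (Fin M)
          W b = var i ↑ (m ∸ suc (toℕ b))

        xO : x ⊗ O ≋ H ⊗ (con (K.fromℕ M) ⊗ X′ ⊕ Z) ⊕ ⊖ (H ⊗ (n ⊗ X′))
        xO = begin
          x ⊗ O
            ≈⟨ Solver.solve 4 (λ x O H g → x :* O := x :* (O :+ H :* g) :+ :- (H :* (x :* g))) refl
                 x O H (geometric i i (suc m)) ⟩
          x ⊗ (O ⊕ H ⊗ geometric i i (suc m)) ⊕ ⊖ (H ⊗ (x ⊗ geometric i i (suc m)))
            ≈⟨ ⊕-cong (trans (⊗-cong refl O+) (Solver.solve 3 (λ x n y → x :* (n :* y) := n :* (x :* y)) refl
                 x H (∑[ j < M ] geometric i j (suc m)))) refl ⟩
          H ⊗ (x ⊗ ∑[ j < M ] geometric i j (suc m)) ⊕ ⊖ (H ⊗ (x ⊗ geometric i i (suc m)))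
            ≈⟨ ⊕-cong (⊗-cong refl x-all) (⊖-cong (⊗-cong refl x-diagonal)) ⟩
          H ⊗ (con (K.fromℕ M) ⊗ X′ ⊕ Z) ⊕ ⊖ (H ⊗ (n ⊗ X′)) ∎

        lowerSum : φ i (sumₓ (lowerTerms h m)) ≋ (H ⊗ con θ) ⊗ Z
        lowerSum = trans (sum-homo (additive-φ i) m (lowerTerms h m)) (trans
          (Ring.sum-cong-≋ {n = m} λ b → trans (φ-monomial i (h ⊗ (con θ ⊗ p (suc (toℕ b)))) (suc (m ∸ suc (toℕ b))))
            (Solver.solve 4 (λ H t P Y → (H :* (t :* P)) :* Y := (H :* t) :* (P :* Y)) refl
              H (con θ) (π̄ (p (suc (toℕ b)))) (var i ↑ suc (m ∸ suc (toℕ b)))))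
          (sym (Ring.*-distribˡ-sum {n = m} (H ⊗ con θ) _)))

    x𝒟-φ : ∀ i F → Positive F → x𝒟 i (φ i F) ≋ φ i (T F) ⊕ c · φ i F
    x𝒟-φ i = agree-positive Λ_M-monoid
      (additive-∘ {M = Λ_M-monoid} {M′ = Λ_M-monoid} (x𝒟-cong i) (x𝒟-0 i) (x𝒟-⊕ i) (additive-φ i))
      (additive-∙ Λ_M-monoid (additive-∘ₓ (additive-φ i) additive-T)
        (additive-∘ {M = Λ_M-monoid} {M′ = Λ_M-monoid} (⊗-cong refl) (Ring.zeroʳ _) (distrib _) (additive-φ i)))
      (monomials i)

    -- ∑_i x_i^n is the image of p_n for n ≥ 1. At n = 0 the left side would count M while p_0
    -- specializes to N, whence the restriction to multiples of x.
    sum-φ : ∀ F → Positive F → ∑[ i < M ] φ i F ≋ π̄ (ev F)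
    sum-φ = agree-positive Λ_M-monoid additive-sum
      (additive-∘ {M = Λ̄-monoid} {M′ = Λ_M-monoid} π̄-cong refl (λ _ _ → refl) additive-ev)
      λ h n → trans (Ring.sum-cong-≋ {n = M} λ i → φ-monomial i h (suc n))
        (trans (sym (Ring.*-distribˡ-sum {n = M} (π̄ h) _)) (sym (π̄-cong (ev-monomial h (suc n)))))
      where
      additive-sum : IsAdditive Λ_M-monoid (λ F → ∑[ i < M ] φ i F)
      additive-sum .cong e     = Ring.sum-cong-≋ {n = M} λ i → additive-φ i .cong e
      additive-sum .[]-homo    = sum-0 M λ i → refl
      additive-sum .+-homo F G = trans (Ring.sum-cong-≋ {n = M} λ i → additive-φ i .+-homo F G)
        (Ring.∑-distrib-+ {n = M} (λ i → φ i F) (λ i → φ i G))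

    module _ (f : Λ̄) where

      private
        F₁ F₂ : Λ̄[x]
        F₁ = ∂₀ f
        F₂ = T F₁

        F₁⁺ : Positive F₁
        F₁⁺ = coeff-∂₀-zero f

        F₂⁺ : Positive F₂
        F₂⁺ = T-positive F₁ F₁⁺

        x𝒟² : ∀ i → x𝒟 i (x𝒟 i (π̄ f)) ≋ φ i F₂ ⊕ con c ⊗ φ i F₁
        x𝒟² i = trans (x𝒟-cong i (x𝒟-π̄ i f)) (x𝒟-φ i F₁ F₁⁺)

        x𝒟³ : ∀ i → x𝒟 i (x𝒟 i (x𝒟 i (π̄ f))) ≋ φ i (T F₂) ⊕ (# 2 ⊗ con c) ⊗ φ i F₂ ⊕ (con c ⊗ con c) ⊗ φ i F₁
        x𝒟³ i = trans (x𝒟-cong i (x𝒟² i)) (trans (x𝒟-⊕ i (φ i F₂) (con c ⊗ φ i F₁)) (trans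
          (⊕-cong (x𝒟-φ i F₂ F₂⁺) (trans (x𝒟-· i c (φ i F₁)) (⊗-cong refl (x𝒟-φ i F₁ F₁⁺))))
          (Solver.solve 4 (λ c f₁ f₂ f₃ → (f₃ :+ c :* f₂) :+ c :* (f₂ :+ c :* f₁)
            := f₃ :+ (:# 2 :* c) :* f₂ :+ (c :* c) :* f₁) refl (con c) (φ i F₁) (φ i F₂) (φ i (T F₂)))))

        sum-· : ∀ a F → Positive F → ∑[ i < M ] (a ⊗ φ i F) ≋ a ⊗ π̄ (ev F)
        sum-· a F F⁺ = trans (sym (Ring.*-distribˡ-sum {n = M} a _)) (⊗-cong refl (sum-φ F F⁺))

      𝒫₁ : 𝒫 M 1 (π̄ f) ≋ π̄ (e₁ f)
      𝒫₁ = trans (Ring.sum-cong-≋ {n = M} λ i → x𝒟-π̄ i f) (sum-φ F₁ F₁⁺)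

      𝒫₂ : 𝒫 M 2 (π̄ f) ≋ π̄ (e₂ f) ⊕ con c ⊗ π̄ (e₁ f)
      𝒫₂ = trans (Ring.sum-cong-≋ {n = M} x𝒟²) (trans (Ring.∑-distrib-+ {n = M} (λ i → φ i F₂) _)
        (⊕-cong (sum-φ F₂ F₂⁺) (sum-· (con c) F₁ F₁⁺)))

      𝒫₃ : 𝒫 M 3 (π̄ f) ≋ π̄ (e₃ f) ⊕ (# 2 ⊗ con c) ⊗ π̄ (e₂ f) ⊕ (con c ⊗ con c) ⊗ π̄ (e₁ f)
      𝒫₃ = trans (Ring.sum-cong-≋ {n = M} x𝒟³) (trans
        (Ring.∑-distrib-+ {n = M} (λ i → φ i (T F₂) ⊕ (# 2 ⊗ con c) ⊗ φ i F₂) (λ i → (con c ⊗ con c) ⊗ φ i F₁))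
        (⊕-cong (trans (Ring.∑-distrib-+ {n = M} (λ i → φ i (T F₂)) (λ i → (# 2 ⊗ con c) ⊗ φ i F₂))
          (⊕-cong (sum-φ (T F₂) (T-positive F₂ F₂⁺)) (sum-· _ F₂ F₂⁺))) (sum-· _ F₁ F₁⁺)))

  -- Normal ordering

  bound-∂/∂ : ∀ a f → bound (∂/∂ ℕ._≟_ a f) ≤ bound f
  bound-∂/∂ a (con c) = z≤n
  bound-∂/∂ a (var b) with a ℕ.≡ᵇ b
  ... | true  = z≤n
  ... | false = z≤n
  bound-∂/∂ a (f ⊕ g) = ℕ.⊔-mono-≤ (bound-∂/∂ a f) (bound-∂/∂ a g)
  bound-∂/∂ a (f ⊗ g) = ℕ.⊔-lub (ℕ.⊔-mono-≤ (bound-∂/∂ a f) ℕ.≤-refl) (ℕ.⊔-mono-≤ (ℕ.≤-refl {bound f}) (bound-∂/∂ a g))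
  bound-∂/∂ a (⊖ f)   = bound-∂/∂ a f

  -- The derivation ∑_c p_{n+c} D_c of Λ̄; for n = 0 it is `e₁` by definition.
  V : ℕ → Λ̄ → Λ̄
  V n h = ev (shift n (∂₀ h))

  additive-V : ∀ n → IsAdditive Λ̄-monoid (λ F → ev (shift n F))
  additive-V n = additive-∘ₓ additive-ev (additive-shift n)

  V-expand : ∀ n h B → bound h ≤ B → V n h ≋ ∑[ c < B ] (D (suc (toℕ c)) h ⊗ p (n ℕ.+ suc (toℕ c)))
  V-expand n h B h≤B = trans (expand-∂₀ (additive-V n) h B h≤B) (Ring.sum-cong-≋ {n = B} λ c →
    trans (additive-ev .cong (Ringₓ.reflexive (shift-monomial n _ (suc (toℕ c))))) (ev-monomial _ _))

  V-• : ∀ n g F → ev (shift n (g • F)) ≋ g ⊗ ev (shift n F)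
  V-• n g F = agree Λ̄-monoid
    (additive-∘ₓ (additive-V n) (additive-• g))
    (additive-∘ {M = Λ̄-monoid} {M′ = Λ̄-monoid} {Υ = g ⊗_} (⊗-cong refl) (Ring.zeroʳ g) (distrib g) (additive-V n))
    (λ h m → trans (additive-V n .cong (•-monomial m g h)) (trans (shifted (g ⊗ h) m)
      (trans (⊗-assoc g h _) (⊗-cong refl (sym (shifted h m)))))) F
    where
    shifted : ∀ h m → ev (shift n (monomial h m)) ≋ h ⊗ p (n ℕ.+ m)
    shifted h m = trans (additive-ev .cong (Ringₓ.reflexive (shift-monomial n h m))) (ev-monomial _ _)

  V-⊗ : ∀ n g h → V n (g ⊗ h) ≋ h ⊗ V n g ⊕ g ⊗ V n h
  V-⊗ n g h = trans (additive-V n .+-homo (h • ∂₀ g) (g • ∂₀ h)) (⊕-cong (V-• n h (∂₀ g)) (V-• n g (∂₀ h)))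

  V-p : ∀ n a → V n (p (suc a)) ≋ con (K.fromℕ (suc a)) ⊗ p (n ℕ.+ suc a)
  V-p n a = trans (additive-ev .cong (Ringₓ.reflexive (shift-monomial n _ (suc a)))) (ev-monomial _ _)

  V-0 : ∀ n h → ∂₀ h ≡ [] → V n h ≋ con K.0#
  V-0 n h e = trans (additive-V n .cong (Ringₓ.reflexive e)) (additive-V n .[]-homo)

  lower : ∀ {m} → Fin m → ℕ
  lower {m} b = suc (m ∸ suc (toℕ b))

  θp : ℕ → Λ̄
  θp b = con θ ⊗ p (suc b)

  -- This is `ev` `T` x^{m+1}. By `evT-monomial`, h ↦ `ev` `T` (h x^{m+1}) is multiplication by it
  -- plus the derivation `V (suc m)`.
  c₁′ : ℕ → Λ̄
  c₁′ m = κ (suc m) ⊗ p (suc m) ⊕ ∑[ b < m ] (θp (toℕ b) ⊗ p (lower b))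

  evT-monomial : ∀ h m → ev (T (monomial h (suc m))) ≋ V (suc m) h ⊕ h ⊗ c₁′ m
  evT-monomial h m = begin
    ev (T (monomial h (suc m)))
      ≈⟨ additive-ev .cong (T-monomial h m) ⟩
    ev (shift (suc m) (∂₀ h) +ₓ (monomial (h ⊗ κ (suc m)) (suc m) +ₓ sumₓ (lowerTerms h m)))
      ≈⟨ trans (additive-ev .+-homo (shift (suc m) (∂₀ h)) _) (⊕-cong refl
           (trans (additive-ev .+-homo (monomial (h ⊗ κ (suc m)) (suc m)) (sumₓ (lowerTerms h m)))
           (⊕-cong (ev-monomial _ _) (sum-homo additive-ev m (lowerTerms h m))))) ⟩
    V (suc m) h ⊕ ((h ⊗ κ (suc m)) ⊗ p (suc m) ⊕ ∑[ b < m ] ev (lowerTerms h m b))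
      ≈⟨ ⊕-cong refl (⊕-cong (⊗-assoc _ _ _) (Ring.sum-cong-≋ {n = m} λ b → trans (ev-monomial _ _) (⊗-assoc _ _ _))) ⟩
    V (suc m) h ⊕ (h ⊗ (κ (suc m) ⊗ p (suc m)) ⊕ ∑[ b < m ] (h ⊗ (θp (toℕ b) ⊗ p (lower b))))
      ≈⟨ ⊕-cong refl (trans (⊕-cong refl (sym (Ring.*-distribˡ-sum {n = m} h _))) (sym (distrib h _ _))) ⟩
    V (suc m) h ⊕ h ⊗ c₁′ m ∎
    where open ≋-Reasoning

  -- ev T² x^{m+1}, and the coefficients of D_c and D_d D_c in ev T² (x^{m+1} h)
  c₁ : ℕ → Λ̄
  c₁ m = κ (suc m) ⊗ c₁′ m ⊕ ∑[ b < m ] (θp (toℕ b) ⊗ c₁′ (m ∸ suc (toℕ b))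
    ⊕ con θ ⊗ (con (K.fromℕ (suc (toℕ b))) ⊗ p (lower b ℕ.+ suc (toℕ b))))

  c₂ : ℕ → ℕ → Λ̄
  c₂ m c = c₁′ (m ℕ.+ suc c) ⊕ (κ (suc m) ⊗ p (suc m ℕ.+ suc c) ⊕ ∑[ b < m ] (θp (toℕ b) ⊗ p (lower b ℕ.+ suc c)))

  c₃ : ℕ → ℕ → ℕ → Λ̄
  c₃ m c d = p (suc (m ℕ.+ suc c) ℕ.+ suc d)

  module _ (B : ℕ) where

    bound-D : ∀ a {h} → bound h ≤ B → bound (D a h) ≤ B
    bound-D a {h} = ℕ.≤-trans (bound-∂/∂ a h)

    private
      -- The only source of second derivatives of h: `∂₀ h` already contains the D_c h, to each of
      -- which `evT-monomial` applies one more derivation.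
      shifted : ∀ h m → bound h ≤ B → ev (T (shift (suc m) (∂₀ h)))
        ≋ ∑[ c < B ] (D (suc (toℕ c)) h ⊗ c₁′ (m ℕ.+ suc (toℕ c)))
        ⊕ ∑[ c < B ] ∑[ d < B ] (D (suc (toℕ d)) (D (suc (toℕ c)) h) ⊗ c₃ m (toℕ c) (toℕ d))
      shifted h m h≤B = begin
        ev (T (shift (suc m) (∂₀ h)))
          ≈⟨ expand-∂₀ (additive-∘ₓ (additive-∘ₓ additive-ev additive-T) (additive-shift (suc m))) h B h≤B ⟩
        ∑[ c < B ] ev (T (shift (suc m) (monomial (D (suc (toℕ c)) h) (suc (toℕ c)))))
          ≈⟨ Ring.sum-cong-≋ {n = B} (λ c → trans (additive-∘ₓ additive-ev additive-T .cong
               (Ringₓ.reflexive (shift-monomial (suc m) (D (suc (toℕ c)) h) (suc (toℕ c)))))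
               (trans (evT-monomial _ (m ℕ.+ suc (toℕ c))) (⊕-comm _ _))) ⟩
        ∑[ c < B ] (D (suc (toℕ c)) h ⊗ c₁′ (m ℕ.+ suc (toℕ c)) ⊕ V (suc (m ℕ.+ suc (toℕ c))) (D (suc (toℕ c)) h))
          ≈⟨ Ring.∑-distrib-+ {n = B} (λ c → D (suc (toℕ c)) h ⊗ c₁′ (m ℕ.+ suc (toℕ c)))
               (λ c → V (suc (m ℕ.+ suc (toℕ c))) (D (suc (toℕ c)) h)) ⟩
        ∑[ c < B ] (D (suc (toℕ c)) h ⊗ c₁′ (m ℕ.+ suc (toℕ c)))
          ⊕ ∑[ c < B ] V (suc (m ℕ.+ suc (toℕ c))) (D (suc (toℕ c)) h)
          ≈⟨ ⊕-cong refl (Ring.sum-cong-≋ {n = B} λ c → V-expand (suc (m ℕ.+ suc (toℕ c))) (D (suc (toℕ c)) h) B (bound-D (suc (toℕ c)) {h} h≤B)) ⟩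
        ∑[ c < B ] (D (suc (toℕ c)) h ⊗ c₁′ (m ℕ.+ suc (toℕ c)))
          ⊕ ∑[ c < B ] ∑[ d < B ] (D (suc (toℕ d)) (D (suc (toℕ c)) h) ⊗ c₃ m (toℕ c) (toℕ d)) ∎
        where open ≋-Reasoning

      diagonal : ∀ h m → bound h ≤ B → ev (T (monomial (h ⊗ κ (suc m)) (suc m)))
        ≋ ∑[ c < B ] (D (suc (toℕ c)) h ⊗ (κ (suc m) ⊗ p (suc m ℕ.+ suc (toℕ c)))) ⊕ h ⊗ (κ (suc m) ⊗ c₁′ m)
      diagonal h m h≤B = trans (evT-monomial _ m) (⊕-cong (begin
        V (suc m) (h ⊗ k)                  ≈⟨ V-⊗ (suc m) h k ⟩
        k ⊗ V (suc m) h ⊕ h ⊗ V (suc m) k  ≈⟨ ⊕-cong (⊗-cong refl (V-expand (suc m) h B h≤B)) (⊗-cong refl (V-0 (suc m) k ≡.refl)) ⟩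
        k ⊗ sum (λ c → Dh c ⊗ P c) ⊕ h ⊗ con K.0#
          ≈⟨ trans (⊕-cong refl (Ring.zeroʳ h)) (Ring.+-identityʳ _) ⟩
        k ⊗ sum (λ c → Dh c ⊗ P c)           ≈⟨ Ring.*-distribˡ-sum {n = B} k (λ c → Dh c ⊗ P c) ⟩
        sum (λ c → k ⊗ (Dh c ⊗ P c))         ≈⟨ Ring.sum-cong-≋ {n = B} (λ c →
                                              Solver.solve 3 (λ k d q → k :* (d :* q) := d :* (k :* q)) refl k (Dh c) (P c)) ⟩
        sum (λ c → Dh c ⊗ (k ⊗ P c))         ∎) (⊗-assoc _ _ _))
        where
        open ≋-Reasoning
        k : Λ̄
        k = κ (suc m)
        Dh P : Fin B → Λ̄
        Dh c = D (suc (toℕ c)) h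
        P c = p (suc m ℕ.+ suc (toℕ c))

      off-diagonal : ∀ h m → bound h ≤ B → ∑[ b < m ] ev (T (lowerTerms h m b))
        ≋ ∑[ c < B ] (D (suc (toℕ c)) h ⊗ ∑[ b < m ] (θp (toℕ b) ⊗ p (lower b ℕ.+ suc (toℕ c))))
        ⊕ h ⊗ ∑[ b < m ] (θp (toℕ b) ⊗ c₁′ (m ∸ suc (toℕ b))
                ⊕ con θ ⊗ (con (K.fromℕ (suc (toℕ b))) ⊗ p (lower b ℕ.+ suc (toℕ b))))
      off-diagonal h m h≤B = begin
        ∑[ b < m ] ev (T (lowerTerms h m b))
          ≈⟨ Ring.sum-cong-≋ {n = m} term ⟩
        ∑[ b < m ] (∑[ c < B ] (Dh c ⊗ (θp (toℕ b) ⊗ p (lower b ℕ.+ suc (toℕ c)))) ⊕ h ⊗ R b)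
          ≈⟨ Ring.∑-distrib-+ {n = m} (λ b → ∑[ c < B ] (Dh c ⊗ (θp (toℕ b) ⊗ p (lower b ℕ.+ suc (toℕ c))))) (λ b → h ⊗ R b) ⟩
        ∑[ b < m ] ∑[ c < B ] (Dh c ⊗ (θp (toℕ b) ⊗ p (lower b ℕ.+ suc (toℕ c)))) ⊕ ∑[ b < m ] (h ⊗ R b)
          ≈⟨ ⊕-cong (Ring.∑-comm {m = m} {n = B} (λ b c → Dh c ⊗ (θp (toℕ b) ⊗ p (lower b ℕ.+ suc (toℕ c)))))
                    (sym (Ring.*-distribˡ-sum {n = m} h R)) ⟩
        ∑[ c < B ] ∑[ b < m ] (Dh c ⊗ (θp (toℕ b) ⊗ p (lower b ℕ.+ suc (toℕ c)))) ⊕ h ⊗ sum R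
          ≈⟨ ⊕-cong (Ring.sum-cong-≋ {n = B} λ c →
               sym (Ring.*-distribˡ-sum {n = m} (Dh c) (λ b → θp (toℕ b) ⊗ p (lower b ℕ.+ suc (toℕ c))))) refl ⟩
        ∑[ c < B ] (Dh c ⊗ ∑[ b < m ] (θp (toℕ b) ⊗ p (lower b ℕ.+ suc (toℕ c)))) ⊕ h ⊗ sum R ∎
        where
        open ≋-Reasoning
        Dh : Fin B → Λ̄
        Dh c = D (suc (toℕ c)) h
        R : Fin m → Λ̄
        R b = θp (toℕ b) ⊗ c₁′ (m ∸ suc (toℕ b)) ⊕ con θ ⊗ (con (K.fromℕ (suc (toℕ b))) ⊗ p (lower b ℕ.+ suc (toℕ b)))

        -- By the Leibniz rule `V` differentiates h or the coefficient θ p_{b+1}. The second case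
        -- produces the summand of `R b` with the factor b + 1.
        term : ∀ b → ev (T (lowerTerms h m b))
          ≋ ∑[ c < B ] (Dh c ⊗ (θp (toℕ b) ⊗ p (lower b ℕ.+ suc (toℕ c)))) ⊕ h ⊗ R b
        term b = begin
          ev (T (lowerTerms h m b))
            ≈⟨ evT-monomial (h ⊗ q) (m ∸ suc (toℕ b)) ⟩
          V (lower b) (h ⊗ q) ⊕ (h ⊗ q) ⊗ e
            ≈⟨ ⊕-cong (trans (V-⊗ (lower b) h q) (⊕-cong (⊗-cong refl (V-expand (lower b) h B h≤B))
                 (⊗-cong refl (trans (V-⊗ (lower b) (con θ) (p (suc (toℕ b))))
                   (⊕-cong (⊗-cong refl (V-0 (lower b) (con θ) ≡.refl)) (⊗-cong refl (V-p (lower b) (toℕ b)))))))) refl ⟩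
          (q ⊗ sum (λ c → Dh c ⊗ P c) ⊕ h ⊗ (p (suc (toℕ b)) ⊗ con K.0# ⊕ con θ ⊗ r)) ⊕ (h ⊗ q) ⊗ e
            ≈⟨ Solver.solve 7 (λ q s h z t r e → (q :* s :+ h :* (z :* :# 0 :+ t :* r)) :+ (h :* q) :* e
                 := q :* s :+ h :* (q :* e :+ t :* r)) refl q (sum (λ c → Dh c ⊗ P c)) h (p (suc (toℕ b))) (con θ) r e ⟩
          q ⊗ sum (λ c → Dh c ⊗ P c) ⊕ h ⊗ (q ⊗ e ⊕ con θ ⊗ r)
            ≈⟨ ⊕-cong (trans (Ring.*-distribˡ-sum {n = B} q (λ c → Dh c ⊗ P c)) (Ring.sum-cong-≋ {n = B} λ c →
                 Solver.solve 3 (λ k d q → k :* (d :* q) := d :* (k :* q)) refl q (Dh c) (P c))) refl ⟩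
          sum (λ c → Dh c ⊗ (q ⊗ P c)) ⊕ h ⊗ (q ⊗ e ⊕ con θ ⊗ r) ∎
          where
          q e r : Λ̄
          q = θp (toℕ b)
          e = c₁′ (m ∸ suc (toℕ b))
          r = con (K.fromℕ (suc (toℕ b))) ⊗ p (lower b ℕ.+ suc (toℕ b))
          P : Fin B → Λ̄
          P c = p (lower b ℕ.+ suc (toℕ c))

    evT²-monomial : ∀ h m → bound h ≤ B → ev (T (T (monomial h (suc m))))
      ≋ h ⊗ c₁ m ⊕ (∑[ c < B ] (D (suc (toℕ c)) h ⊗ c₂ m (toℕ c))
        ⊕ ∑[ c < B ] ∑[ d < B ] (D (suc (toℕ d)) (D (suc (toℕ c)) h) ⊗ c₃ m (toℕ c) (toℕ d)))
    evT²-monomial h m h≤B = begin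
      ev (T (T (monomial h (suc m))))
        ≈⟨ additive-evT .cong (T-monomial h m) ⟩
      ev (T (shift (suc m) (∂₀ h) +ₓ (monomial (h ⊗ κ (suc m)) (suc m) +ₓ sumₓ (lowerTerms h m))))
        ≈⟨ trans (additive-evT .+-homo (shift (suc m) (∂₀ h)) (monomial (h ⊗ κ (suc m)) (suc m) +ₓ sumₓ (lowerTerms h m))) (⊕-cong (shifted h m h≤B)
             (trans (additive-evT .+-homo (monomial (h ⊗ κ (suc m)) (suc m)) (sumₓ (lowerTerms h m)))
             (⊕-cong (diagonal h m h≤B) (trans (sum-homo additive-evT m (lowerTerms h m)) (off-diagonal h m h≤B))))) ⟩
      (sum X₁ ⊕ X₄) ⊕ ((sum X₂ ⊕ h ⊗ z₁) ⊕ (sum X₃ ⊕ h ⊗ z₂))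
        ≈⟨ Solver.solve 7 (λ x₁ x₂ x₃ y h z₁ z₂ → (x₁ :+ y) :+ ((x₂ :+ h :* z₁) :+ (x₃ :+ h :* z₂))
             := h :* (z₁ :+ z₂) :+ ((x₁ :+ (x₂ :+ x₃)) :+ y)) refl (sum X₁) (sum X₂) (sum X₃) X₄ h z₁ z₂ ⟩
      h ⊗ c₁ m ⊕ ((sum X₁ ⊕ (sum X₂ ⊕ sum X₃)) ⊕ X₄)
        ≈⟨ ⊕-cong refl (⊕-cong (⊕-cong refl (Ring.∑-distrib-+ {n = B} X₂ X₃)) refl) ⟨
      h ⊗ c₁ m ⊕ ((sum X₁ ⊕ sum (λ c → X₂ c ⊕ X₃ c)) ⊕ X₄)
        ≈⟨ ⊕-cong refl (⊕-cong (Ring.∑-distrib-+ {n = B} X₁ (λ c → X₂ c ⊕ X₃ c)) refl) ⟨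
      h ⊗ c₁ m ⊕ (sum (λ c → X₁ c ⊕ (X₂ c ⊕ X₃ c)) ⊕ X₄)
        ≈⟨ ⊕-cong refl (⊕-cong (Ring.sum-cong-≋ {n = B} λ c →
             trans (distrib _ _ _) (⊕-cong refl (distrib _ _ _))) refl) ⟨
      h ⊗ c₁ m ⊕ (∑[ c < B ] (D (suc (toℕ c)) h ⊗ c₂ m (toℕ c)) ⊕ X₄) ∎
      where
      open ≋-Reasoning
      additive-evT : IsAdditive Λ̄-monoid (λ F → ev (T F))
      additive-evT = additive-∘ₓ additive-ev additive-T
      X₁ X₂ X₃ : Fin B → Λ̄
      X₁ c = D (suc (toℕ c)) h ⊗ c₁′ (m ℕ.+ suc (toℕ c))
      X₂ c = D (suc (toℕ c)) h ⊗ (κ (suc m) ⊗ p (suc m ℕ.+ suc (toℕ c)))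
      X₃ c = D (suc (toℕ c)) h ⊗ ∑[ b < m ] (θp (toℕ b) ⊗ p (lower b ℕ.+ suc (toℕ c)))
      X₄ z₁ z₂ : Λ̄
      X₄  = ∑[ c < B ] ∑[ d < B ] (D (suc (toℕ d)) (D (suc (toℕ c)) h) ⊗ c₃ m (toℕ c) (toℕ d))
      z₁ = κ (suc m) ⊗ c₁′ m
      z₂ = ∑[ b < m ] (θp (toℕ b) ⊗ c₁′ (m ∸ suc (toℕ b))
             ⊕ con θ ⊗ (con (K.fromℕ (suc (toℕ b))) ⊗ p (lower b ℕ.+ suc (toℕ b))))

    e₁-cong : ∀ {f g} → f ≋ g → e₁ f ≋ e₁ g
    e₁-cong e = additive-ev .cong (∂₀-cong e)

    e₁-sum : ∀ n (f : Fin n → Λ̄) → e₁ (sum f) ≋ ∑[ i < n ] e₁ (f i)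
    e₁-sum zero    f = refl
    e₁-sum (suc n) f = trans (additive-ev .+-homo (∂₀ (f zero)) _) (⊕-cong refl (e₁-sum n (f ∘ suc)))

    -- The outer Euler operator acts on p_a D_a f: differentiating p_a yields the first-order terms,
    -- differentiating D_a f the second-order ones.
    e₁²-expand : ∀ f → bound f ≤ B → e₁ (e₁ f) ≋ ∑[ a < B ] (let g = D (suc (toℕ a)) f in
      g ⊗ (con (K.fromℕ (suc (toℕ a))) ⊗ p (suc (toℕ a)))
        ⊕ ∑[ c < B ] (D (suc (toℕ c)) g ⊗ (p (suc (toℕ a)) ⊗ p (suc (toℕ c)))))
    e₁²-expand f f≤B = trans (e₁-cong (V-expand 0 f B f≤B)) (trans (e₁-sum B _) (Ring.sum-cong-≋ {n = B} λ a →
      let g = D (suc (toℕ a)) f in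
      trans (V-⊗ 0 g (p (suc (toℕ a)))) (trans (⊕-comm _ _) (⊕-cong (⊗-cong refl (V-p 0 (toℕ a)))
        (trans (⊗-cong refl (V-expand 0 g B (bound-D (suc (toℕ a)) {f} f≤B)))
        (trans (Ring.*-distribˡ-sum {n = B} (p (suc (toℕ a))) (λ c → D (suc (toℕ c)) g ⊗ p (suc (toℕ c))))
        (Ring.sum-cong-≋ {n = B} λ c → Solver.solve 3 (λ k d q → k :* (d :* q) := d :* (k :* q))
          refl (p (suc (toℕ a))) (D (suc (toℕ c)) g) (p (suc (toℕ c)))))))))) 

  -- The head of the list is the index of the innermost derivative, as in `normalOrderedPart`. No
  -- symmetrisation is made.
  coefficient : List ℕ → Λ̄
  coefficient (suc a ∷ []) = (# 4 ⊗ con θ) ⊗ c₁ a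
    ⊕ (# 2 ⊗ (con θ ⊗ con θ)) ⊗ (con (K.fromℕ (suc a)) ⊗ p (suc a))
  coefficient (suc a ∷ suc c ∷ []) = (# 4 ⊗ con θ) ⊗ c₂ a c ⊕ (# 2 ⊗ (con θ ⊗ con θ)) ⊗ (p (suc a) ⊗ p (suc c))
  coefficient (suc a ∷ suc c ∷ suc d ∷ []) = (# 4 ⊗ con θ) ⊗ c₃ a c d
  coefficient _ = con K.0#

  -- h does not involve p_0
  Free : Λ̄ → Set
  Free h = ι ((p₀↦ 0) h) ≋ h

  Free-sum : ∀ n (f : Fin n → Λ̄) → (∀ i → Free (f i)) → Free (sum f)
  Free-sum zero    f e = refl
  Free-sum (suc n) f e = ⊕-cong (e zero) (Free-sum n (f ∘ suc) (e ∘ suc))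

  Free-c₁′ : ∀ m → Free (c₁′ m)
  Free-c₁′ m = ⊕-cong refl (Free-sum m _ λ b → refl)

  -- Every p occurring here has a successor index, on which `ι ∘ (p₀↦ 0)` computes to the identity;
  -- `Free-sum` is needed where a sum of variable length blocks the computation.
  Free-coefficient : ∀ as → Free (coefficient as)
  Free-coefficient []           = refl
  Free-coefficient (zero ∷ as)  = refl
  Free-coefficient (suc a ∷ []) = ⊕-cong (⊗-cong refl (⊕-cong (⊗-cong refl (Free-c₁′ a))
    (Free-sum a _ λ b → ⊕-cong (⊗-cong refl (Free-c₁′ (a ∸ suc (toℕ b)))) refl))) refl
  Free-coefficient (suc a ∷ zero ∷ as)  = refl
  Free-coefficient (suc a ∷ suc c ∷ []) = ⊕-cong (⊗-cong refl (⊕-cong (Free-c₁′ (a ℕ.+ suc c))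
    (⊕-cong refl (Free-sum a _ λ b → refl)))) refl
  Free-coefficient (suc a ∷ suc c ∷ zero ∷ as)       = refl
  Free-coefficient (suc a ∷ suc c ∷ suc d ∷ [])      = refl
  Free-coefficient (suc a ∷ suc c ∷ suc d ∷ _ ∷ as) = refl

  normalOrder : NormalOrderIndependentOf-p₀ rhs
  -- The order is 3 because `T`, `T` and `∂` each contribute at most one derivative. Coefficients
  -- have to lie in Λ; by `Free-coefficient`, setting p_0 to 0 provides a preimage under `ι`.
  normalOrder = 3 , (p₀↦ 0) ∘ coefficient , λ f → begin
    rhs f
      ≈⟨ rhs≋ f ⟩
    x ⊗ e₃ f ⊕ y ⊗ e₁ (e₁ f)
      ≈⟨ ⊕-cong (⊗-cong refl (expand-∂₀ (additive-∘ₓ (additive-∘ₓ additive-ev additive-T) additive-T) f (bound f) ℕ.≤-refl))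
                (⊗-cong refl (e₁²-expand (bound f) f ℕ.≤-refl)) ⟩
    x ⊗ sum {n = bound f} (λ a → ev (T (T (monomial (D (suc (toℕ a)) f) (suc (toℕ a)))))) ⊕ y ⊗ sum (E² f)
      ≈⟨ ⊕-cong (Ring.*-distribˡ-sum {n = bound f} x _) (Ring.*-distribˡ-sum {n = bound f} y (E² f)) ⟩
    _ ≈⟨ Ring.∑-distrib-+ {n = bound f} (λ a → x ⊗ ev (T (T (monomial (D (suc (toℕ a)) f) (suc (toℕ a))))))
           (λ a → y ⊗ E² f a) ⟨
    sum {n = bound f} (λ a → x ⊗ ev (T (T (monomial (D (suc (toℕ a)) f) (suc (toℕ a))))) ⊕ y ⊗ E² f a)
      ≈⟨ Ring.sum-cong-≋ {n = bound f} (λ a → collect (bound f) (toℕ a) (D (suc (toℕ a)) f)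
           (bound-D (bound f) (suc (toℕ a)) {f} ℕ.≤-refl)) ⟩
    sum {n = bound f} (λ a → P₁ f a ⊕ (P₂ f a ⊕ P₃ f a))
      ≈⟨ trans (Ring.∑-distrib-+ {n = bound f} (P₁ f) (λ a → P₂ f a ⊕ P₃ f a))
           (⊕-cong refl (Ring.∑-distrib-+ {n = bound f} (P₂ f) (P₃ f))) ⟩
    sum (P₁ f) ⊕ (sum (P₂ f) ⊕ sum (P₃ f))
      -- The product with 0 is the part of order zero, whose coefficient is `c []`.
      ≈⟨ Solver.solve 4 (λ f a b c → a :+ (b :+ c) := :# 0 :* f :+ (a :+ (b :+ (c :+ :# 0)))) refl
           f (sum (P₁ f)) (sum (P₂ f)) (sum (P₃ f)) ⟩
    normalOrdered 3 (ι ∘ (p₀↦ 0) ∘ coefficient) f ∎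
    where
    open ≋-Reasoning
    x y : Λ̄
    x = # 4 ⊗ con θ
    y = # 2 ⊗ (con θ ⊗ con θ)

    c : List ℕ → Λ̄
    c = ι ∘ (p₀↦ 0) ∘ coefficient

    E² P₁ P₂ P₃ : ∀ f → Fin (bound f) → Λ̄
    E² f a = let g = D (suc (toℕ a)) f in g ⊗ (con (K.fromℕ (suc (toℕ a))) ⊗ p (suc (toℕ a)))
        ⊕ ∑[ c < bound f ] (D (suc (toℕ c)) g ⊗ (p (suc (toℕ a)) ⊗ p (suc (toℕ c))))
    P₁ f a = c (suc (toℕ a) ∷ []) ⊗ D (suc (toℕ a)) f
    P₂ f a = normalOrderedPart (bound f) 1 (λ as → c (suc (toℕ a) ∷ as)) (D (suc (toℕ a)) f)
    P₃ f a = normalOrderedPart (bound f) 2 (λ as → c (suc (toℕ a) ∷ as)) (D (suc (toℕ a)) f)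

    collect : ∀ B a g → bound g ≤ B →
      x ⊗ ev (T (T (monomial g (suc a)))) ⊕ y ⊗ (g ⊗ (con (K.fromℕ (suc a)) ⊗ p (suc a))
        ⊕ ∑[ c < B ] (D (suc (toℕ c)) g ⊗ (p (suc a) ⊗ p (suc (toℕ c)))))
      ≋ c (suc a ∷ []) ⊗ g ⊕ (normalOrderedPart B 1 (λ as → c (suc a ∷ as)) g
        ⊕ normalOrderedPart B 2 (λ as → c (suc a ∷ as)) g)
    collect B a g g≤B = begin
      _ ≈⟨ ⊕-cong (⊗-cong refl (evT²-monomial B g a g≤B)) refl ⟩
      x ⊗ (g ⊗ c₁ a ⊕ (sum X₁ ⊕ sum (λ c → sum (X₂ c)))) ⊕ y ⊗ (g ⊗ r ⊕ sum X₃)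
        ≈⟨ Solver.solve 8 (λ x g c₁ x₁ x₂ y r x₃ → x :* (g :* c₁ :+ (x₁ :+ x₂)) :+ y :* (g :* r :+ x₃)
             := (x :* c₁ :+ y :* r) :* g :+ ((x :* x₁ :+ y :* x₃) :+ x :* x₂)) refl
             x g (c₁ a) (sum X₁) (sum (λ c → sum (X₂ c))) y r (sum X₃) ⟩
      coefficient (suc a ∷ []) ⊗ g ⊕ ((x ⊗ sum X₁ ⊕ y ⊗ sum X₃) ⊕ x ⊗ sum (λ c → sum (X₂ c)))
        ≈⟨ ⊕-cong (⊗-cong (sym (Free-coefficient (suc a ∷ []))) refl) (⊕-cong second third) ⟩
      _ ∎
      where
      r : Λ̄
      r = con (K.fromℕ (suc a)) ⊗ p (suc a)
      X₁ X₃ : Fin B → Λ̄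
      X₁ c = D (suc (toℕ c)) g ⊗ c₂ a (toℕ c)
      X₃ c = D (suc (toℕ c)) g ⊗ (p (suc a) ⊗ p (suc (toℕ c)))
      X₂ : Fin B → Fin B → Λ̄
      X₂ c d = D (suc (toℕ d)) (D (suc (toℕ c)) g) ⊗ c₃ a (toℕ c) (toℕ d)

      second : x ⊗ sum X₁ ⊕ y ⊗ sum X₃ ≋ normalOrderedPart B 1 (λ as → c (suc a ∷ as)) g
      second = trans (⊕-cong (Ring.*-distribˡ-sum {n = B} x X₁) (Ring.*-distribˡ-sum {n = B} y X₃))
        (trans (sym (Ring.∑-distrib-+ {n = B} (λ c → x ⊗ X₁ c) (λ c → y ⊗ X₃ c))) (Ring.sum-cong-≋ {n = B} λ c →
        trans (Solver.solve 5 (λ x d e y f → x :* (d :* e) :+ y :* (d :* f) := (x :* e :+ y :* f) :* d) refl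
          x (D (suc (toℕ c)) g) (c₂ a (toℕ c)) y (p (suc a) ⊗ p (suc (toℕ c))))
        (⊗-cong (sym (Free-coefficient (suc a ∷ suc (toℕ c) ∷ []))) refl)))

      third : x ⊗ sum (λ c → sum (X₂ c)) ≋ normalOrderedPart B 2 (λ as → c (suc a ∷ as)) g
      third = trans (Ring.*-distribˡ-sum {n = B} x (λ c → sum (X₂ c))) (Ring.sum-cong-≋ {n = B} λ c →
        trans (Ring.*-distribˡ-sum {n = B} x (X₂ c)) (Ring.sum-cong-≋ {n = B} λ d →
        trans (Solver.solve 3 (λ x d e → x :* (d :* e) := (x :* e) :* d) refl
          x (D (suc (toℕ d)) (D (suc (toℕ c)) g)) (c₃ a (toℕ c) (toℕ d)))
        (⊗-cong (sym (Free-coefficient (suc a ∷ suc (toℕ c) ∷ suc (toℕ d) ∷ []))) refl)))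

  -- The operator 𝒬₄

  module _ (M : ℕ) where

    private
      Λ_M : Set
      Λ_M = Poly (Fin M)

    -- Makes a composite in a product of series vanish as soon as its inner factor does.
    record IsPointed (F : Op M) : Set where
      field
        cong   : ∀ {f g} → f ≋ g → F f ≋ F g
        0-homo : F (con K.0#) ≋ con K.0#

    open IsPointed

    pointed-≋0 : ∀ {F} → IsPointed F → ∀ {f} → f ≋ con K.0# → F f ≋ con K.0#
    pointed-≋0 F-pointed e = trans (F-pointed .cong e) (F-pointed .0-homo)

    pointed-⊕ : ∀ {F G} → IsPointed F → IsPointed G → IsPointed (λ f → F f ⊕ G f)
    pointed-⊕ F-p G-p .cong e = ⊕-cong (F-p .cong e) (G-p .cong e)
    pointed-⊕ F-p G-p .0-homo = trans (⊕-cong (F-p .0-homo) (G-p .0-homo)) (⊕-identity _)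

    pointed-⊖ : ∀ {F} → IsPointed F → IsPointed (λ f → ⊖ F f)
    pointed-⊖ F-p .cong e = ⊖-cong (F-p .cong e)
    pointed-⊖ F-p .0-homo = trans (⊖-cong (F-p .0-homo)) Ring.-0#≈0#

    pointed-⊗ : ∀ a {F} → IsPointed F → IsPointed (λ f → a ⊗ F f)
    pointed-⊗ a F-p .cong e = ⊗-cong refl (F-p .cong e)
    pointed-⊗ a F-p .0-homo = trans (⊗-cong refl (F-p .0-homo)) (Ring.zeroʳ a)

    pointed-sum : ∀ n {F : Fin n → Op M} → (∀ i → IsPointed (F i)) → IsPointed (λ f → ∑[ i < n ] F i f)
    pointed-sum n F-p .cong e = Ring.sum-cong-≋ {n = n} λ i → F-p i .cong e
    pointed-sum n F-p .0-homo = sum-0 n λ i → F-p i .0-homo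

    pointed-id : IsPointed id
    pointed-id .cong e = e
    pointed-id .0-homo = refl

    pointed-fold : ∀ {F} → IsPointed F → ∀ n → IsPointed (λ f → fold f F n)
    pointed-fold F-p zero = pointed-id
    pointed-fold F-p (suc n) .cong e = F-p .cong (pointed-fold F-p n .cong e)
    pointed-fold F-p (suc n) .0-homo = pointed-≋0 F-p (pointed-fold F-p n .0-homo)

    pointed-𝒫 : ∀ r → IsPointed (𝒫 M r)
    pointed-𝒫 zero    = pointed-⊗ _ pointed-id
    pointed-𝒫 (suc r) = pointed-sum M λ i →
      pointed-fold (record { cong = x𝒟-cong i ; 0-homo = x𝒟-0 i }) (suc r)

    pointed-Ḡ : ∀ r → IsPointed (Ḡ M r)
    pointed-Ḡ zero    = pointed-id
    pointed-Ḡ (suc m) = pointed-⊖ (pointed-⊗ _ (pointed-sum (suc m) λ r →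
      pointed-⊗ (con (K.fromℕ (m choose toℕ r) K.* (K.- (θ K.* K.fromℕ M)) K.^ (m ∸ toℕ r))) (pointed-𝒫 (toℕ r))))

    pointed-Φ : ∀ r → IsPointed (Φ M r)
    pointed-Φ zero    = pointed-id
    pointed-Φ (suc r) = pointed-⊕ (pointed-Ḡ (suc r)) (pointed-⊗ _ (pointed-Ḡ r))

    -- 1 - Φ is divisible by z²: this is what the factor 1 + θ N z achieves.
    u : OpSeries M
    u = 1ₛ −ₛ Φ M

    pointed-u : ∀ r → IsPointed (u r)
    pointed-u zero    = pointed-⊕ pointed-id (pointed-⊖ (pointed-Φ zero))
    pointed-u (suc r) = pointed-⊕ (record { cong = λ _ → refl ; 0-homo = refl }) (pointed-⊖ (pointed-Φ (suc r)))

    private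
      N θ′ C′ : Λ_M
      N  = con (K.fromℕ M)
      θ′ = con θ
      C′ = θ′ ⊗ N

    𝒫̄-expand : ∀ m f → 𝒫̄ M m f ≋ ∑[ r < suc m ] ((# (m choose toℕ r) ⊗ (⊖ C′) ↑ (m ∸ toℕ r)) ⊗ 𝒫 M (toℕ r) f)
    𝒫̄-expand m f = Ring.sum-cong-≋ {n = suc m} λ r →
      ⊗-cong (scalar (m choose toℕ r) (m ∸ toℕ r)) (refl {f = 𝒫 M (toℕ r) f})
      where
      scalar : ∀ n k → con (K.fromℕ n K.* (K.- (θ K.* K.fromℕ M)) K.^ k) ≋ # n ⊗ (⊖ C′) ↑ k
      scalar n k = trans (con-* _ _) (⊗-cong (con-fromℕ n) (trans (con-^ _ k)
        (↑-cong k (trans (con-neg _) (⊖-cong (con-* _ _))))))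

    module _ (f : Λ_M) where

      private
        P₁ P₂ P₃ : Λ_M
        P₁ = 𝒫 M 1 f
        P₂ = 𝒫 M 2 f
        P₃ = 𝒫 M 3 f

        Φ-expand : ∀ r → Φ M (suc (suc r)) f ≋ (⊖ (θ′ ⊗ ∑[ k < suc (suc r) ]
            ((# (suc r choose toℕ k) ⊗ (⊖ C′) ↑ (suc r ∸ toℕ k)) ⊗ 𝒫 M (toℕ k) f)))
          ⊕ C′ ⊗ ⊖ (θ′ ⊗ ∑[ k < suc r ] ((# (r choose toℕ k) ⊗ (⊖ C′) ↑ (r ∸ toℕ k)) ⊗ 𝒫 M (toℕ k) f))
        Φ-expand r = ⊕-cong (⊖-cong (⊗-cong refl (𝒫̄-expand (suc r) f)))
          (⊗-cong (con-* _ _) (⊖-cong (⊗-cong refl (𝒫̄-expand r f))))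

      u₀ : u 0 f ≋ con K.0#
      u₀ = Ring.-‿inverseʳ f

      -- The coefficient of z in Φ is θ N - θ 𝒫̄_0, and 𝒫̄_0 = 𝒫_0 is multiplication by N.
      u₁ : u 1 f ≋ con K.0#
      u₁ = trans (⊕-cong refl (⊖-cong (⊕-cong (⊖-cong (⊗-cong refl (𝒫̄-expand 0 f))) (⊗-cong (con-* _ _) refl))))
        (Solver.solve 3 (λ t n f → :# 0 :+ :- (:- (t :* ((:# 1 :* :# 1) :* (n :* f) :+ :# 0)) :+ (t :* n) :* f) := :# 0)
          refl θ′ N f)

      u₂ : u 2 f ≋ θ′ ⊗ P₁
      u₂ = trans (⊕-cong refl (⊖-cong (Φ-expand 0)))
        (Solver.solve 4 (λ t n f p₁ → let y = :- (t :* n); p₀ = n :* f in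
          :# 0 :+ :- (:- (t :* ((:# 1 :* (y :* :# 1)) :* p₀ :+ ((:# 1 :* :# 1) :* p₁ :+ :# 0)))
            :+ (t :* n) :* :- (t :* ((:# 1 :* :# 1) :* p₀ :+ :# 0)))
          := t :* p₁) refl θ′ N f P₁)

      -- The coefficient is θ (𝒫̄_3 + θ N 𝒫̄_2). With X = x_i 𝒟_i and C = θ N this is θ times the
      -- sum over i of (X - C)³ + C (X - C)² = X (X - C)²; in particular 𝒫_0 drops out.
      u₄ : u 4 f ≋ θ′ ⊗ (P₃ ⊕ ⊖ ((# 2 ⊗ C′) ⊗ P₂) ⊕ (C′ ⊗ C′) ⊗ P₁)
      u₄ = trans (⊕-cong refl (⊖-cong (Φ-expand 2)))
        (Solver.solve 6 (λ t n f p₁ p₂ p₃ → let y = :- (t :* n); p₀ = n :* f in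
          :# 0 :+ :- (:- (t :* ((:# 1 :* (y :* (y :* (y :* :# 1)))) :* p₀ :+ ((:# 3 :* (y :* (y :* :# 1))) :* p₁
              :+ ((:# 3 :* (y :* :# 1)) :* p₂ :+ ((:# 1 :* :# 1) :* p₃ :+ :# 0)))))
            :+ (t :* n) :* :- (t :* ((:# 1 :* (y :* (y :* :# 1))) :* p₀ :+ ((:# 2 :* (y :* :# 1)) :* p₁
              :+ ((:# 1 :* :# 1) :* p₂ :+ :# 0)))))
          := t :* (p₃ :+ :- ((:# 2 :* (t :* n)) :* p₂) :+ ((t :* n) :* (t :* n)) :* p₁)) refl θ′ N f P₁ P₂ P₃)

    𝒫₁-· : ∀ a f → 𝒫 M 1 (a · f) ≋ a · 𝒫 M 1 f
    𝒫₁-· a f = trans (Ring.sum-cong-≋ {n = M} λ i → x𝒟-· i a f) (sym (Ring.*-distribˡ-sum {n = M} (con a) (λ i → x𝒟 i f)))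

    -- As `u` starts at z², its m-th power starts at z^{2m}: in each summand either the left index
    -- is at most 1, or the right index is below 2(m - 1). For r = 4 only m = 1 and m = 2 survive in
    -- the logarithm.
    u^-vanish : ∀ m {r} → r < m ℕ.* 2 → ∀ f → (u ^ₛ m) r f ≋ con K.0#
    u^-vanish (suc m) {r} r<2m f = sum-0 (suc r) λ j → term (toℕ j) (ℕ.s≤s⁻¹ (Fin.toℕ<n j))
      where
      term : ∀ j → j ≤ r → u j ((u ^ₛ m) (r ∸ j) f) ≋ con K.0#
      term zero          _   = u₀ _
      term (suc zero)    _   = u₁ _
      term (suc (suc j)) j≤r = pointed-≋0 (pointed-u (suc (suc j))) (u^-vanish m (smaller j≤r) f)
        where
        -- The bound on j supplies 2 ≤ r, which the truncated subtraction requires.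
        smaller : suc (suc j) ≤ r → r ∸ suc (suc j) < m ℕ.* 2
        smaller j≤r = ℕ.≤-trans (ℕ.s≤s (ℕ.∸-monoʳ-≤ r (s≤s (s≤s z≤n))))
          (ℕ.≤-trans (ℕ.≤-reflexive (≡.sym (ℕ.+-∸-assoc 1 (ℕ.≤-trans (s≤s (s≤s z≤n)) j≤r)))) (ℕ.∸-monoˡ-≤ 2 r<2m))

    -- `u ^ₛ 1` is the convolution of `u` with `1ₛ`; only its last summand meets the constant term
    -- of `1ₛ`.
    u^1 : ∀ r f → (u ^ₛ 1) r f ≋ u r f
    u^1 r f = trans (sum-last r _ λ j j<r → pointed-≋0 (pointed-u j) (1ₛ-vanish (ℕ.m<n⇒0<n∸m j<r)))
      (≡⇒≋ (≡.cong (λ k → u r (1ₛ k f)) (ℕ.n∸n≡0 r)))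
      where
      1ₛ-vanish : ∀ {k} → 0 < k → 1ₛ k f ≋ con K.0#
      1ₛ-vanish (s≤s _) = refl

      sum-last : ∀ r (g : ℕ → Λ_M) → (∀ j → j < r → g j ≋ con K.0#) → ∑[ j < suc r ] g (toℕ j) ≋ g r
      sum-last zero    g e = Ring.+-identityʳ _
      sum-last (suc r) g e = trans (⊕-cong (e 0 (s≤s z≤n)) (sum-last r (g ∘ suc) λ j j<r → e (suc j) (s≤s j<r))) (⊕-identity _)

    -- The indices 2 + 2 are the only way to reach 4 with both at least 2, so this is `u 2` composed
    -- with itself.
    u^2 : ∀ f → (u ^ₛ 2) 4 f ≋ (θ′ ⊗ θ′) ⊗ 𝒫 M 1 (𝒫 M 1 f)
    u^2 f = begin
      (u ^ₛ 2) 4 f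
        ≈⟨ ⊕-cong (u₀ _) (⊕-cong (u₁ _) (⊕-cong square (⊕-cong (vanish 1 3 (s≤s (s≤s z≤n)))
             (⊕-cong (vanish 0 4 (s≤s z≤n)) refl)))) ⟩
      con K.0# ⊕ (con K.0# ⊕ ((θ′ ⊗ θ′) ⊗ 𝒫 M 1 (𝒫 M 1 f) ⊕ (con K.0# ⊕ (con K.0# ⊕ con K.0#))))
        ≈⟨ Solver.solve 1 (λ x → :# 0 :+ (:# 0 :+ (x :+ (:# 0 :+ (:# 0 :+ :# 0)))) := x) refl _ ⟩
      (θ′ ⊗ θ′) ⊗ 𝒫 M 1 (𝒫 M 1 f) ∎
      where
      open ≋-Reasoning
      vanish : ∀ r j → r < 2 → u j ((u ^ₛ 1) r f) ≋ con K.0#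
      vanish r j r<2 = pointed-≋0 (pointed-u j) (u^-vanish 1 r<2 f)

      square : u 2 ((u ^ₛ 1) 2 f) ≋ (θ′ ⊗ θ′) ⊗ 𝒫 M 1 (𝒫 M 1 f)
      square = trans (pointed-u 2 .cong (trans (u^1 2 f) (u₂ f))) (trans (u₂ _)
        (trans (⊗-cong refl (𝒫₁-· θ (𝒫 M 1 f))) (sym (⊗-assoc _ _ _))))

    𝒬₄ : ∀ f → 𝒬 M 4 f ≋ (# 4 ⊗ θ′) ⊗ (𝒫 M 3 f ⊕ ⊖ ((# 2 ⊗ C′) ⊗ 𝒫 M 2 f) ⊕ (C′ ⊗ C′) ⊗ 𝒫 M 1 f)
      ⊕ (# 2 ⊗ (θ′ ⊗ θ′)) ⊗ 𝒫 M 1 (𝒫 M 1 f)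
    𝒬₄ f = begin
      𝒬 M 4 f
        ≈⟨ ⊗-cong (con-fromℕ 4) (⊕-cong (⊗-cong 1/1 (trans (u^1 4 f) (u₄ f))) (⊕-cong (⊗-cong refl (u^2 f))
             (⊕-cong (⊗-cong refl (u^-vanish 3 (s≤s (s≤s (s≤s (s≤s (s≤s z≤n))))) f))
             (⊕-cong (⊗-cong refl (u^-vanish 4 (s≤s (s≤s (s≤s (s≤s (s≤s z≤n))))) f)) refl)))) ⟩
      # 4 ⊗ (con K.1# ⊗ (θ′ ⊗ Q′) ⊕ (h ⊗ ((θ′ ⊗ θ′) ⊗ Q″) ⊕ (con 1/[1+ 2 ] ⊗ con K.0# ⊕ (con 1/[1+ 3 ] ⊗ con K.0# ⊕ con K.0#))))
        ≈⟨ Solver.solve 6 (λ t x h y a b → :# 4 :* (:# 1 :* (t :* x) :+ (h :* ((t :* t) :* y) :+ (a :* :# 0 :+ (b :* :# 0 :+ :# 0))))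
             := (:# 4 :* t) :* x :+ (:# 2 :* h) :* ((:# 2 :* (t :* t)) :* y)) refl θ′ Q′ h Q″ (con 1/[1+ 2 ]) (con 1/[1+ 3 ]) ⟩
      (# 4 ⊗ θ′) ⊗ Q′ ⊕ (# 2 ⊗ h) ⊗ ((# 2 ⊗ (θ′ ⊗ θ′)) ⊗ Q″)
        ≈⟨ ⊕-cong refl (trans (⊗-cong (sym half) refl) (⊗-identity _)) ⟩
      (# 4 ⊗ θ′) ⊗ Q′ ⊕ (# 2 ⊗ (θ′ ⊗ θ′)) ⊗ Q″ ∎
      where
      open ≋-Reasoning
      Q′ Q″ h : Λ_M
      Q′ = 𝒫 M 3 f ⊕ ⊖ ((# 2 ⊗ C′) ⊗ 𝒫 M 2 f) ⊕ (C′ ⊗ C′) ⊗ 𝒫 M 1 f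
      Q″ = 𝒫 M 1 (𝒫 M 1 f)
      h = con 1/[1+ 1 ]

      1/1 : con 1/[1+ 0 ] ≋ con {X = Fin M} K.1#
      1/1 = con-cong (K.trans (K.sym (K.*-identityˡ _)) (K.trans (K.*-congʳ (K.sym (K.+-identityʳ K.1#)))
        (Scalars.1/[1+n]-inverse S 0)))

  -- The induced operators agree

  module _ (N M : ℕ) where

    open Specialization N M

    induces : ∀ g → π M ((rhs at-p₀= N) g) ≋ 𝒬 M 4 (π M g)
    induces g = begin
      π̄ (rhs (ι g))
        ≈⟨ π̄-cong (rhs≋ (ι g)) ⟩
      (# 4 ⊗ con θ) ⊗ E₃ ⊕ (# 2 ⊗ (con θ ⊗ con θ)) ⊗ π̄ (e₁ (e₁ (ι g)))
        -- This is T² = (T + c)² - 2c (T + c) + c², written for the values after `∂`; the three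
        -- groups are the right-hand sides of `𝒫₃`, `𝒫₂` and `𝒫₁`.
        ≈⟨ ⊕-cong (⊗-cong refl (Solver.solve 4 (λ c e₁ e₂ e₃ → e₃
             := e₃ :+ (:# 2 :* c) :* e₂ :+ (c :* c) :* e₁ :+ :- ((:# 2 :* c) :* (e₂ :+ c :* e₁)) :+ (c :* c) :* e₁)
             refl (con c) E₁ E₂ E₃)) refl ⟩
      (# 4 ⊗ con θ) ⊗ (E₃ ⊕ (# 2 ⊗ con c) ⊗ E₂ ⊕ (con c ⊗ con c) ⊗ E₁
          ⊕ ⊖ ((# 2 ⊗ con c) ⊗ (E₂ ⊕ con c ⊗ E₁)) ⊕ (con c ⊗ con c) ⊗ E₁)
        ⊕ (# 2 ⊗ (con θ ⊗ con θ)) ⊗ π̄ (e₁ (e₁ (ι g)))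
        ≈⟨ ⊕-cong (⊗-cong refl (⊕-cong (⊕-cong (𝒫≋ 3 (𝒫₃ (ι g))) (⊖-cong (⊗-cong (⊗-cong refl c≋) (𝒫≋ 2 (𝒫₂ (ι g))))))
                    (⊗-cong (⊗-cong c≋ c≋) (𝒫≋ 1 (𝒫₁ (ι g))))))
                  (⊗-cong refl (trans (sym (𝒫₁ (e₁ (ι g)))) (pointed-𝒫 M 1 .cong (𝒫≋ 1 (𝒫₁ (ι g)))))) ⟩
      _ ≈⟨ 𝒬₄ M (π M g) ⟨
      𝒬 M 4 (π M g) ∎
      where
      open ≋-Reasoning
      open IsPointed
      E₁ E₂ E₃ : Poly (Fin M)
      E₁ = π̄ (e₁ (ι g))
      E₂ = π̄ (e₂ (ι g))
      E₃ = π̄ (e₃ (ι g))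

      c≋ : con c ≋ con θ ⊗ con (K.fromℕ M)
      c≋ = con-* _ _

      𝒫≋ : ∀ r {f} → 𝒫 M r (π̄ (ι g)) ≋ f → f ≋ 𝒫 M r (π M g)
      𝒫≋ r e = trans (sym e) (pointed-𝒫 M r .cong (π̄-ι g))

  identity×normalOrder : ((N : ℕ) → (rhs at-p₀= N) Induces (λ M → 𝒬 M 4)) × NormalOrderIndependentOf-p₀ rhs
  identity×normalOrder = induces , normalOrder

open import Defs

proposition5p5 :
  let rhs : Λ̄ → Λ̄
      rhs f = (K.fromℕ 4 K.* θ) · 𝓛 3 (K.- θ) f
            ⊕ ⊖ ((K.fromℕ 6 K.* θ K.^ 2) · (p 0 ⊗ 𝓛 2 (K.- θ) f))
            ⊕ (K.fromℕ 4 K.* θ K.^ 3) · (p 0 ↑ 2 ⊗ E f)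
  in ((N : ℕ) → (rhs at-p₀= N) Induces (λ M → 𝒬 M 4))
   × NormalOrderIndependentOf-p₀ rhs
proposition5p5 = Generic.identity×normalOrder ℚ⟨α⟩-scalars
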